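{- Let $f(X)=a_nX^n+\cdots+a_1X+a_0$ be a polynomial with real coefficients, with $n\ge 1$ and $a_n>0$. Denote by $j_1<j_2<\cdots<j_\ell$ the indices $j$ for which $a_j<0$, and by $k_1<k_2<\cdots<k_t=n$ the indices $k>j_\ell$ for which $a_k>0$. Let $$v=\min_{1\le r\le t}\ \max_{1\le i\le \ell}\left(\frac{|a_{j_1}+a_{j_2}+\cdots+a_{j_\ell}|}{a_{k_r}}\right)^{\frac{1}{k_r-j_i}}.$$ Then $f$ has no zero in the sector $S_{v,\frac{\pi}{n}}$.
   Context: For real numbers $v,\theta$ with $0<\theta\le\pi$, define the open sector $S_{v,\theta}=\{z=v+\rho e^{i\varphi}\in\mathbb{C}:\rho>0,\ |\varphi|<\theta\}$ (with $\varphi$ real). If $f$ has no negative coefficients ($\ell=0$), the condition $k>j_\ell$ is void and the maximum over the empty set is understood to be $0$, i.e. $v=0$. -}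

module Defs where

open import Algebra.Bundles.Raw using (RawSemiring)
import Algebra.Definitions.RawSemiring as RawSemiringDefinitions
open import Data.Empty using (⊥-elim)
open import Data.Fin as Fin using (Fin; toℕ; fromℕ)
open import Data.Integer as ℤ using ()
import Data.Integer.Properties as ℤₚ
open import Data.Nat as ℕ using (ℕ; zero; suc; _!)
import Data.Nat.Properties as ℕₚ
open import Data.Product using (∃; _×_; _,_; proj₁; proj₂)
open import Data.Rational as ℚ using (ℚ; 0ℚ; 1ℚ)
import Data.Rational.Properties as ℚₚ
open import Data.Rational.Solver using (module +-*-Solver)
import Data.Rational.Unnormalised as ℚᵘ
import Data.Rational.Unnormalised.Properties as ℚᵘₚ
open import Data.Sum using (_⊎_; inj₁; inj₂)
open import Data.Vec.Functional using (Vector; head; tail; foldr)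
open import Function.Bundles using (_⇔_; Equivalence)
open import Level using (0ℓ)
open import Relation.Binary.Core using (_Preserves_⟶_)
open import Relation.Binary.PropositionalEquality
open import Relation.Nullary using (¬_; yes; no)

-- Estimates on rationals, used below to show that each pointwise operation on
-- representing sequences yields a Cauchy sequence again.
module RationalSequences where
  open import Data.Rational renaming (∣_∣ to abs)
  open import Data.Rational.Properties
  open +-*-Solver
  open RawSemiringDefinitions +-*-rawSemiring public using (_^_)

  ι : ℕ → ℚ
  ι n = ℤ.+ n / 1

  recip : (m : ℕ) .{{_ : ℕ.NonZero m}} → ℚ
  recip m = ℤ.+ 1 / m

  unnorm : ∀ n d → toℚᵘ (ℤ.+ n / suc d) ℚᵘ.≃ ℚᵘ.mkℚᵘ (ℤ.+ n) d
  unnorm n d = toℚᵘ-fromℚᵘ (ℚᵘ.mkℚᵘ (ℤ.+ n) d)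

  ι-suc : ∀ n → ι (suc n) ≡ 1ℚ + ι n
  ι-suc n = toℚᵘ-injective (ℚᵘₚ.≃-trans (unnorm (suc n) 0) (ℚᵘₚ.≃-sym
    (ℚᵘₚ.≃-trans (toℚᵘ-homo-+ 1ℚ (ι n)) (ℚᵘₚ.≃-trans (ℚᵘₚ.+-congʳ ℚᵘ.1ℚᵘ (unnorm n 0)) (ℚᵘ.*≡* (cong (λ k → (ℤ.+ 1 ℤ.+ k) ℤ.* ℤ.+ 1) (ℤₚ.*-identityʳ (ℤ.+ n))))))))

  ι-recip : ∀ m → ι (suc m) * recip (suc m) ≡ 1ℚ
  ι-recip m = toℚᵘ-injective (ℚᵘₚ.≃-trans (toℚᵘ-homo-* (ι (suc m)) (recip (suc m)))
    (ℚᵘₚ.≃-trans (ℚᵘₚ.*-cong (unnorm (suc m) 0) (unnorm 1 m)) (ℚᵘ.*≡* (cong ℤ.+_ (trans (ℕₚ.*-identityʳ _) (trans (ℕₚ.*-identityʳ _) (sym (trans (ℕₚ.*-identityˡ _) (ℕₚ.*-identityˡ _)))))))))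

  recip-* : ∀ m n .{{_ : ℕ.NonZero m}} .{{_ : ℕ.NonZero n}} .{{_ : ℕ.NonZero (m ℕ.* n)}} → recip (m ℕ.* n) ≡ recip m * recip n
  recip-* (suc m) (suc n) = toℚᵘ-injective (ℚᵘₚ.≃-trans (unnorm 1 (n ℕ.+ m ℕ.* suc n)) (ℚᵘₚ.≃-sym (ℚᵘₚ.≃-trans (toℚᵘ-homo-* (recip (suc m)) (recip (suc n)))
    (ℚᵘₚ.*-cong (unnorm 1 m) (unnorm 1 n)))))

  bound : ∀ q → q ≤ ι ℤ.∣ ↥ q ∣
  bound q@(mkℚ n d c) = toℚᵘ-cancel-≤ (ℚᵘₚ.≤-trans (ℚᵘ.*≤* le) (ℚᵘₚ.≤-reflexive (ℚᵘₚ.≃-sym (unnorm ℤ.∣ n ∣ 0))))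
    where
    open ℤₚ.≤-Reasoning
    le : n ℤ.* ℤ.+ 1 ℤ.≤ ℤ.+ ℤ.∣ n ∣ ℤ.* ℤ.+ suc d
    le = begin
      n ℤ.* ℤ.+ 1 ≡⟨ ℤₚ.*-identityʳ n ⟩
      n         ≤⟨ n≤ n ⟩
      ℤ.+ ℤ.∣ n ∣  ≤⟨ ℤ.+≤+ (ℕₚ.m≤m*n ℤ.∣ n ∣ (suc d)) ⟩
      ℤ.+ (ℤ.∣ n ∣ ℕ.* suc d) ≡⟨ ℤₚ.pos-* ℤ.∣ n ∣ (suc d) ⟩
      ℤ.+ ℤ.∣ n ∣ ℤ.* ℤ.+ suc d ∎
      where
      n≤ : ∀ n → n ℤ.≤ ℤ.+ ℤ.∣ n ∣
      n≤ (ℤ.+ n) = ℤₚ.≤-refl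
      n≤ ℤ.-[1+ n ] = ℤ.-≤+

  0<1 : 0ℚ < 1ℚ
  0<1 = positive⁻¹ 1ℚ

  +-nn : ∀ {a b} → 0ℚ ≤ a → 0ℚ ≤ b → 0ℚ ≤ a + b
  +-nn {a} {b} p q = nonNegative⁻¹ (a + b) {{nonNeg+nonNeg⇒nonNeg a {{nonNegative p}} b {{nonNegative q}}}}

  *-nn : ∀ {a b} → 0ℚ ≤ a → 0ℚ ≤ b → 0ℚ ≤ a * b
  *-nn {a} {b} p q = nonNegative⁻¹ (a * b) {{nonNeg*nonNeg⇒nonNeg a {{nonNegative p}} b {{nonNegative q}}}}

  +-pos : ∀ {a b} → 0ℚ < a → 0ℚ ≤ b → 0ℚ < a + b
  +-pos {a} {b} p q = positive⁻¹ (a + b) {{pos+nonNeg⇒pos a {{positive p}} b {{nonNegative q}}}}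

  *-pos : ∀ {a b} → 0ℚ < a → 0ℚ < b → 0ℚ < a * b
  *-pos {a} {b} p q = positive⁻¹ (a * b) {{pos*pos⇒pos a {{positive p}} b {{positive q}}}}

  diff : ∀ {p q} → p ≤ q → 0ℚ ≤ q - p
  diff {p} {q} h = subst (_≤ q - p) (+-inverseʳ p) (+-monoˡ-≤ (- p) h)

  diff< : ∀ {p q} → p < q → 0ℚ < q - p
  diff< {p} {q} h = subst (_< q - p) (+-inverseʳ p) (+-monoˡ-< (- p) h)

  p+[q-p] : ∀ p q → p + (q - p) ≡ q
  p+[q-p] = solve 2 (λ p q → p :+ (q :- p) := q) refl

  by : ∀ {p q} r → q - p ≡ r → 0ℚ ≤ r → p ≤ q
  by {p} {q} r e h = subst₂ _≤_ (+-identityʳ p) (trans (cong (p +_) (sym e)) (p+[q-p] p q)) (+-monoʳ-≤ p h)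

  by< : ∀ {p q} r → q - p ≡ r → 0ℚ < r → p < q
  by< {p} {q} r e h = subst₂ _<_ (+-identityʳ p) (trans (cong (p +_) (sym e)) (p+[q-p] p q)) (+-monoʳ-< p h)

  ι-nn : ∀ n → 0ℚ ≤ ι n
  ι-nn zero    = ≤-refl
  ι-nn (suc n) = subst (0ℚ ≤_) (sym (ι-suc n)) (+-nn (<⇒≤ 0<1) (ι-nn n))

  ι-pos : ∀ n → 0ℚ < ι (suc n)
  ι-pos n = subst (0ℚ <_) (sym (ι-suc n)) (+-pos 0<1 (ι-nn n))

  ι-mono : ∀ {m n} → m ℕ.≤ n → ι m ≤ ι n
  ι-mono {n = n} ℕ.z≤n = ι-nn n
  ι-mono (ℕ.s≤s {m} {n} h) = subst₂ _≤_ (sym (ι-suc m)) (sym (ι-suc n)) (+-monoʳ-≤ 1ℚ (ι-mono h))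

  recip-pos : ∀ n .{{_ : ℕ.NonZero n}} → 0ℚ < recip n
  recip-pos n = positive⁻¹ (recip n) {{normalize-pos 1 n}}

  ∣∣≤ : ∀ {p b} → p ≤ b → - p ≤ b → abs p ≤ b
  ∣∣≤ {p} {b} h k with ∣p∣≡p∨∣p∣≡-p p
  ... | inj₁ e = subst (_≤ b) (sym e) h
  ... | inj₂ e = subst (_≤ b) (sym e) k

  ∣∣< : ∀ {p b} → p < b → - p < b → abs p < b
  ∣∣< {p} {b} h k with ∣p∣≡p∨∣p∣≡-p p
  ... | inj₁ e = subst (_< b) (sym e) h
  ... | inj₂ e = subst (_< b) (sym e) k

  p≤∣p∣ : ∀ p → p ≤ abs p
  p≤∣p∣ p with ∣p∣≡p∨∣p∣≡-p p
  ... | inj₁ e = ≤-reflexive (sym e)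
  ... | inj₂ e = by (abs p + abs p) (cong (λ r → abs p + r) (sym e)) (+-nn (0≤∣p∣ p) (0≤∣p∣ p))

  ∣-∣-sym : ∀ p q → abs (p - q) ≡ abs (q - p)
  ∣-∣-sym p q = trans (sym (∣-p∣≡∣p∣ (p - q))) (cong abs (solve 2 (λ p q → :- (p :- q) := q :- p) refl p q))

  triangle : ∀ p q r → abs (p - r) ≤ abs (p - q) + abs (q - r)
  triangle p q r = subst (λ z → abs z ≤ abs (p - q) + abs (q - r))
    (solve 3 (λ p q r → (p :- q) :+ (q :- r) := p :- r) refl p q r) (∣p+q∣≤∣p∣+∣q∣ (p - q) (q - r))

  *-mono-nn : ∀ {a b c d} → 0ℚ ≤ a → a ≤ b → 0ℚ ≤ c → c ≤ d → a * c ≤ b * d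
  *-mono-nn {a} {b} {c} {d} 0≤a a≤b 0≤c c≤d = by ((b - a) * d + a * (d - c))
    (solve 4 (λ a b c d → b :* d :- a :* c := (b :- a) :* d :+ a :* (d :- c)) refl a b c d)
    (+-nn (*-nn (diff a≤b) (≤-trans 0≤c c≤d)) (*-nn 0≤a (diff c≤d)))

  half : ∀ ε → ½ * ε + ½ * ε ≡ ε
  half ε = trans (sym (*-distribʳ-+ ε ½ ½)) (*-identityˡ ε)

  half-pos : ∀ {ε} → 0ℚ < ε → 0ℚ < ½ * ε
  half-pos = *-pos (positive⁻¹ ½)

  inv : ℚ → ℚ
  inv q with q ≟ 0ℚ
  ... | yes _   = 0ℚ
  ... | no  q≢0 = (1/ q) {{≢-nonZero q≢0}}

  inv-* : ∀ {q} → 0ℚ < q → q * inv q ≡ 1ℚ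
  inv-* {q} 0<q with q ≟ 0ℚ
  ... | yes e   = ⊥-elim (<-irrefl (sym e) 0<q)
  ... | no  q≢0 = *-inverseʳ q {{≢-nonZero q≢0}}

  inv-pos : ∀ {q} → 0ℚ < q → 0ℚ < inv q
  inv-pos {q} 0<q with q ≟ 0ℚ
  ... | yes e   = ⊥-elim (<-irrefl (sym e) 0<q)
  ... | no  q≢0 = positive⁻¹ _ {{1/pos⇒pos q {{positive 0<q}}}}

  inv-diff : ∀ {a b} → 0ℚ < a → 0ℚ < b → inv a - inv b ≡ (b - a) * (inv a * inv b)
  inv-diff {a} {b} 0<a 0<b = trans (cong₂ _-_ (trans (sym (*-identityʳ i)) (cong (i *_) (sym (inv-* 0<b))))
                                              (trans (sym (*-identityʳ j)) (cong (j *_) (sym (inv-* 0<a)))))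
    (solve 4 (λ a b i j → i :* (b :* j) :- j :* (a :* i) := (b :- a) :* (i :* j)) refl a b i j)
    where
    i = inv a
    j = inv b

  inv-anti : ∀ {a b} → 0ℚ < a → a ≤ b → inv b ≤ inv a
  inv-anti {a} {b} 0<a a≤b = by _ (inv-diff 0<a 0<b) (*-nn (diff a≤b) (<⇒≤ (*-pos (inv-pos 0<a) (inv-pos 0<b))))
    where 0<b = <-≤-trans 0<a a≤b

  recip-small : ∀ {ε} → 0ℚ < ε → ∃ λ N → ∀ n → N ℕ.≤ n → recip (suc n) ≤ ε
  recip-small {ε} 0<ε = ℤ.∣ ↥ inv ε ∣ , λ n N≤n → let g = recip (suc n) in
    by (ε * g * (ι (suc n) - inv ε))
       (trans (cong₂ _-_ (trans (sym (*-identityʳ ε)) (cong (ε *_) (sym (ι-recip n))))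
                         (trans (sym (*-identityʳ g)) (cong (g *_) (sym (inv-* 0<ε)))))
              (solve 4 (λ e g i v → e :* (i :* g) :- g :* (e :* v) := e :* g :* (i :- v)) refl ε g (ι (suc n)) (inv ε)))
       (*-nn (<⇒≤ (*-pos 0<ε (recip-pos (suc n))))
             (diff (≤-trans (bound (inv ε)) (ι-mono (ℕₚ.m≤n⇒m≤1+n N≤n)))))

  IsCauchy : (ℕ → ℚ) → Set
  IsCauchy f = ∀ ε → 0ℚ < ε → ∃ λ N → ∀ m n → N ℕ.≤ m → N ℕ.≤ n → abs (f m - f n) < ε

  cauchy-scaled : ∀ f C → 0ℚ < C →
    (∀ ε → 0ℚ < ε → ∃ λ N → ∀ m n → N ℕ.≤ m → N ℕ.≤ n → abs (f m - f n) ≤ C * ε) → IsCauchy f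
  cauchy-scaled f C 0<C h ε 0<ε with h (½ * ε * inv C) (*-pos (half-pos 0<ε) (inv-pos 0<C))
  ... | N , k = N , λ m n N≤m N≤n → ≤-<-trans (k m n N≤m N≤n) (by< (½ * ε) eq (half-pos 0<ε))
    where
    eq : ε - C * (½ * ε * inv C) ≡ ½ * ε
    eq = trans (cong₂ _-_ (sym (half ε)) (trans (solve 3 (λ c e i → c :* (e :* i) := e :* (c :* i)) refl C (½ * ε) (inv C))
                                                (trans (cong (½ * ε *_) (inv-* 0<C)) (*-identityʳ (½ * ε)))))
               (solve 1 (λ h → h :+ h :- h := h) refl (½ * ε))

  cauchy-one-sided : ∀ f →
    (∀ ε → 0ℚ < ε → ∃ λ N → ∀ m n → N ℕ.≤ m → N ℕ.≤ n → f m - f n < ε) → IsCauchy f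
  cauchy-one-sided f h ε 0<ε with h ε 0<ε
  ... | N , k = N , λ m n N≤m N≤n → ∣∣< (k m n N≤m N≤n)
    (subst (_< ε) (solve 2 (λ p q → q :- p := :- (p :- q)) refl (f m) (f n)) (k n m N≤n N≤m))

  cauchy-cases : ∀ f C → 0ℚ < C →
    (∀ ε → 0ℚ < ε → ∃ λ N → ∀ m n → N ℕ.≤ n → n ℕ.≤ m → abs (f m - f n) ≤ C * ε) → IsCauchy f
  cauchy-cases f C 0<C h = cauchy-scaled f C 0<C λ ε 0<ε → proj₁ (h ε 0<ε) , λ m n N≤m N≤n →
    case ε 0<ε m n N≤m N≤n (ℕₚ.≤-total n m)
    where
    case : ∀ ε 0<ε m n → _ → _ → _ → _
    case ε 0<ε m n N≤m N≤n (inj₁ n≤m) = proj₂ (h ε 0<ε) m n N≤n n≤m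
    case ε 0<ε m n N≤m N≤n (inj₂ m≤n) = subst (_≤ C * ε) (∣-∣-sym (f n) (f m)) (proj₂ (h ε 0<ε) n m N≤m m≤n)

  Bounded : (ℕ → ℚ) → ℚ → Set
  Bounded f B = ∃ λ N → ∀ n → N ℕ.≤ n → abs (f n) ≤ B

  bounded : ∀ {f} → IsCauchy f → ∃ λ B → 1ℚ ≤ B × Bounded f B
  bounded {f} c with c 1ℚ 0<1
  ... | N , k = 1ℚ + abs (f N) , by (abs (f N)) (solve 1 (λ a → con 1ℚ :+ a :- con 1ℚ := a) refl (abs (f N))) (0≤∣p∣ (f N)) , N , λ n N≤n →
    ≤-trans (subst (λ z → abs z ≤ abs (f n - f N) + abs (f N)) (solve 2 (λ a b → a :- b :+ b := a) refl (f n) (f N)) (∣p+q∣≤∣p∣+∣q∣ (f n - f N) (f N)))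
            (+-monoˡ-≤ (abs (f N)) (<⇒≤ (k n N N≤n ℕₚ.≤-refl)))

  const-cauchy : ∀ q → IsCauchy (λ _ → q)
  const-cauchy q ε 0<ε = 0 , λ m n _ _ → subst (λ z → abs z < ε) (sym (+-inverseʳ q)) 0<ε

  module _ {f : ℕ → ℚ} (cf : IsCauchy f) where

    neg-cauchy : IsCauchy (λ n → - f n)
    neg-cauchy ε 0<ε with cf ε 0<ε
    ... | N , k = N , λ m n N≤m N≤n → subst (λ z → abs z < ε) (solve 2 (λ p q → q :- p := :- p :- :- q) refl (f m) (f n)) (k n m N≤n N≤m)

    abs-cauchy : IsCauchy (λ n → abs (f n))
    abs-cauchy = cauchy-one-sided (λ n → abs (f n)) λ ε 0<ε → proj₁ (cf ε 0<ε) , λ m n N≤m N≤n →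
      ≤-<-trans (by (abs (f m - f n) + abs (f n) - abs (f m))
                    (solve 3 (λ a b c → a :- (b :- c) := a :+ c :- b) refl (abs (f m - f n)) (abs (f m)) (abs (f n)))
                    (diff (subst (λ z → abs z ≤ abs (f m - f n) + abs (f n)) (solve 2 (λ a b → a :- b :+ b := a) refl (f m) (f n)) (∣p+q∣≤∣p∣+∣q∣ (f m - f n) (f n)))))
                (proj₂ (cf ε 0<ε) m n N≤m N≤n)

    inv-cauchy : ∀ {δ} → 0ℚ < δ → (∃ λ N → ∀ n → N ℕ.≤ n → δ ≤ f n) → IsCauchy (λ n → inv (f n))
    inv-cauchy {δ} 0<δ (M , low) = cauchy-scaled (λ n → inv (f n)) (D * D) (*-pos 0<D 0<D) λ ε 0<ε →
      M ℕ.⊔ proj₁ (cf ε 0<ε) , λ m n N≤m N≤n → let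
        lm = low m (ℕₚ.≤-trans (ℕₚ.m≤m⊔n M _) N≤m)
        ln = low n (ℕₚ.≤-trans (ℕₚ.m≤m⊔n M _) N≤n)
        0<m = <-≤-trans 0<δ lm
        0<n = <-≤-trans 0<δ ln
        k = proj₂ (cf ε 0<ε) n m (ℕₚ.≤-trans (ℕₚ.m≤n⊔m M _) N≤n) (ℕₚ.≤-trans (ℕₚ.m≤n⊔m M _) N≤m)
        ii = <⇒≤ (*-pos (inv-pos 0<m) (inv-pos 0<n)) in
      ≤-trans (≤-reflexive (trans (cong abs (inv-diff 0<m 0<n)) (trans (∣p*q∣≡∣p∣*∣q∣ (f n - f m) _) (trans (cong (abs (f n - f m) *_) (0≤p⇒∣p∣≡p ii)) (*-comm (abs (f n - f m)) _)))))
              (*-mono-nn ii (*-mono-nn (<⇒≤ (inv-pos 0<m)) (inv-anti 0<δ lm) (<⇒≤ (inv-pos 0<n)) (inv-anti 0<δ ln)) (0≤∣p∣ _) (<⇒≤ k))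
      where
      D = inv δ
      0<D = inv-pos 0<δ

  +-est : ∀ a b c d {ε} → abs (a - b) ≤ ε → abs (c - d) ≤ ε → abs (a + c - (b + d)) ≤ (1ℚ + 1ℚ) * ε
  +-est a b c d {ε} h k = begin
    abs (a + c - (b + d))      ≡⟨ cong abs (solve 4 (λ a b c d → a :+ c :- (b :+ d) := (a :- b) :+ (c :- d)) refl a b c d) ⟩
    abs ((a - b) + (c - d))    ≤⟨ ∣p+q∣≤∣p∣+∣q∣ (a - b) (c - d) ⟩
    abs (a - b) + abs (c - d)    ≤⟨ +-mono-≤ h k ⟩
    ε + ε                    ≡⟨ cong₂ _+_ (*-identityˡ ε) (*-identityˡ ε) ⟨
    1ℚ * ε + 1ℚ * ε          ≡⟨ *-distribʳ-+ ε 1ℚ 1ℚ ⟨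
    (1ℚ + 1ℚ) * ε            ∎
    where open ≤-Reasoning

  *-est : ∀ a b c d {A B ε} → abs a ≤ A → abs d ≤ B → abs (a - b) ≤ ε → abs (c - d) ≤ ε →
          abs (a * c - b * d) ≤ (A + B) * ε
  *-est a b c d {A} {B} {ε} ha hd h k = begin
    abs (a * c - b * d)                        ≡⟨ cong abs (solve 4 (λ a b c d → a :* c :- b :* d := a :* (c :- d) :+ d :* (a :- b)) refl a b c d) ⟩
    abs (a * (c - d) + d * (a - b))            ≤⟨ ∣p+q∣≤∣p∣+∣q∣ (a * (c - d)) (d * (a - b)) ⟩
    abs (a * (c - d)) + abs (d * (a - b))        ≡⟨ cong₂ _+_ (∣p*q∣≡∣p∣*∣q∣ a (c - d)) (∣p*q∣≡∣p∣*∣q∣ d (a - b)) ⟩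
    abs a * abs (c - d) + abs d * abs (a - b)    ≤⟨ +-mono-≤ (*-mono-nn (0≤∣p∣ a) ha (0≤∣p∣ (c - d)) k) (*-mono-nn (0≤∣p∣ d) hd (0≤∣p∣ (a - b)) h) ⟩
    A * ε + B * ε                            ≡⟨ *-distribʳ-+ ε A B ⟨
    (A + B) * ε                              ∎
    where open ≤-Reasoning

  ⊔-est₁ : ∀ a b c d {ε} → abs (a - b) ≤ ε → abs (c - d) ≤ ε → (a ⊔ c) - (b ⊔ d) ≤ ε
  ⊔-est₁ a b c d {ε} h k = by (ε + (b ⊔ d) - (a ⊔ c)) (solve 3 (λ e s t → e :- (s :- t) := e :+ t :- s) refl ε (a ⊔ c) (b ⊔ d))
    (diff (⊔-lub (step a b h (p≤p⊔q b d)) (step c d k (p≤q⊔p b d))))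
    where
    step : ∀ x y {s} → abs (x - y) ≤ ε → y ≤ s → x ≤ ε + s
    step x y {s} h l = by ((ε - (x - y)) + (s - y)) (solve 4 (λ e a b s → e :+ s :- a := (e :- (a :- b)) :+ (s :- b)) refl ε x y s)
      (+-nn (diff (≤-trans (p≤∣p∣ (x - y)) h)) (diff l))

  ⊔-est : ∀ a b c d {ε} → abs (a - b) ≤ ε → abs (c - d) ≤ ε → abs ((a ⊔ c) - (b ⊔ d)) ≤ ε
  ⊔-est a b c d {ε} h k = ∣∣≤ (⊔-est₁ a b c d h k)
    (subst (_≤ ε) (solve 2 (λ p q → q :- p := :- (p :- q)) refl (a ⊔ c) (b ⊔ d))
      (⊔-est₁ b a d c (subst (_≤ ε) (∣-∣-sym a b) h) (subst (_≤ ε) (∣-∣-sym c d) k)))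

  ⊓-est₁ : ∀ a b c d {ε} → abs (a - b) ≤ ε → abs (c - d) ≤ ε → b ⊓ d - a ⊓ c ≤ ε
  ⊓-est₁ a b c d {ε} h k = by (a ⊓ c - (b ⊓ d - ε)) (solve 3 (λ e s t → e :- (t :- s) := s :- (t :- e)) refl ε (a ⊓ c) (b ⊓ d))
    (diff (⊓-glb (step a b h (p⊓q≤p b d)) (step c d k (p⊓q≤q b d))))
    where
    step : ∀ x y {s} → abs (x - y) ≤ ε → s ≤ y → s - ε ≤ x
    step x y {s} h l = by ((ε - (y - x)) + (y - s)) (solve 4 (λ e a b s → a :- (s :- e) := (e :- (b :- a)) :+ (b :- s)) refl ε x y s)
      (+-nn (diff (≤-trans (p≤∣p∣ (y - x)) (subst (_≤ ε) (∣-∣-sym x y) h))) (diff l))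

  ⊓-est : ∀ a b c d {ε} → abs (a - b) ≤ ε → abs (c - d) ≤ ε → abs (a ⊓ c - b ⊓ d) ≤ ε
  ⊓-est a b c d {ε} h k = ∣∣≤
    (⊓-est₁ b a d c (subst (_≤ ε) (∣-∣-sym a b) h) (subst (_≤ ε) (∣-∣-sym c d) k))
    (subst (_≤ ε) (solve 2 (λ p q → q :- p := :- (p :- q)) refl (a ⊓ c) (b ⊓ d)) (⊓-est₁ a b c d h k))

  module _ {f g : ℕ → ℚ} (cf : IsCauchy f) (cg : IsCauchy g) where

    both : ∀ ε → 0ℚ < ε → ∃ λ N → ∀ m n → N ℕ.≤ m → N ℕ.≤ n → abs (f m - f n) ≤ ε × abs (g m - g n) ≤ ε
    both ε 0<ε with cf ε 0<ε | cg ε 0<ε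
    ... | M , h | N , k = M ℕ.⊔ N , λ m n p q →
      <⇒≤ (h m n (ℕₚ.≤-trans (ℕₚ.m≤m⊔n M N) p) (ℕₚ.≤-trans (ℕₚ.m≤m⊔n M N) q)) ,
      <⇒≤ (k m n (ℕₚ.≤-trans (ℕₚ.m≤n⊔m M N) p) (ℕₚ.≤-trans (ℕₚ.m≤n⊔m M N) q))

    +-cauchy : IsCauchy (λ n → f n + g n)
    +-cauchy = cauchy-scaled (λ n → f n + g n) (1ℚ + 1ℚ) (positive⁻¹ (1ℚ + 1ℚ)) λ ε 0<ε →
      let (N , h) = both ε 0<ε in N , λ m n p q → +-est (f m) (f n) (g m) (g n) (proj₁ (h m n p q)) (proj₂ (h m n p q))

    ⊔-cauchy : IsCauchy (λ n → f n ⊔ g n)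
    ⊔-cauchy = cauchy-scaled (λ n → f n ⊔ g n) 1ℚ 0<1 λ ε 0<ε →
      let (N , h) = both ε 0<ε in N , λ m n p q →
        subst (abs ((f m ⊔ g m) - (f n ⊔ g n)) ≤_) (sym (*-identityˡ ε)) (⊔-est (f m) (f n) (g m) (g n) (proj₁ (h m n p q)) (proj₂ (h m n p q)))

    ⊓-cauchy : IsCauchy (λ n → f n ⊓ g n)
    ⊓-cauchy = cauchy-scaled (λ n → f n ⊓ g n) 1ℚ 0<1 λ ε 0<ε →
      let (N , h) = both ε 0<ε in N , λ m n p q →
        subst (abs (f m ⊓ g m - f n ⊓ g n) ≤_) (sym (*-identityˡ ε)) (⊓-est (f m) (f n) (g m) (g n) (proj₁ (h m n p q)) (proj₂ (h m n p q)))

    *-cauchy : IsCauchy (λ n → f n * g n)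
    *-cauchy = helper (bounded cf) (bounded cg)
      where
      helper : (∃ λ A → 1ℚ ≤ A × Bounded f A) → (∃ λ B → 1ℚ ≤ B × Bounded g B) → IsCauchy (λ n → f n * g n)
      helper (A , 1≤A , M , hA) (B , 1≤B , N , hB) =
        cauchy-scaled (λ n → f n * g n) (A + B) (+-pos (<-≤-trans 0<1 1≤A) (≤-trans (<⇒≤ 0<1) 1≤B)) λ ε 0<ε →
          let (P , h) = both ε 0<ε in M ℕ.+ N ℕ.+ P , λ m n p q →
            let r = h m n (ℕₚ.≤-trans (ℕₚ.m≤n+m P (M ℕ.+ N)) p) (ℕₚ.≤-trans (ℕₚ.m≤n+m P (M ℕ.+ N)) q)
                p′ = ℕₚ.≤-trans (ℕₚ.m≤m+n (M ℕ.+ N) P) p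
                q′ = ℕₚ.≤-trans (ℕₚ.m≤m+n (M ℕ.+ N) P) q
            in *-est (f m) (f n) (g m) (g n) (hA m (ℕₚ.≤-trans (ℕₚ.m≤m+n M N) p′)) (hB n (ℕₚ.≤-trans (ℕₚ.m≤n+m N M) q′)) (proj₁ r) (proj₂ r)

  ^-nn : ∀ {a} → 0ℚ ≤ a → ∀ k → 0ℚ ≤ a ^ k
  ^-nn h zero    = <⇒≤ 0<1
  ^-nn h (suc k) = *-nn h (^-nn h k)

  ^-pos : ∀ {a} → 0ℚ < a → ∀ k → 0ℚ < a ^ k
  ^-pos h zero    = 0<1
  ^-pos h (suc k) = *-pos h (^-pos h k)

  ^-mono : ∀ {a b} → 0ℚ ≤ a → a ≤ b → ∀ k → a ^ k ≤ b ^ k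
  ^-mono h l zero    = ≤-refl
  ^-mono h l (suc k) = *-mono-nn h l (^-nn h k) (^-mono h l k)

  ^-super : ∀ {a b} → 0ℚ ≤ a → 0ℚ ≤ b → ∀ k → a ^ suc k + b ^ suc k ≤ (a + b) ^ suc k
  ^-super {a} {b} h l zero    = ≤-reflexive (solve 2 (λ a b → a :* con 1ℚ :+ b :* con 1ℚ := (a :+ b) :* con 1ℚ) refl a b)
  ^-super {a} {b} h l (suc k) = by ((a + b) * (s - (a ^ suc k + b ^ suc k)) + (a * (b ^ suc k) + b * (a ^ suc k)))
    (solve 5 (λ a b s x y → (a :+ b) :* s :- (a :* x :+ b :* y) := (a :+ b) :* (s :- (x :+ y)) :+ (a :* y :+ b :* x)) refl a b s (a ^ suc k) (b ^ suc k))
    (+-nn (*-nn (+-nn h l) (diff (^-super h l k))) (+-nn (*-nn h (^-nn l (suc k))) (*-nn l (^-nn h (suc k)))))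
    where s = (a + b) ^ suc k

  1≤^ : ∀ {c} → 1ℚ ≤ c → ∀ k → 1ℚ ≤ c ^ k
  1≤^ h zero    = ≤-refl
  1≤^ {c} h (suc k) = subst (_≤ c ^ suc k) (*-identityˡ 1ℚ) (*-mono-nn (<⇒≤ 0<1) h (<⇒≤ 0<1) (1≤^ h k))

  ^-≥ : ∀ {c} → 1ℚ ≤ c → ∀ k → c ≤ c ^ suc k
  ^-≥ {c} h k = subst (_≤ c ^ suc k) (*-identityʳ c) (*-mono-nn (≤-trans (<⇒≤ 0<1) h) ≤-refl (<⇒≤ 0<1) (1≤^ h k))

  ∑ : (ℕ → ℚ) → ℕ → ℚ
  ∑ t zero    = 0ℚ
  ∑ t (suc n) = ∑ t n + t n

  term : (ℕ → ℚ) → ℚ → ℕ → ℚ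
  term c x k = c k * (x ^ k * recip (k !) {{ℕₚ._!≢0 k}})

  module _ {C : ℚ} (1≤C : 1ℚ ≤ C) where

    u : ℕ → ℚ
    u k = C ^ k * recip (k !) {{ℕₚ._!≢0 k}}

    0≤C : 0ℚ ≤ C
    0≤C = ≤-trans (<⇒≤ 0<1) 1≤C

    u-nn : ∀ k → 0ℚ ≤ u k
    u-nn k = *-nn (^-nn 0≤C k) (<⇒≤ (recip-pos (k !) {{ℕₚ._!≢0 k}}))

    u-suc : ∀ k → u (suc k) ≡ u k * (C * recip (suc k))
    u-suc k = trans (cong (C * C ^ k *_) (recip-* (suc k) (k !) {{_}} {{ℕₚ._!≢0 k}} {{ℕₚ._!≢0 (suc k)}}))
      (solve 4 (λ c p r s → c :* p :* (r :* s) := p :* s :* (c :* r)) refl C (C ^ k) (recip (suc k)) (recip (k !) {{ℕₚ._!≢0 k}}))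

    K : ℕ
    K = ℤ.∣ ↥ (C + C) ∣

    u-halves : ∀ k → K ℕ.≤ k → u (suc k) + u (suc k) ≤ u k
    u-halves k K≤k = subst (λ z → z + z ≤ u k) (sym (u-suc k)) (by (u k * r * (ι (suc k) - (C + C)))
      (trans (cong (_- (u k * (C * r) + u k * (C * r))) (trans (sym (*-identityʳ (u k))) (cong (u k *_) (sym (ι-recip k)))))
             (solve 4 (λ u c r i → u :* (i :* r) :- (u :* (c :* r) :+ u :* (c :* r)) := u :* r :* (i :- (c :+ c))) refl (u k) C r (ι (suc k))))
      (*-nn (*-nn (u-nn k) (<⇒≤ (recip-pos (suc k)))) (diff (≤-trans (bound (C + C)) (ι-mono (ℕₚ.m≤n⇒m≤1+n K≤k))))))
      where r = recip (suc k)

    -- ∑ u n + 2 u n is nonincreasing from K on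
    ∑u-step : ∀ d n → K ℕ.≤ n → ∑ u (d ℕ.+ n) + (u (d ℕ.+ n) + u (d ℕ.+ n)) ≤ ∑ u n + (u n + u n)
    ∑u-step zero    n K≤n = ≤-refl
    ∑u-step (suc d) n K≤n = ≤-trans (by (u e - (u (suc e) + u (suc e)))
      (solve 3 (λ s u v → s :+ (u :+ u) :- (s :+ u :+ (v :+ v)) := u :- (v :+ v)) refl (∑ u e) (u e) (u (suc e)))
      (diff (u-halves e (ℕₚ.≤-trans K≤n (ℕₚ.m≤n+m n d))))) (∑u-step d n K≤n)
      where e = d ℕ.+ n

    M : ℚ
    M = ∑ u K + (u K + u K)

    ∑u-nn : ∀ n → 0ℚ ≤ ∑ u n
    ∑u-nn zero    = ≤-refl
    ∑u-nn (suc n) = +-nn (∑u-nn n) (u-nn n)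

    M-nn : 0ℚ ≤ M
    M-nn = +-nn (∑u-nn K) (+-nn (u-nn K) (u-nn K))

    ∑u≤M : ∀ n → K ℕ.≤ n → ∑ u n ≤ M
    ∑u≤M n K≤n = subst (λ n → ∑ u n ≤ M) (ℕₚ.m∸n+n≡m K≤n)
      (≤-trans (by (u e + u e) (solve 2 (λ s u → s :+ u :- s := u) refl (∑ u e) (u e + u e)) (+-nn (u-nn e) (u-nn e)))
               (∑u-step (n ℕ.∸ K) K ℕₚ.≤-refl))
      where e = n ℕ.∸ K ℕ.+ K

    u-decay : ∀ j → ι (suc j) * u (j ℕ.+ K) ≤ u K
    u-decay zero    = ≤-reflexive (*-identityˡ (u K))
    u-decay (suc j) = ≤-trans (subst (λ z → z * b ≤ ι (suc j) * a) (sym (ι-suc (suc j)))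
      (by (ι (suc j) * (a - (b + b)) + ι j * b)
          (trans (cong (λ i → i * a - (1ℚ + i) * b) (ι-suc j))
            (trans (solve 3 (λ i a b → (con 1ℚ :+ i) :* a :- (con 1ℚ :+ (con 1ℚ :+ i)) :* b := (con 1ℚ :+ i) :* (a :- (b :+ b)) :+ i :* b) refl (ι j) a b)
                   (cong (λ i → i * (a - (b + b)) + ι j * b) (sym (ι-suc j)))))
          (+-nn (*-nn (ι-nn (suc j)) (diff (u-halves (j ℕ.+ K) (ℕₚ.m≤n+m K j)))) (*-nn (ι-nn j) (u-nn (suc j ℕ.+ K))))))
      (u-decay j)
      where
      a = u (j ℕ.+ K)
      b = u (suc j ℕ.+ K)

    u-small : ∀ {ε} → 0ℚ < ε → ∃ λ N → ∀ n → N ℕ.≤ n → u n ≤ ε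
    u-small {ε} 0<ε = L ℕ.+ K , λ n N≤n → let j = n ℕ.∸ K in
      subst (λ n → u n ≤ ε) (ℕₚ.m∸n+n≡m (ℕₚ.≤-trans (ℕₚ.m≤n+m K L) N≤n))
        (*-cancelˡ-≤-pos (ι (suc j)) {{positive (ι-pos j)}} (≤-trans (u-decay j) (uK≤ j (subst (ℕ._≤ j) (ℕₚ.m+n∸n≡m L K) (ℕₚ.∸-monoˡ-≤ K N≤n)))))
      where
      L = ℤ.∣ ↥ (u K * inv ε) ∣
      uK≤ : ∀ j → L ℕ.≤ j → u K ≤ ι (suc j) * ε
      uK≤ j L≤j = subst (_≤ ι (suc j) * ε)
        (trans (*-assoc (u K) (inv ε) ε) (trans (cong (u K *_) (trans (*-comm (inv ε) ε) (inv-* 0<ε))) (*-identityʳ (u K))))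
        (*-mono-nn (*-nn (u-nn K) (<⇒≤ (inv-pos 0<ε))) (≤-trans (bound (u K * inv ε)) (ι-mono (ℕₚ.m≤n⇒m≤1+n L≤j))) (<⇒≤ 0<ε) ≤-refl)

    module _ {B : ℚ} (1≤B : 1ℚ ≤ B) (C≡2B : C ≡ B + B) (c : ℕ → ℚ) (c≤1 : ∀ k → abs (c k) ≤ 1ℚ) where

      0≤B : 0ℚ ≤ B
      0≤B = ≤-trans (<⇒≤ 0<1) 1≤B

      B≤C : B ≤ C
      B≤C = subst (B ≤_) (sym C≡2B) (by B (solve 1 (λ b → b :+ b :- b := b) refl B) 0≤B)

      pow≤ : ∀ x → abs x ≤ B → ∀ k → abs (x ^ k) ≤ C ^ k
      pow≤ x h zero    = ≤-refl
      pow≤ x h (suc k) = ≤-trans (≤-reflexive (∣p*q∣≡∣p∣*∣q∣ x (x ^ k)))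
        (*-mono-nn (0≤∣p∣ x) (≤-trans h B≤C) (0≤∣p∣ (x ^ k)) (pow≤ x h k))

      pow-diff : ∀ x y → abs x ≤ B → abs y ≤ B → ∀ k → abs (x ^ k - y ^ k) ≤ C ^ k * abs (x - y)
      pow-diff x y hx hy zero    = *-nn (<⇒≤ 0<1) (0≤∣p∣ (x - y))
      pow-diff x y hx hy (suc k) = begin
        abs (x * x ^ k - y * y ^ k)
          ≡⟨ cong abs (solve 4 (λ x y a b → x :* a :- y :* b := x :* (a :- b) :+ b :* (x :- y)) refl x y (x ^ k) (y ^ k)) ⟩
        abs (x * (x ^ k - y ^ k) + y ^ k * (x - y))
          ≤⟨ ∣p+q∣≤∣p∣+∣q∣ (x * (x ^ k - y ^ k)) (y ^ k * (x - y)) ⟩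
        abs (x * (x ^ k - y ^ k)) + abs (y ^ k * (x - y))
          ≡⟨ cong₂ _+_ (∣p*q∣≡∣p∣*∣q∣ x (x ^ k - y ^ k)) (∣p*q∣≡∣p∣*∣q∣ (y ^ k) (x - y)) ⟩
        abs x * abs (x ^ k - y ^ k) + abs (y ^ k) * abs (x - y)
          ≤⟨ +-mono-≤ (*-mono-nn (0≤∣p∣ x) hx (0≤∣p∣ (x ^ k - y ^ k)) (pow-diff x y hx hy k))
                      (*-mono-nn (0≤∣p∣ (y ^ k)) (pow≤ y hy k) (0≤∣p∣ (x - y)) ≤-refl) ⟩
        B * (C ^ k * abs (x - y)) + C ^ k * abs (x - y)
          ≤⟨ by ((B - 1ℚ) * (C ^ k * abs (x - y)))
                (solve 2 (λ b t → b :* t :+ b :* t :- (b :* t :+ t) := (b :- con 1ℚ) :* t) refl B (C ^ k * abs (x - y)))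
                (*-nn (diff 1≤B) (*-nn (^-nn 0≤C k) (0≤∣p∣ (x - y)))) ⟩
        B * (C ^ k * abs (x - y)) + B * (C ^ k * abs (x - y))
          ≡⟨ solve 3 (λ b p d → b :* (p :* d) :+ b :* (p :* d) := (b :+ b) :* p :* d) refl B (C ^ k) (abs (x - y)) ⟩
        (B + B) * C ^ k * abs (x - y)
          ≡⟨ cong (λ z → z * C ^ k * abs (x - y)) (sym C≡2B) ⟩
        C ^ suc k * abs (x - y) ∎
        where open ≤-Reasoning

      scaled≤ : ∀ p k r → 0ℚ ≤ r → abs (c k * (p * r)) ≤ abs p * r
      scaled≤ p k r 0≤r = begin
        abs (c k * (p * r))        ≡⟨ ∣p*q∣≡∣p∣*∣q∣ (c k) (p * r) ⟩
        abs (c k) * abs (p * r)      ≤⟨ *-mono-nn (0≤∣p∣ (c k)) (c≤1 k) (0≤∣p∣ (p * r)) ≤-refl ⟩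
        1ℚ * abs (p * r)           ≡⟨ *-identityˡ (abs (p * r)) ⟩
        abs (p * r)                ≡⟨ ∣p*q∣≡∣p∣*∣q∣ p r ⟩
        abs p * abs r            ≡⟨ cong (abs p *_) (0≤p⇒∣p∣≡p 0≤r) ⟩
        abs p * r                ∎
        where open ≤-Reasoning

      term≤ : ∀ x → abs x ≤ B → ∀ k → abs (term c x k) ≤ u k
      term≤ x h k = ≤-trans (scaled≤ (x ^ k) k r 0≤r) (*-mono-nn (0≤∣p∣ (x ^ k)) (pow≤ x h k) 0≤r ≤-refl)
        where
        r = recip (k !) {{ℕₚ._!≢0 k}}
        0≤r = <⇒≤ (recip-pos (k !) {{ℕₚ._!≢0 k}})

      term-diff : ∀ x y → abs x ≤ B → abs y ≤ B → ∀ k → abs (term c x k - term c y k) ≤ u k * abs (x - y)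
      term-diff x y hx hy k = begin
        abs (c k * (x ^ k * r) - c k * (y ^ k * r))
          ≡⟨ cong abs (solve 4 (λ c a b r → c :* (a :* r) :- c :* (b :* r) := c :* ((a :- b) :* r)) refl (c k) (x ^ k) (y ^ k) r) ⟩
        abs (c k * ((x ^ k - y ^ k) * r))   ≤⟨ scaled≤ (x ^ k - y ^ k) k r 0≤r ⟩
        abs (x ^ k - y ^ k) * r             ≤⟨ *-mono-nn (0≤∣p∣ (x ^ k - y ^ k)) (pow-diff x y hx hy k) 0≤r ≤-refl ⟩
        C ^ k * abs (x - y) * r             ≡⟨ solve 3 (λ p d r → p :* d :* r := p :* r :* d) refl (C ^ k) (abs (x - y)) r ⟩
        u k * abs (x - y)                   ∎
        where
        open ≤-Reasoning
        r = recip (k !) {{ℕₚ._!≢0 k}}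
        0≤r = <⇒≤ (recip-pos (k !) {{ℕₚ._!≢0 k}})

      sum-diff : ∀ x y → abs x ≤ B → abs y ≤ B → ∀ n → abs (∑ (term c x) n - ∑ (term c y) n) ≤ ∑ u n * abs (x - y)
      sum-diff x y hx hy zero    = ≤-reflexive (sym (*-zeroˡ (abs (x - y))))
      sum-diff x y hx hy (suc n) = begin
        abs (S + s - (T + t))      ≡⟨ cong abs (solve 4 (λ a b c d → a :+ b :- (c :+ d) := (a :- c) :+ (b :- d)) refl S s T t) ⟩
        abs ((S - T) + (s - t))    ≤⟨ ∣p+q∣≤∣p∣+∣q∣ (S - T) (s - t) ⟩
        abs (S - T) + abs (s - t)    ≤⟨ +-mono-≤ (sum-diff x y hx hy n) (term-diff x y hx hy n) ⟩
        ∑ u n * abs (x - y) + u n * abs (x - y)  ≡⟨ *-distribʳ-+ (abs (x - y)) (∑ u n) (u n) ⟨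
        (∑ u n + u n) * abs (x - y)            ∎
        where
        open ≤-Reasoning
        S = ∑ (term c x) n
        T = ∑ (term c y) n
        s = term c x n
        t = term c y n

      tail-diff : ∀ x → abs x ≤ B → ∀ d n → abs (∑ (term c x) (d ℕ.+ n) - ∑ (term c x) n) ≤ ∑ u (d ℕ.+ n) - ∑ u n
      tail-diff x h zero    n = ≤-reflexive (trans (cong abs (+-inverseʳ (∑ (term c x) n))) (sym (+-inverseʳ (∑ u n))))
      tail-diff x h (suc d) n = begin
        abs (S + s - T)            ≡⟨ cong abs (solve 3 (λ a b c → a :+ b :- c := (a :- c) :+ b) refl S s T) ⟩
        abs ((S - T) + s)          ≤⟨ ∣p+q∣≤∣p∣+∣q∣ (S - T) s ⟩
        abs (S - T) + abs s        ≤⟨ +-mono-≤ (tail-diff x h d n) (term≤ x h (d ℕ.+ n)) ⟩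
        (U - V) + v              ≡⟨ solve 3 (λ a b c → (a :- c) :+ b := a :+ b :- c) refl U v V ⟩
        U + v - V                ∎
        where
        open ≤-Reasoning
        S = ∑ (term c x) (d ℕ.+ n)
        T = ∑ (term c x) n
        s = term c x (d ℕ.+ n)
        U = ∑ u (d ℕ.+ n)
        V = ∑ u n
        v = u (d ℕ.+ n)

      ∑u-tail : ∀ d n → K ℕ.≤ n → ∑ u (d ℕ.+ n) - ∑ u n ≤ u n + u n
      ∑u-tail d n K≤n = by ((V + (v + v) - (U + (w + w))) + (w + w))
        (solve 4 (λ a b c d → b :+ b :- (c :- a) := (a :+ (b :+ b) :- (c :+ (d :+ d))) :+ (d :+ d)) refl V v U w)
        (+-nn (diff (∑u-step d n K≤n)) (+-nn (u-nn (d ℕ.+ n)) (u-nn (d ℕ.+ n))))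
        where
        U = ∑ u (d ℕ.+ n)
        V = ∑ u n
        v = u n
        w = u (d ℕ.+ n)

      series-est : ∀ x y {ε} → abs x ≤ B → abs y ≤ B → abs (x - y) ≤ ε → ∀ m n → K ℕ.≤ n → n ℕ.≤ m → u n ≤ ε →
                   abs (∑ (term c x) m - ∑ (term c y) n) ≤ ((1ℚ + 1ℚ) + M) * ε
      series-est x y {ε} hx hy hxy m n K≤n n≤m un≤ε = begin
        abs (∑ (term c x) m - ∑ (term c y) n)
          ≤⟨ triangle (∑ (term c x) m) (∑ (term c x) n) (∑ (term c y) n) ⟩
        abs (∑ (term c x) m - ∑ (term c x) n) + abs (∑ (term c x) n - ∑ (term c y) n)
          ≤⟨ +-mono-≤ first second ⟩
        (1ℚ + 1ℚ) * ε + M * ε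
          ≡⟨ *-distribʳ-+ ε (1ℚ + 1ℚ) M ⟨
        ((1ℚ + 1ℚ) + M) * ε ∎
        where
        open ≤-Reasoning
        first : abs (∑ (term c x) m - ∑ (term c x) n) ≤ (1ℚ + 1ℚ) * ε
        first = subst (λ m → abs (∑ (term c x) m - ∑ (term c x) n) ≤ (1ℚ + 1ℚ) * ε) (ℕₚ.m∸n+n≡m n≤m)
          (≤-trans (tail-diff x hx (m ℕ.∸ n) n) (≤-trans (∑u-tail (m ℕ.∸ n) n K≤n)
            (≤-trans (+-mono-≤ un≤ε un≤ε)
              (≤-reflexive (sym (trans (*-distribʳ-+ ε 1ℚ 1ℚ) (cong₂ _+_ (*-identityˡ ε) (*-identityˡ ε))))))))
        second : abs (∑ (term c x) n - ∑ (term c y) n) ≤ M * ε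
        second = ≤-trans (sum-diff x y hx hy n) (*-mono-nn (∑u-nn n) (∑u≤M n K≤n) (0≤∣p∣ (x - y)) hxy)

  series-cauchy : ∀ c → (∀ k → abs (c k) ≤ 1ℚ) → ∀ {f} → IsCauchy f → IsCauchy (λ n → ∑ (term c (f n)) n)
  series-cauchy c c≤1 {f} cf = helper (bounded cf)
    where
    helper : (∃ λ B → 1ℚ ≤ B × Bounded f B) → IsCauchy (λ n → ∑ (term c (f n)) n)
    helper (B , 1≤B , P , h) = cauchy-cases (λ n → ∑ (term c (f n)) n) ((1ℚ + 1ℚ) + M 1≤C)
      (+-pos (positive⁻¹ (1ℚ + 1ℚ)) (M-nn 1≤C)) λ ε 0<ε →
        let (Q , k) = cf ε 0<ε
            (R , l) = u-small 1≤C 0<ε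
            N = P ℕ.+ Q ℕ.+ R ℕ.+ K 1≤C
        in N , λ m n N≤n n≤m →
          let N≤m = ℕₚ.≤-trans N≤n n≤m
              PQR≤n = ℕₚ.≤-trans (ℕₚ.m≤m+n (P ℕ.+ Q ℕ.+ R) (K 1≤C)) N≤n
              PQR≤m = ℕₚ.≤-trans (ℕₚ.m≤m+n (P ℕ.+ Q ℕ.+ R) (K 1≤C)) N≤m
              PQ≤n = ℕₚ.≤-trans (ℕₚ.m≤m+n (P ℕ.+ Q) R) PQR≤n
              PQ≤m = ℕₚ.≤-trans (ℕₚ.m≤m+n (P ℕ.+ Q) R) PQR≤m
          in series-est 1≤C 1≤B refl c c≤1 (f m) (f n)
               (h m (ℕₚ.≤-trans (ℕₚ.m≤m+n P Q) PQ≤m)) (h n (ℕₚ.≤-trans (ℕₚ.m≤m+n P Q) PQ≤n))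
               (<⇒≤ (k m n (ℕₚ.≤-trans (ℕₚ.m≤n+m Q P) PQ≤m) (ℕₚ.≤-trans (ℕₚ.m≤n+m Q P) PQ≤n)))
               m n (ℕₚ.≤-trans (ℕₚ.m≤n+m (K 1≤C) (P ℕ.+ Q ℕ.+ R)) N≤n) n≤m
               (l n (ℕₚ.≤-trans (ℕₚ.m≤n+m R (P ℕ.+ Q)) PQR≤n))
      where
      1≤C : 1ℚ ≤ B + B
      1≤C = ≤-trans 1≤B (by B (solve 1 (λ b → b :+ b :- b := b) refl B) (≤-trans (<⇒≤ 0<1) 1≤B))

  rootBelow : ℕ → ℚ → ℚ → ℕ → ℚ
  rootBelow m q g zero    = 0ℚ
  rootBelow m q g (suc a) with (ι (suc a) * g) ^ m ≤? q
  ... | yes _ = ι (suc a) * g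
  ... | no  _ = rootBelow m q g a

  approxRoot : ℕ → ℚ → ℕ → ℚ
  approxRoot m q N = rootBelow m q (recip (suc N)) (suc ℤ.∣ ↥ q ∣ ℕ.* suc N)

  rootBelow-nn : ∀ m q {g} → 0ℚ ≤ g → ∀ a → 0ℚ ≤ rootBelow m q g a
  rootBelow-nn m q h zero = ≤-refl
  rootBelow-nn m q {g} h (suc a) with (ι (suc a) * g) ^ m ≤? q
  ... | yes _ = *-nn (ι-nn (suc a)) h
  ... | no  _ = rootBelow-nn m q h a

  rootBelow-≤ : ∀ m q g a → rootBelow m q g a ≡ 0ℚ ⊎ rootBelow m q g a ^ m ≤ q
  rootBelow-≤ m q g zero = inj₁ refl
  rootBelow-≤ m q g (suc a) with (ι (suc a) * g) ^ m ≤? q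
  ... | yes h = inj₂ h
  ... | no  _ = rootBelow-≤ m q g a

  rootBelow-> : ∀ m q g a → q < (ι (suc a) * g) ^ m → q < (rootBelow m q g a + g) ^ m
  rootBelow-> m q g zero h = subst (λ z → q < z ^ m) (trans (*-identityˡ g) (sym (+-identityˡ g))) h
  rootBelow-> m q g (suc a) h with (ι (suc a) * g) ^ m ≤? q
  ... | yes _ = subst (λ z → q < z ^ m) (trans (cong (_* g) (ι-suc (suc a)))
                  (trans (*-distribʳ-+ g 1ℚ (ι (suc a))) (trans (+-comm (1ℚ * g) _) (cong (λ z → ι (suc a) * g + z) (*-identityˡ g))))) h
  ... | no  k = rootBelow-> m q g a (≰⇒> k)

  +-step : ∀ {a b c d e} → a ≡ 1ℚ + b → b ≡ c + d → e ≡ 1ℚ + c → a ≡ e + d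
  +-step {c = c} {d} refl refl refl = sym (+-assoc 1ℚ c d)

  ι-+ : ∀ m n → ι (m ℕ.+ n) ≡ ι m + ι n
  ι-+ zero    n = sym (+-identityˡ (ι n))
  ι-+ (suc m) n = +-step {ι (suc m ℕ.+ n)} {ι (m ℕ.+ n)} {ι m} {ι n} {ι (suc m)} (ι-suc (m ℕ.+ n)) (ι-+ m n) (ι-suc m)

  *-step : ∀ {a b c d e} → a ≡ c + b → b ≡ d * c → e ≡ 1ℚ + d → a ≡ e * c
  *-step {c = c} {d} refl refl refl = trans (cong (_+ d * c) (sym (*-identityˡ c))) (sym (*-distribʳ-+ c 1ℚ d))

  ι-* : ∀ m n → ι (m ℕ.* n) ≡ ι m * ι n
  ι-* zero    n = sym (*-zeroˡ (ι n))
  ι-* (suc m) n = *-step {ι (suc m ℕ.* n)} {ι (m ℕ.* n)} {ι n} {ι m} {ι (suc m)} (ι-+ n (m ℕ.* n)) (ι-* m n) (ι-suc m)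

  root-start : ∀ m {q c d x y g} → q ≤ c → d ≡ 1ℚ + c → 1ℚ ≤ d → 0ℚ ≤ x → x ≤ y → 0ℚ ≤ g → x * g ≡ d → q < (y * g) ^ suc m
  root-start m {q} {c} {d} {x} {y} {g} q≤c d≡ 1≤d 0≤x x≤y 0≤g e = begin-strict
    q                <⟨ ≤-<-trans q≤c (by< 1ℚ (trans (cong (_- c) d≡) (solve 1 (λ a → con 1ℚ :+ a :- a := con 1ℚ) refl c)) 0<1) ⟩
    d                ≤⟨ ^-≥ 1≤d m ⟩
    d ^ suc m        ≡⟨ cong (_^ suc m) e ⟨
    (x * g) ^ suc m  ≤⟨ ^-mono (*-nn 0≤x 0≤g) (*-mono-nn 0≤x x≤y 0≤g ≤-refl) (suc m) ⟩
    (y * g) ^ suc m  ∎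
    where open ≤-Reasoning

  scale : ∀ {b s n g} → b ≡ s * n → n * g ≡ 1ℚ → b * g ≡ s
  scale {s = s} {n} {g} refl e = trans (*-assoc s n g) (trans (cong (s *_) e) (*-identityʳ s))

  root-> : ∀ m q N b → b ≡ suc ℤ.∣ ↥ q ∣ ℕ.* suc N → q < (rootBelow (suc m) q (recip (suc N)) b + recip (suc N)) ^ suc m
  root-> m q N b b≡ = rootBelow-> (suc m) q (recip (suc N)) b
    (root-start m {q} {ι ℤ.∣ ↥ q ∣} {ι (suc ℤ.∣ ↥ q ∣)} {ι b} {ι (suc b)} {recip (suc N)} (bound q) (ι-suc ℤ.∣ ↥ q ∣) (ι-mono {1} {suc ℤ.∣ ↥ q ∣} (ℕ.s≤s ℕ.z≤n)) (ι-nn b) (ι-mono (ℕₚ.n≤1+n b)) (<⇒≤ (recip-pos (suc N)))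
      (scale {ι b} {ι (suc ℤ.∣ ↥ q ∣)} {ι (suc N)} {recip (suc N)} (trans (cong ι b≡) (ι-* (suc ℤ.∣ ↥ q ∣) (suc N))) (ι-recip N)))

  approxRoot-nn : ∀ m q N → 0ℚ ≤ approxRoot m q N
  approxRoot-nn m q N = rootBelow-nn m q (<⇒≤ (recip-pos (suc N))) (suc ℤ.∣ ↥ q ∣ ℕ.* suc N)

  approxRoot-≤ : ∀ m q N → approxRoot m q N ≡ 0ℚ ⊎ approxRoot m q N ^ m ≤ q
  approxRoot-≤ m q N = rootBelow-≤ m q (recip (suc N)) (suc ℤ.∣ ↥ q ∣ ℕ.* suc N)

  approxRoot-> : ∀ m q N → q < (approxRoot (suc m) q N + recip (suc N)) ^ suc m
  approxRoot-> m q N = root-> m q N _ refl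

  root-est : ∀ m {p q s t g δ} → 0ℚ ≤ t → 0ℚ ≤ g → s ≡ 0ℚ ⊎ s ^ suc m ≤ p → q < (t + g) ^ suc m →
             0ℚ < δ → g ≤ δ → p - q < δ ^ suc m → s - t < δ + δ
  root-est m {p} {q} {s} {t} {g} {δ} 0≤t 0≤g low high 0<δ g≤δ h = ≰⇒> λ k → case k low
    where
    t+g+δ≤s : δ + δ ≤ s - t → t + g + δ ≤ s
    t+g+δ≤s k = by ((s - t - (δ + δ)) + (δ - g)) (solve 4 (λ s t g d → s :- (t :+ g :+ d) := (s :- t :- (d :+ d)) :+ (d :- g)) refl s t g δ)
      (+-nn (diff k) (diff g≤δ))
    case : δ + δ ≤ s - t → ¬ (s ≡ 0ℚ ⊎ s ^ suc m ≤ p)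
    case k (inj₁ s≡0) = <-irrefl refl (<-≤-trans (subst (0ℚ <_) (+-comm δ (t + g)) (+-pos 0<δ (+-nn 0≤t 0≤g))) (subst (t + g + δ ≤_) s≡0 (t+g+δ≤s k)))
    case k (inj₂ s^m≤p) = <-irrefl refl (begin-strict
      p                                ≡⟨ p+[q-p] q p ⟨
      q + (p - q)                      <⟨ +-mono-< high h ⟩
      (t + g) ^ suc m + δ ^ suc m      ≤⟨ ^-super (+-nn 0≤t 0≤g) (<⇒≤ 0<δ) m ⟩
      (t + g + δ) ^ suc m              ≤⟨ ^-mono (+-nn (+-nn 0≤t 0≤g) (<⇒≤ 0<δ)) (t+g+δ≤s k) (suc m) ⟩
      s ^ suc m                        ≤⟨ s^m≤p ⟩
      p                                ∎)
      where open ≤-Reasoning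

  root-cauchy : ∀ m .{{_ : ℕ.NonZero m}} {f} → IsCauchy f → IsCauchy (λ n → approxRoot m (f n) n)
  root-cauchy (suc m) {f} cf = cauchy-one-sided (λ n → approxRoot (suc m) (f n) n) λ ε 0<ε →
    let δ = ½ * ε
        0<δ = half-pos 0<ε
        (P , small) = recip-small 0<δ
        (Q , close) = cf (δ ^ suc m) (^-pos 0<δ (suc m))
    in P ℕ.+ Q , λ i j N≤i N≤j →
      subst (approxRoot (suc m) (f i) i - approxRoot (suc m) (f j) j <_) (half ε)
        (root-est m (approxRoot-nn (suc m) (f j) j) (<⇒≤ (recip-pos (suc j))) (approxRoot-≤ (suc m) (f i) i) (approxRoot-> m (f j) j)
          0<δ (small j (ℕₚ.≤-trans (ℕₚ.m≤m+n P Q) N≤j))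
          (≤-<-trans (p≤∣p∣ (f i - f j)) (close i j (ℕₚ.≤-trans (ℕₚ.m≤n+m Q P) N≤i) (ℕₚ.≤-trans (ℕₚ.m≤n+m Q P) N≤j))))

open RationalSequences using (IsCauchy; ∑; recip; _^_; inv; approxRoot; term)

record ℝ : Set where
  constructor real
  field
    seq    : ℕ → ℚ
    cauchy : IsCauchy seq

open ℝ public

infix  4 _≈_ _<_
infixl 6 _+_ _⊔_
infixl 7 _*_ _⊓_
infix  8 -_

_≈_ : ℝ → ℝ → Set
x ≈ y = ∀ ε → 0ℚ ℚ.< ε → ∃ λ N → ∀ n → N ℕ.≤ n → ℚ.∣ seq x n ℚ.- seq y n ∣ ℚ.< ε

_<_ : ℝ → ℝ → Set
x < y = ∃ λ δ → 0ℚ ℚ.< δ × ∃ λ N → ∀ n → N ℕ.≤ n → seq x n ℚ.+ δ ℚ.≤ seq y n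

fromℚ : ℚ → ℝ
fromℚ q = real (λ _ → q) (RationalSequences.const-cauchy q)

0ℝ 1ℝ : ℝ
0ℝ = fromℚ 0ℚ
1ℝ = fromℚ 1ℚ

_+_ : ℝ → ℝ → ℝ
x + y = real (λ n → seq x n ℚ.+ seq y n) (RationalSequences.+-cauchy {seq x} {seq y} (cauchy x) (cauchy y))

-_ : ℝ → ℝ
- x = real (λ n → ℚ.- seq x n) (RationalSequences.neg-cauchy {seq x} (cauchy x))

_*_ : ℝ → ℝ → ℝ
x * y = real (λ n → seq x n ℚ.* seq y n) (RationalSequences.*-cauchy {seq x} {seq y} (cauchy x) (cauchy y))

_⊔_ : ℝ → ℝ → ℝ
x ⊔ y = real (λ n → seq x n ℚ.⊔ seq y n) (RationalSequences.⊔-cauchy {seq x} {seq y} (cauchy x) (cauchy y))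

_⊓_ : ℝ → ℝ → ℝ
x ⊓ y = real (λ n → seq x n ℚ.⊓ seq y n) (RationalSequences.⊓-cauchy {seq x} {seq y} (cauchy x) (cauchy y))

∣_∣ : ℝ → ℝ
∣ x ∣ = real (λ n → ℚ.∣ seq x n ∣) (RationalSequences.abs-cauchy {seq x} (cauchy x))

reciprocal : (y : ℝ) → 0ℝ < y → ℝ
reciprocal y (δ , 0<δ , N , h) = real (λ n → inv (seq y n)) (RationalSequences.inv-cauchy {seq y} (cauchy y) 0<δ
  (N , λ n N≤n → subst (ℚ._≤ seq y n) (ℚₚ.+-identityˡ δ) (h n N≤n)))

_/ℕ_ : ℝ → (n : ℕ) .{{_ : ℕ.NonZero n}} → ℝ
x /ℕ n = x * fromℚ (recip n)

-- For x ≥ 0 this is the y ≥ 0 with yᵐ = x (for x < 0 it is 0).  Its n-th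
-- approximation is the largest multiple of 1/(n+1) whose m-th power does not
-- exceed the n-th approximation of x.
root : (m : ℕ) .{{_ : ℕ.NonZero m}} → ℝ → ℝ
root m x = real (λ n → approxRoot m (seq x n) n) (RationalSequences.root-cauchy m {seq x} (cauchy x))

-- re-i k and im-i k are the real and imaginary parts of iᵏ.
re-i im-i : ℕ → ℚ
re-i zero          = 1ℚ
re-i (suc zero)    = 0ℚ
re-i (suc (suc k)) = ℚ.- re-i k
im-i zero          = 0ℚ
im-i (suc zero)    = 1ℚ
im-i (suc (suc k)) = ℚ.- im-i k

∣re-i∣≤1 : ∀ k → ℚ.∣ re-i k ∣ ℚ.≤ 1ℚ
∣re-i∣≤1 zero          = ℚₚ.≤-refl
∣re-i∣≤1 (suc zero)    = ℚₚ.<⇒≤ RationalSequences.0<1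
∣re-i∣≤1 (suc (suc k)) = subst (ℚ._≤ 1ℚ) (sym (ℚₚ.∣-p∣≡∣p∣ (re-i k))) (∣re-i∣≤1 k)

∣im-i∣≤1 : ∀ k → ℚ.∣ im-i k ∣ ℚ.≤ 1ℚ
∣im-i∣≤1 zero          = ℚₚ.<⇒≤ RationalSequences.0<1
∣im-i∣≤1 (suc zero)    = ℚₚ.≤-refl
∣im-i∣≤1 (suc (suc k)) = subst (ℚ._≤ 1ℚ) (sym (ℚₚ.∣-p∣≡∣p∣ (im-i k))) (∣im-i∣≤1 k)

-- ∑ₖ Re(iᵏ) xᵏ/k! and ∑ₖ Im(iᵏ) xᵏ/k!: the n-th approximation is the sum of
-- the first n terms, evaluated at the n-th approximation of x.
cos sin : ℝ → ℝ
cos x = real (λ n → ∑ (term re-i (seq x n)) n) (RationalSequences.series-cauchy re-i ∣re-i∣≤1 {seq x} (cauchy x))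
sin x = real (λ n → ∑ (term im-i (seq x n)) n) (RationalSequences.series-cauchy im-i ∣im-i∣≤1 {seq x} (cauchy x))

-- π is the first positive zero of the sine.  As sin is positive just to the
-- right of 0, this says that sin is positive on all of (0 , π).
record IsPi (π : ℝ) : Set where
  field
    positive : 0ℝ < π
    sin-π    : sin π ≈ 0ℝ
    sin-pos  : ∀ x → 0ℝ < x → x < π → 0ℝ < sin x

record ℂ : Set where
  constructor _+i_
  field
    re im : ℝ

open ℂ public

infix 5 _+i_
infix 4 _≈ᶜ_

_≈ᶜ_ : ℂ → ℂ → Set
z ≈ᶜ w = re z ≈ re w × im z ≈ im w

0ℂ : ℂ
0ℂ = 0ℝ +i 0ℝ

fromℝ : ℝ → ℂ
fromℝ x = x +i 0ℝ

ℝ-rawSemiring : RawSemiring 0ℓ 0ℓ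
ℝ-rawSemiring = record { _≈_ = _≈_ ; _+_ = _+_ ; _*_ = _*_ ; 0# = 0ℝ ; 1# = 1ℝ }

ℂ-rawSemiring : RawSemiring 0ℓ 0ℓ
ℂ-rawSemiring = record
  { Carrier = ℂ
  ; _≈_     = _≈ᶜ_
  ; _+_     = λ z w → (re z + re w) +i (im z + im w)
  ; _*_     = λ z w → (re z * re w + - (im z * im w)) +i (re z * im w + im z * re w)
  ; 0#      = 0ℂ
  ; 1#      = fromℝ 1ℝ
  }

module ℝ-Sum = RawSemiringDefinitions ℝ-rawSemiring
module ℂ-Sum = RawSemiringDefinitions ℂ-rawSemiring
open RawSemiring ℂ-rawSemiring using () renaming (_+_ to _+ᶜ_; _*_ to _*ᶜ_) public

-- e^{iφ} = ∑ₖ (iφ)ᵏ/k!, by real and imaginary parts.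
exp-i : ℝ → ℂ
exp-i φ = cos φ +i sin φ

Sector : ℝ → ℝ → ℂ → Set
Sector v θ z = ∃ λ ρ → ∃ λ φ → 0ℝ < ρ × ∣ φ ∣ < θ × z ≈ᶜ (fromℝ v +ᶜ fromℝ ρ *ᶜ exp-i φ)

evaluate : ∀ {n} → Vector ℝ (suc n) → ℂ → ℂ
evaluate a z = ℂ-Sum.sum (λ m → fromℝ (a m) *ᶜ (z ℂ-Sum.^ toℕ m))

maximum : ∀ {n} → Vector ℝ n → ℝ
maximum {zero}  x = 0ℝ
maximum {suc n} x = foldr _⊔_ (head x) (tail x)

minimum : ∀ {n} .{{_ : ℕ.NonZero n}} → Vector ℝ n → ℝ
minimum {suc n} x = foldr _⊓_ (head x) (tail x)

-- j₁ < … < j_ℓ enumerate the indices of negative coefficients, k₁ < … < k_t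
-- those of the positive coefficients beyond every jᵢ (so beyond j_ℓ, and there
-- is no constraint if ℓ = 0).  When the leading coefficient is positive, its
-- index is one of the k_r, so t is nonzero.
record SignIndices {n} (a : Vector ℝ (suc n)) : Set where
  field
    ℓ t          : ℕ
    {{t-nonZero}} : ℕ.NonZero t
    j            : Fin ℓ → Fin (suc n)
    k            : Fin t → Fin (suc n)
    j-increasing : j Preserves Fin._<_ ⟶ Fin._<_
    k-increasing : k Preserves Fin._<_ ⟶ Fin._<_
    j-enumerates : ∀ m → (∃ λ i → j i ≡ m) ⇔ a m < 0ℝ
    k-enumerates : ∀ m → (∃ λ r → k r ≡ m) ⇔ ((∀ i → j i Fin.< m) × 0ℝ < a m)

  k-beyond : ∀ r i → j i Fin.< k r
  k-beyond r = proj₁ (Equivalence.to (k-enumerates (k r)) (r , refl))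

  k-positive : ∀ r → 0ℝ < a (k r)
  k-positive r = proj₂ (Equivalence.to (k-enumerates (k r)) (r , refl))

  v : ℝ
  v = minimum λ r → maximum λ i →
    root (toℕ (k r) ℕ.∸ toℕ (j i)) {{ℕ.>-nonZero (ℕₚ.m<n⇒0<n∸m (k-beyond r i))}}
      (∣ ℝ-Sum.sum (λ i′ → a (j i′)) ∣ * reciprocal (a (k r)) (k-positive r))

{-# OPTIONS --safe #-}
-- Write z = v + w with w = ρ e^{iφ}.  If φ > 0, then Im(wᵐ) = ρᵐ sin(mφ) > 0 for 1 ≤ m ≤ n, since mφ < π.
-- As zᵏ⁺¹ wᵐ = v zᵏ wᵐ + zᵏ wᵐ⁺¹, it follows that Xₖ = Im(zᵏ) satisfies Xₖ₊₁ > v Xₖ ≥ 0 for k < n.  The same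
-- holds for Xₖ = -Im(zᵏ) if φ < 0 and for Xₖ = Re(zᵏ) if φ = 0.  Let k be the index k_r at which the minimum v
-- is attained, and B = ∑ |a_j| over the negative coefficients.  Then aₖ vᵏ⁻ʲ ≥ B, so aₖ Xₖ > aₖ vᵏ⁻ʲ X_j ≥ B X_j
-- for each such j; averaging with the weights |a_j| / B gives aₖ Xₖ > ∑ |a_j| X_j, so ∑ aₘ Xₘ > 0 and f(z) ≠ 0.
-- (If there is no such j, then already aₙ Xₙ > 0.)  The conclusion being negative, the sign of φ and the index k_r
-- are only needed up to double negation.
module Submission where

open import Algebra.Bundles using (CommutativeSemiring)
import Algebra.Properties.CommutativeSemiring.Exp as Exponentiation
import Algebra.Properties.Semiring.Sum as Summation
open import Algebra.Structures.Biased using (isCommutativeSemiringˡ)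
open import Data.Empty using (⊥-elim)
open import Data.Fin as Fin using (Fin; zero; suc; toℕ; fromℕ; punchIn; punchOut)
import Data.Fin.Properties as Finₚ
open import Data.Nat as ℕ using (ℕ; zero; suc; NonZero)
import Data.Nat.Properties as ℕₚ
open import Data.Product using (∃; _×_; _,_; proj₁; proj₂)
open import Data.Rational as ℚ using (ℚ; 0ℚ; 1ℚ; ½)
import Data.Rational.Properties as ℚₚ
open import Data.Rational.Solver using (module +-*-Solver)
open import Data.Sum using (_⊎_; inj₁; inj₂)
open import Data.Vec.Functional using (Vector; foldr; head; tail)
open import Function using (_∘_)
open import Function.Bundles using (Equivalence)
open import Function.Definitions using (Injective)
open import Level using (0ℓ)
open import Relation.Binary.Core using (Rel)
open import Relation.Binary.Definitions using (tri<; tri≈; tri>)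
open import Relation.Binary.PropositionalEquality as ≡ using (_≡_; _≢_)
import Relation.Binary.Reasoning.Base.Triple as Triple
import Relation.Binary.Reasoning.Setoid as SetoidReasoning
open import Relation.Binary.Structures using (IsEquivalence; IsPreorder; IsStrictPartialOrder)
open import Relation.Nullary using (¬_; yes; no)
import Defs

-- The inequalities are derived for an abstract real-linear functional L over an abstract ordered
-- semiring; the instances Im, -Im and Re then yield the three sign cases from a single argument.
-- Positivity of L (z^k w) does not propagate in k by itself, because z^(k+1) w = v z^k w + z^k w^2
-- brings in a higher power of w. Hence the two-parameter family L (z^k w^m) with k + m ≤ n; the
-- angle π/n enters only at its edge k = 0. What `IsPi` offers is the sign of the sine on (0, π), so
-- the powers of w must be tied to the sine of multiples of φ by de Moivre's formula, that is, by
-- the addition theorems. These are proved for truncated series at rational points with an explicit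
-- error: the product of two truncations of length n exceeds the truncated Cauchy product by the
-- terms with i + j ≥ n, and those are dominated by a tail of an exponential series.

record OrderedCommutativeSemiring : Set₁ where
  field
    commutativeSemiring : CommutativeSemiring 0ℓ 0ℓ
  open CommutativeSemiring commutativeSemiring public hiding (zero)
  infix 4 _≤_ _<_
  field
    _≤_ _<_              : Rel Carrier 0ℓ
    isPreorder           : IsPreorder _≈_ _≤_
    isStrictPartialOrder : IsStrictPartialOrder _≈_ _<_
    <⇒≤                  : ∀ {x y} → x < y → x ≤ y
    <-≤-trans            : ∀ {x y z} → x < y → y ≤ z → x < z
    ≤-<-trans            : ∀ {x y z} → x ≤ y → y < z → x < z
    +-mono-≤             : ∀ {x y u v} → x ≤ y → u ≤ v → x + u ≤ y + v
    +-mono-<-≤           : ∀ {x y u v} → x < y → u ≤ v → x + u < y + v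
    *-monoˡ-≤            : ∀ {x y z} → 0# ≤ z → x ≤ y → z * x ≤ z * y
    *-monoˡ-<            : ∀ {x y z} → 0# < z → x < y → z * x < z * y

-- Ordered semirings: sums, growth of X, and the averaging argument

module OrderedSemiringProperties (R : OrderedCommutativeSemiring) where
  open OrderedCommutativeSemiring R
  open Exponentiation commutativeSemiring public using (_^_; ^-congˡ)
  open Summation semiring public using (sum; sum-cong-≋; sum-remove; ∑-distrib-+; *-distribˡ-sum; *-distribʳ-sum; sum-replicate-zero)
  open IsPreorder isPreorder public using () renaming (refl to ≤-refl; reflexive to ≤-reflexive; trans to ≤-trans)
  open IsStrictPartialOrder isStrictPartialOrder public using (<-resp-≈) renaming (irrefl to <-irrefl; asym to <-asym; trans to <-trans)
  module ≤-Reasoning = Triple isPreorder <-asym <-trans <-resp-≈ <⇒≤ <-≤-trans ≤-<-trans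

  +-mono-≤-< : ∀ {x y u v} → x ≤ y → u < v → x + u < y + v
  +-mono-≤-< {x} {y} {u} {v} x≤y u<v = begin-strict
    x + u ≈⟨ +-comm x u ⟩
    u + x <⟨ +-mono-<-≤ u<v x≤y ⟩
    v + y ≈⟨ +-comm v y ⟩
    y + v ∎
    where open ≤-Reasoning

  +-nonNeg : ∀ {x y} → 0# ≤ x → 0# ≤ y → 0# ≤ x + y
  +-nonNeg 0≤x 0≤y = ≤-trans (≤-reflexive (sym (+-identityˡ 0#))) (+-mono-≤ 0≤x 0≤y)

  *-nonNeg : ∀ {x y} → 0# ≤ x → 0# ≤ y → 0# ≤ x * y
  *-nonNeg {x} 0≤x 0≤y = ≤-trans (≤-reflexive (sym (zeroʳ x))) (*-monoˡ-≤ 0≤x 0≤y)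

  *-pos : ∀ {x y} → 0# < x → 0# < y → 0# < x * y
  *-pos {x} 0<x 0<y = ≤-<-trans (≤-reflexive (sym (zeroʳ x))) (*-monoˡ-< 0<x 0<y)

  *-monoʳ-≤ : ∀ {x y z} → 0# ≤ z → x ≤ y → x * z ≤ y * z
  *-monoʳ-≤ {x} {y} {z} 0≤z x≤y = begin
    x * z ≈⟨ *-comm x z ⟩
    z * x ≤⟨ *-monoˡ-≤ 0≤z x≤y ⟩
    z * y ≈⟨ *-comm z y ⟩
    y * z ∎
    where open ≤-Reasoning

  ^-pos : 0# < 1# → ∀ {x} → 0# < x → ∀ m → 0# < x ^ m
  ^-pos 0<1 0<x zero    = 0<1
  ^-pos 0<1 0<x (suc m) = *-pos 0<x (^-pos 0<1 0<x m)

  ^-nonNeg : 0# ≤ 1# → ∀ {x} → 0# ≤ x → ∀ m → 0# ≤ x ^ m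
  ^-nonNeg 0≤1 0≤x zero    = 0≤1
  ^-nonNeg 0≤1 0≤x (suc m) = *-nonNeg 0≤x (^-nonNeg 0≤1 0≤x m)

  ^-mono-≤ : 0# ≤ 1# → ∀ {x y} → 0# ≤ x → x ≤ y → ∀ m → x ^ m ≤ y ^ m
  ^-mono-≤ 0≤1 0≤x x≤y zero    = ≤-refl
  ^-mono-≤ 0≤1 0≤x x≤y (suc m) =
    ≤-trans (*-monoˡ-≤ 0≤x (^-mono-≤ 0≤1 0≤x x≤y m)) (*-monoʳ-≤ (^-nonNeg 0≤1 (≤-trans 0≤x x≤y) m) x≤y)

  sum-mono-≤ : ∀ {n} {f g : Vector Carrier n} → (∀ i → f i ≤ g i) → sum f ≤ sum g
  sum-mono-≤ {zero}  f≤g = ≤-refl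
  sum-mono-≤ {suc n} f≤g = +-mono-≤ (f≤g zero) (sum-mono-≤ (f≤g ∘ suc))

  sum-mono-< : ∀ {n} {f g : Vector Carrier (suc n)} → (∀ i → f i < g i) → sum f < sum g
  sum-mono-< f<g = +-mono-<-≤ (f<g zero) (sum-mono-≤ (<⇒≤ ∘ f<g ∘ suc))

  sum-nonNeg : ∀ {n} {f : Vector Carrier n} → (∀ i → 0# ≤ f i) → 0# ≤ sum f
  sum-nonNeg {n} 0≤f = ≤-trans (≤-reflexive (sym (sum-replicate-zero n))) (sum-mono-≤ 0≤f)

  -- Injectivity means that each term of `sum f` is taken at most once, and the terms left out are
  -- nonnegative. The induction deletes the index `j zero`: `punchOut` carries the other values of
  -- `j` into `Fin n`.
  sum-subfamily-≤ : ∀ {ℓ n} (j : Fin ℓ → Fin n) → Injective _≡_ _≡_ j → (f : Vector Carrier n) →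
                    (∀ m → (∀ i → j i ≢ m) → 0# ≤ f m) → sum (f ∘ j) ≤ sum f
  sum-subfamily-≤ {zero}          j inj f 0≤f = sum-nonNeg (λ m → 0≤f m (λ ()))
  sum-subfamily-≤ {suc ℓ} {zero}  j inj f 0≤f with () ← j zero
  sum-subfamily-≤ {suc ℓ} {suc n} j inj f 0≤f = begin
    f j₀ + sum (f ∘ j ∘ suc)          ≈⟨ +-congˡ (sum-cong-≋ (λ i → reflexive (≡.cong f (≡.sym (Finₚ.punchIn-punchOut (j₀≢ i)))))) ⟩
    f j₀ + sum (f ∘ punchIn j₀ ∘ j′)  ≤⟨ +-mono-≤ ≤-refl (sum-subfamily-≤ j′ j′-inj (f ∘ punchIn j₀) 0≤f′) ⟩
    f j₀ + sum (f ∘ punchIn j₀)       ≈⟨ sum-remove {i = j₀} f ⟨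
    sum f                             ∎
    where
    open ≤-Reasoning
    j₀ = j zero
    j₀≢ : ∀ i → j₀ ≢ j (suc i)
    j₀≢ i j₀≡ with () ← inj j₀≡
    j′ : Fin ℓ → Fin n
    j′ i = punchOut (j₀≢ i)
    j′-inj : Injective _≡_ _≡_ j′
    j′-inj {x} {y} e = Finₚ.suc-injective (inj (Finₚ.punchOut-injective (j₀≢ x) (j₀≢ y) e))
    0≤f′ : ∀ m → (∀ i → j′ i ≢ m) → 0# ≤ f (punchIn j₀ m)
    0≤f′ m j′≢m = 0≤f (punchIn j₀ m) λ where
      zero    e → Finₚ.punchInᵢ≢i j₀ m (≡.sym e)
      (suc i) e → j′≢m i (Finₚ.punchIn-injective j₀ (j′ i) m (≡.trans (Finₚ.punchIn-punchOut (j₀≢ i)) e))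

  -- B t = ∑ bᵢ (B qᵢ) < ∑ bᵢ c = B c for t = ∑ bᵢ qᵢ and B = ∑ bᵢ.
  weighted-sum-≱ : ∀ {ℓ} (b q : Vector Carrier (suc ℓ)) {c} → (∀ i → 0# < b i) → (∀ i → sum b * q i < c) →
                   ¬ c ≤ sum (λ i → b i * q i)
  weighted-sum-≱ b q {c} 0<b Bq<c c≤t = <-irrefl refl (begin-strict
    B * c                       ≤⟨ *-monoˡ-≤ (sum-nonNeg (<⇒≤ ∘ 0<b)) c≤t ⟩
    B * sum (λ i → b i * q i)   ≈⟨ *-distribˡ-sum B (λ i → b i * q i) ⟩
    sum (λ i → B * (b i * q i)) ≈⟨ sum-cong-≋ (λ i → trans (sym (*-assoc B (b i) (q i))) (trans (*-congʳ (*-comm B (b i))) (*-assoc (b i) B (q i)))) ⟩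
    sum (λ i → b i * (B * q i)) <⟨ sum-mono-< (λ i → *-monoˡ-< (0<b i) (Bq<c i)) ⟩
    sum (λ i → b i * c)         ≈⟨ *-distribʳ-sum c b ⟨
    B * c                       ∎)
    where
    open ≤-Reasoning
    B = sum b

  -- W k m stands for L (zᵏ wᵐ), where z = v + w and L is a linear functional.
  module _ (v : Carrier) (0≤v : 0# ≤ v) (n : ℕ) (W : ℕ → ℕ → Carrier)
           (W-suc : ∀ k m → W (suc k) m ≈ v * W k m + W k (suc m))
           (0≤W₀₀ : 0# ≤ W 0 0) (0<W₀ : ∀ m → m ℕ.< n → 0# < W 0 (suc m)) where

    -- Repeated use of `W-suc` writes z^k w^(m+1) as a combination of w^(m+1), ..., w^(m+1+k) with
    -- nonnegative coefficients, that of the highest power being 1. The bound on k + m keeps these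
    -- exponents at most n.
    W-pos : ∀ k m → k ℕ.+ m ℕ.< n → 0# < W k (suc m)
    W-pos zero    m m<n   = 0<W₀ m m<n
    W-pos (suc k) m k+m<n = begin-strict
      0#                                      ≤⟨ *-nonNeg 0≤v (<⇒≤ (W-pos k m (ℕₚ.<-trans (ℕₚ.n<1+n _) k+m<n))) ⟩
      v * W k (suc m)                         ≈⟨ +-identityʳ _ ⟨
      v * W k (suc m) + 0#                    <⟨ +-mono-≤-< ≤-refl (W-pos k (suc m) (≡.subst (ℕ._< n) (≡.sym (ℕₚ.+-suc k m)) k+m<n)) ⟩
      v * W k (suc m) + W k (suc (suc m))     ≈⟨ W-suc k (suc m) ⟨
      W (suc k) (suc m)                       ∎
      where open ≤-Reasoning

    X : ℕ → Carrier
    X k = W k 0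

    X-suc : ∀ k → k ℕ.< n → v * X k < X (suc k)
    X-suc k k<n = begin-strict
      v * X k         ≈⟨ +-identityʳ _ ⟨
      v * X k + 0#    <⟨ +-mono-≤-< ≤-refl (W-pos k 0 (≡.subst (ℕ._< n) (≡.sym (ℕₚ.+-identityʳ k)) k<n)) ⟩
      v * X k + W k 1 ≈⟨ W-suc k 0 ⟨
      X (suc k)       ∎
      where open ≤-Reasoning

    -- Only weak, because X 0 = L 1 vanishes when L is an imaginary part; strictness starts at index
    -- 1.
    X-nonNeg : ∀ k → k ℕ.≤ n → 0# ≤ X k
    X-nonNeg zero    _   = 0≤W₀₀
    X-nonNeg (suc k) k<n = ≤-trans (*-nonNeg 0≤v (X-nonNeg k (ℕₚ.<⇒≤ k<n))) (<⇒≤ (X-suc k k<n))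

    X-pos : ∀ k → k ℕ.< n → 0# < X (suc k)
    X-pos k k<n = ≤-<-trans (*-nonNeg 0≤v (X-nonNeg k (ℕₚ.<⇒≤ k<n))) (X-suc k k<n)

    -- Iterates `X-suc`. As v may be 0, multiplying by it preserves only `≤`, so strictness comes
    -- from the last step alone and needs a positive exponent.
    X-growth-≤ : ∀ d j → d ℕ.+ j ℕ.≤ n → v ^ d * X j ≤ X (d ℕ.+ j)
    X-growth-< : ∀ d j → d ℕ.+ j ℕ.< n → v ^ suc d * X j < X (suc d ℕ.+ j)
    X-growth-≤ zero    j _     = ≤-reflexive (*-identityˡ (X j))
    X-growth-≤ (suc d) j d+j<n = <⇒≤ (X-growth-< d j d+j<n)
    X-growth-< d j d+j<n = begin-strict
      v * v ^ d * X j   ≈⟨ *-assoc v (v ^ d) (X j) ⟩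
      v * (v ^ d * X j) ≤⟨ *-monoˡ-≤ 0≤v (X-growth-≤ d j (ℕₚ.<⇒≤ d+j<n)) ⟩
      v * X (d ℕ.+ j)   <⟨ X-suc (d ℕ.+ j) d+j<n ⟩
      X (suc d ℕ.+ j)   ∎
      where open ≤-Reasoning

    X-growth : ∀ {j k} → j ℕ.< k → k ℕ.≤ n → v ^ (k ℕ.∸ j) * X j < X k
    X-growth {j} {suc k} (ℕ.s≤s j≤k) k<n rewrite ℕₚ.+-∸-assoc 1 j≤k =
      ≡.subst (λ i → v ^ suc (k ℕ.∸ j) * X j < X (suc i)) (ℕₚ.m∸n+n≡m j≤k)
        (X-growth-< (k ℕ.∸ j) j (≡.subst (ℕ._< n) (≡.sym (ℕₚ.m∸n+n≡m j≤k)) k<n))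

    -- A semiring has no negation, so the absolute values of the negative coefficients enter as a
    -- vector `b` that cancels them.
    module _ .{{_ : NonZero n}} (a : Vector Carrier (suc n)) (0<aₙ : 0# < a (fromℕ n))
             {ℓ} (j : Fin ℓ → Fin (suc n)) (j-inj : Injective _≡_ _≡_ j)
             (0≤a : ∀ m → (∀ i → j i ≢ m) → 0# ≤ a m)
             (b : Vector Carrier ℓ) (0<b : ∀ i → 0# < b i) (b+a≈0 : ∀ i → b i + a (j i) ≈ 0#)
             (k : Fin (suc n)) (j<k : ∀ i → j i Fin.< k) (0<aₖ : 0# < a k)
             (∑b≤ : ∀ i → sum b ≤ a k * v ^ (toℕ k ℕ.∸ toℕ (j i))) where

      private
        f : Vector Carrier (suc n)
        f m = a m * X (toℕ m)

        0≤X : ∀ (m : Fin (suc n)) → 0# ≤ X (toℕ m)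
        0≤X m = X-nonNeg (toℕ m) (Finₚ.toℕ≤pred[n] m)

        -- Lets `sum-subfamily-≤` retain one term with a nonnegative coefficient next to all the
        -- negative ones.
        extend : Fin (suc n) → Fin (suc ℓ) → Fin (suc n)
        extend p zero    = p
        extend p (suc i) = j i

        extend-inj : ∀ {p} → (∀ i → j i ≢ p) → Injective _≡_ _≡_ (extend p)
        extend-inj j≢p {zero}  {zero}  _ = ≡.refl
        extend-inj j≢p {zero}  {suc y} e with () ← j≢p y (≡.sym e)
        extend-inj j≢p {suc x} {zero}  e with () ← j≢p x e
        extend-inj j≢p {suc x} {suc y} e = ≡.cong suc (j-inj e)

        bX : Vector Carrier ℓ
        bX i = b i * X (toℕ (j i))

        bX+f : sum bX + sum (f ∘ j) ≈ 0#
        bX+f = begin-equality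
          sum bX + sum (f ∘ j)       ≈⟨ ∑-distrib-+ bX (f ∘ j) ⟨
          sum (λ i → bX i + f (j i)) ≈⟨ sum-cong-≋ (λ i → trans (sym (distribʳ _ (b i) (a (j i)))) (trans (*-congʳ (b+a≈0 i)) (zeroˡ _))) ⟩
          sum {ℓ} (λ _ → 0#)         ≈⟨ sum-replicate-zero ℓ ⟩
          0#                         ∎
          where open ≤-Reasoning

        -- Dropping every nonnegative term except `f p` gives f p + ∑ f (j i) ≤ 0; adding `sum bX`,
        -- which cancels the negative terms, isolates `f p`.
        f≤bX : ∀ p → (∀ i → j i ≢ p) → sum f ≈ 0# → f p ≤ sum bX
        f≤bX p j≢p ∑f≈0 = begin
          f p                            ≈⟨ +-identityʳ (f p) ⟨
          f p + 0#                       ≈⟨ +-congˡ (trans (+-comm _ _) bX+f) ⟨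
          f p + (sum (f ∘ j) + sum bX)   ≈⟨ +-assoc _ _ _ ⟨
          (f p + sum (f ∘ j)) + sum bX   ≤⟨ +-mono-≤ (sum-subfamily-≤ (extend p) (extend-inj j≢p) f (λ m h → *-nonNeg (0≤a m (h ∘ suc)) (0≤X m))) ≤-refl ⟩
          sum f + sum bX                 ≈⟨ +-congʳ ∑f≈0 ⟩
          0# + sum bX                    ≈⟨ +-identityˡ _ ⟩
          sum bX                         ∎
          where open ≤-Reasoning

        ∑bX<f : ∀ i → sum b * X (toℕ (j i)) < f k
        ∑bX<f i = begin-strict
          sum b * X jᵢ                   ≤⟨ *-monoʳ-≤ (0≤X (j i)) (∑b≤ i) ⟩
          a k * v ^ (toℕ k ℕ.∸ jᵢ) * X jᵢ   ≈⟨ *-assoc _ _ _ ⟩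
          a k * (v ^ (toℕ k ℕ.∸ jᵢ) * X jᵢ) <⟨ *-monoˡ-< 0<aₖ (X-growth (j<k i) (Finₚ.toℕ≤pred[n] k)) ⟩
          a k * X (toℕ k)                ∎
          where
          open ≤-Reasoning
          jᵢ = toℕ (j i)

        0<Xₙ : 0# < X (toℕ (fromℕ n))
        0<Xₙ = ≡.subst (λ i → 0# < X i) (≡.trans (ℕₚ.suc-pred n) (≡.sym (Finₚ.toℕ-fromℕ n))) (X-pos (ℕ.pred n) (ℕₚ.≤-reflexive (ℕₚ.suc-pred n)))

      sum≉0 : ¬ sum f ≈ 0#
      sum≉0 = go ℓ ≡.refl
        where
        go : ∀ ℓ′ → ℓ ≡ ℓ′ → ¬ sum f ≈ 0#
        -- With no weights there is nothing to average: `sum bX` is the empty sum, and it would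
        -- bound the positive leading term.
        go zero    ≡.refl ∑f≈0 = <-irrefl refl (<-≤-trans (*-pos 0<aₙ 0<Xₙ) (f≤bX (fromℕ n) (λ ()) ∑f≈0))
        go (suc _) ≡.refl ∑f≈0 = weighted-sum-≱ b (X ∘ toℕ ∘ j) 0<b ∑bX<f
          (f≤bX k (λ i e → ℕₚ.<-irrefl (≡.cong toℕ e) (j<k i)) ∑f≈0)

-- Linear functionals, polar powers and polynomial evaluation

module ComplexPolynomials
  (R : OrderedCommutativeSemiring) (C : CommutativeSemiring 0ℓ 0ℓ)
  (fromReal : OrderedCommutativeSemiring.Carrier R → CommutativeSemiring.Carrier C) where

  private
    module C = CommutativeSemiring C
    module ∑ = Summation C.semiring
  open OrderedCommutativeSemiring R
  open OrderedSemiringProperties R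
  open Exponentiation C public using () renaming (_^_ to _^ᶜ_)

  -- Homogeneous for real scalars only, since the intended functionals are Re, Im and -Im.
  record IsLinearFunctional (L : C.Carrier → Carrier) : Set where
    field
      cong    : ∀ {x y} → x C.≈ y → L x ≈ L y
      0#-homo : L C.0# ≈ 0#
      +-homo  : ∀ x y → L (x C.+ y) ≈ L x + L y
      *-homo  : ∀ x y → L (fromReal x C.* y) ≈ x * L y

  open SetoidReasoning C.setoid

  -- The sequence `e m` plays e^(imφ). It is given by a recursion rather than as a power of `e₁` so
  -- that it can be the exponential of a multiple angle; `polar-^` is then de Moivre's formula.
  module _ (fromReal-* : ∀ x y → fromReal (x * y) C.≈ fromReal x C.* fromReal y) (fromReal-1# : fromReal 1# C.≈ C.1#)
           (w : C.Carrier) (ρ : Carrier) (e : ℕ → C.Carrier) (e₁ : C.Carrier)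
           (e₀ : e 0 C.≈ C.1#) (e-suc : ∀ m → e (suc m) C.≈ e₁ C.* e m) (w≈ : w C.≈ fromReal ρ C.* e₁) where

    polar-^ : ∀ m → w ^ᶜ m C.≈ fromReal (ρ ^ m) C.* e m
    polar-^ zero    = C.sym (C.trans (C.*-cong fromReal-1# e₀) (C.*-identityˡ C.1#))
    polar-^ (suc m) = begin
      w C.* w ^ᶜ m                                         ≈⟨ C.*-cong w≈ (polar-^ m) ⟩
      (fromReal ρ C.* e₁) C.* (fromReal (ρ ^ m) C.* e m)   ≈⟨ C.*-assoc _ _ _ ⟩
      fromReal ρ C.* (e₁ C.* (fromReal (ρ ^ m) C.* e m))   ≈⟨ C.*-congˡ (C.trans (C.sym (C.*-assoc _ _ _)) (C.trans (C.*-congʳ (C.*-comm _ _)) (C.*-assoc _ _ _))) ⟩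
      fromReal ρ C.* (fromReal (ρ ^ m) C.* (e₁ C.* e m))   ≈⟨ C.*-assoc _ _ _ ⟨
      (fromReal ρ C.* fromReal (ρ ^ m)) C.* (e₁ C.* e m)   ≈⟨ C.*-cong (fromReal-* _ _) (e-suc m) ⟨
      fromReal (ρ * ρ ^ m) C.* e (suc m)                   ∎

    polar-pos : ∀ {L} → IsLinearFunctional L → 0# < 1# → 0# < ρ → ∀ m → 0# < L (e m) → 0# < L (w ^ᶜ m)
    polar-pos L-linear 0<1 0<ρ m 0<Le = <-≤-trans (*-pos (^-pos 0<1 0<ρ m) 0<Le)
      (≤-reflexive (sym (trans (IsLinearFunctional.cong L-linear (polar-^ m)) (IsLinearFunctional.*-homo L-linear _ _))))

  evaluateᶜ : ∀ {n} → Vector Carrier n → C.Carrier → C.Carrier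
  evaluateᶜ a z = ∑.sum (λ m → fromReal (a m) C.* z ^ᶜ toℕ m)

  -- Compares the operations, because comparing two evaluations by refl would unfold the polynomial.
  evaluateᶜ-unique : (sum′ : ∀ n → Vector C.Carrier n → C.Carrier) (_·_ : C.Carrier → C.Carrier → C.Carrier) (_^′_ : C.Carrier → ℕ → C.Carrier) →
                     sum′ ≡ (λ _ → ∑.sum) → _·_ ≡ C._*_ → _^′_ ≡ _^ᶜ_ →
                     ∀ {n} (a : Vector Carrier n) z → sum′ n (λ m → fromReal (a m) · (z ^′ toℕ m)) ≡ evaluateᶜ a z
  evaluateᶜ-unique _ _ _ ≡.refl ≡.refl ≡.refl a z = ≡.refl

  module _ {L} (L-linear : IsLinearFunctional L) where
    open IsLinearFunctional L-linear

    sum-homo : ∀ {n} (f : Vector C.Carrier n) → L (∑.sum f) ≈ sum (L ∘ f)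
    sum-homo {zero}  f = 0#-homo
    sum-homo {suc n} f = trans (+-homo _ _) (+-congˡ (sum-homo (f ∘ suc)))

    module _ (v : Carrier) (0≤v : 0# ≤ v) (n : ℕ) (z w : C.Carrier) (z≈v+w : z C.≈ fromReal v C.+ w)
             (0≤L1 : 0# ≤ L C.1#) (0<Lw^ : ∀ m → m ℕ.< n → 0# < L (w ^ᶜ suc m)) where

      private
        W : ℕ → ℕ → Carrier
        W k m = L (z ^ᶜ k C.* w ^ᶜ m)

        W₀ : ∀ m → W 0 m ≈ L (w ^ᶜ m)
        W₀ m = cong (C.*-identityˡ (w ^ᶜ m))

        W-suc : ∀ k m → W (suc k) m ≈ v * W k m + W k (suc m)
        W-suc k m = trans (cong step) (trans (+-homo _ _) (+-congʳ (*-homo v _)))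
          where
          u = z ^ᶜ k
          step : (z C.* u) C.* w ^ᶜ m C.≈ fromReal v C.* (u C.* w ^ᶜ m) C.+ u C.* (w C.* w ^ᶜ m)
          step = begin
            (z C.* u) C.* w ^ᶜ m                                                ≈⟨ C.*-assoc _ _ _ ⟩
            z C.* (u C.* w ^ᶜ m)                                                ≈⟨ C.*-congʳ z≈v+w ⟩
            (fromReal v C.+ w) C.* (u C.* w ^ᶜ m)                               ≈⟨ C.distribʳ _ _ _ ⟩
            fromReal v C.* (u C.* w ^ᶜ m) C.+ w C.* (u C.* w ^ᶜ m)              ≈⟨ C.+-congˡ (C.trans (C.sym (C.*-assoc _ _ _)) (C.trans (C.*-congʳ (C.*-comm _ _)) (C.*-assoc _ _ _))) ⟩
            fromReal v C.* (u C.* w ^ᶜ m) C.+ u C.* (w C.* w ^ᶜ m)              ∎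

      module _ .{{_ : NonZero n}} (a : Vector Carrier (suc n)) (0<aₙ : 0# < a (fromℕ n))
               {ℓ} (j : Fin ℓ → Fin (suc n)) (j-inj : Injective _≡_ _≡_ j)
               (0≤a : ∀ m → (∀ i → j i ≢ m) → 0# ≤ a m)
               (b : Vector Carrier ℓ) (0<b : ∀ i → 0# < b i) (b+a≈0 : ∀ i → b i + a (j i) ≈ 0#)
               (k : Fin (suc n)) (j<k : ∀ i → j i Fin.< k) (0<aₖ : 0# < a k)
               (∑b≤ : ∀ i → sum b ≤ a k * v ^ (toℕ k ℕ.∸ toℕ (j i))) where

        private
          L-evaluate : sum (λ m → a m * W (toℕ m) 0) ≈ L (evaluateᶜ a z)
          L-evaluate = trans (sum-cong-≋ {suc n} {λ m → a m * W (toℕ m) 0} {λ m → L (fromReal (a m) C.* z ^ᶜ toℕ m)} λ m →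
            trans (*-congˡ (cong (C.*-identityʳ (z ^ᶜ toℕ m)))) (sym (*-homo (a m) (z ^ᶜ toℕ m)))) (sym (sum-homo (λ m → fromReal (a m) C.* z ^ᶜ toℕ m)))

        evaluate≉0 : ¬ evaluateᶜ a z C.≈ C.0#
        evaluate≉0 f≈0 = sum≉0 v 0≤v n W W-suc
          (≤-trans 0≤L1 (≤-reflexive (sym (W₀ 0)))) (λ m m<n → <-≤-trans (0<Lw^ m m<n) (≤-reflexive (sym (W₀ (suc m)))))
          a 0<aₙ j j-inj 0≤a b 0<b b+a≈0 k j<k 0<aₖ ∑b≤
          (trans L-evaluate (trans (cong f≈0) 0#-homo))

-- Addition theorems for truncated series over the rationals

module ExponentialSeries where
  open import Data.Nat using (_!)
  open import Data.Rational renaming (∣_∣ to abs)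
  open import Data.Rational.Properties
  open import Data.Rational.Solver using (module +-*-Solver)
  open +-*-Solver
  open ≡ using (cong; cong₂; sym; trans; subst; refl)
  open Defs.RationalSequences
  open Defs using (re-i; im-i)

  ∑-cong : ∀ {s t} → (∀ k → s k ≡ t k) → ∀ n → ∑ s n ≡ ∑ t n
  ∑-cong s≡t zero    = refl
  ∑-cong s≡t (suc n) = cong₂ _+_ (∑-cong s≡t n) (s≡t n)

  ∑-linear : ∀ c s t n → ∑ (λ k → s k + c * t k) n ≡ ∑ s n + c * ∑ t n
  ∑-linear c s t zero    = solve 1 (λ c → con 0ℚ := con 0ℚ :+ c :* con 0ℚ) refl c
  ∑-linear c s t (suc n) = trans (cong (_+ (s n + c * t n)) (∑-linear c s t n))
    (solve 5 (λ c S T a b → S :+ c :* T :+ (a :+ c :* b) := S :+ a :+ c :* (T :+ b)) refl c (∑ s n) (∑ t n) (s n) (t n))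

  ∑-neg : ∀ t n → ∑ (λ k → - t k) n ≡ - ∑ t n
  ∑-neg t zero    = refl
  ∑-neg t (suc n) = trans (cong (_+ - t n) (∑-neg t n)) (sym (neg-distrib-+ (∑ t n) (t n)))

  ∑-front : ∀ t n → ∑ t (suc n) ≡ t 0 + ∑ (t ∘ suc) n
  ∑-front t zero    = +-comm 0ℚ (t 0)
  ∑-front t (suc n) = trans (cong (_+ t (suc n)) (∑-front t n)) (+-assoc (t 0) (∑ (t ∘ suc) n) (t (suc n)))

  ∑-nonNeg : ∀ {t} → (∀ k → 0ℚ ≤ t k) → ∀ n → 0ℚ ≤ ∑ t n
  ∑-nonNeg h zero    = ≤-refl
  ∑-nonNeg h (suc n) = +-nn (∑-nonNeg h n) (h n)

  ∑-mono : ∀ {t} → (∀ k → 0ℚ ≤ t k) → ∀ {m n} → m ℕ.≤ n → ∑ t m ≤ ∑ t n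
  ∑-mono {t} h {m} {n} m≤n = subst (λ n → ∑ t m ≤ ∑ t n) (ℕₚ.m∸n+n≡m m≤n) (go (n ℕ.∸ m))
    where
    go : ∀ d → ∑ t m ≤ ∑ t (d ℕ.+ m)
    go zero    = ≤-refl
    go (suc d) = ≤-trans (go d) (by (t (d ℕ.+ m)) (solve 2 (λ s t → s :+ t :- s := t) refl (∑ t (d ℕ.+ m)) (t (d ℕ.+ m))) (h (d ℕ.+ m)))

  ∑-abs-≤ : ∀ {s S} → (∀ k → abs (s k) ≤ S k) → ∀ n → abs (∑ s n) ≤ ∑ S n
  ∑-abs-≤ h zero    = ≤-refl
  ∑-abs-≤ {s} h (suc n) = ≤-trans (∣p+q∣≤∣p∣+∣q∣ (∑ s n) (s n)) (+-mono-≤ (∑-abs-≤ h n) (h n))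

  ∑-abs-diff : ∀ {s S} → (∀ k → abs (s k) ≤ S k) → ∀ {m n} → m ℕ.≤ n → abs (∑ s n - ∑ s m) ≤ ∑ S n - ∑ S m
  ∑-abs-diff {s} {S} h {m} {n} m≤n = subst (λ n → abs (∑ s n - ∑ s m) ≤ ∑ S n - ∑ S m) (ℕₚ.m∸n+n≡m m≤n) (go (n ℕ.∸ m))
    where
    go : ∀ d → abs (∑ s (d ℕ.+ m) - ∑ s m) ≤ ∑ S (d ℕ.+ m) - ∑ S m
    go zero    = ≤-reflexive (trans (cong abs (+-inverseʳ (∑ s m))) (sym (+-inverseʳ (∑ S m))))
    go (suc d) = begin
      abs (∑ s (d ℕ.+ m) + s (d ℕ.+ m) - ∑ s m)
        ≡⟨ cong abs (solve 3 (λ a b c → a :+ b :- c := (a :- c) :+ b) refl (∑ s (d ℕ.+ m)) (s (d ℕ.+ m)) (∑ s m)) ⟩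
      abs ((∑ s (d ℕ.+ m) - ∑ s m) + s (d ℕ.+ m))      ≤⟨ ∣p+q∣≤∣p∣+∣q∣ (∑ s (d ℕ.+ m) - ∑ s m) (s (d ℕ.+ m)) ⟩
      abs (∑ s (d ℕ.+ m) - ∑ s m) + abs (s (d ℕ.+ m))  ≤⟨ +-mono-≤ (go d) (h (d ℕ.+ m)) ⟩
      (∑ S (d ℕ.+ m) - ∑ S m) + S (d ℕ.+ m)
        ≡⟨ solve 3 (λ a b c → (a :- c) :+ b := a :+ b :- c) refl (∑ S (d ℕ.+ m)) (S (d ℕ.+ m)) (∑ S m) ⟩
      ∑ S (d ℕ.+ m) + S (d ℕ.+ m) - ∑ S m              ∎
      where open ≤-Reasoning

  -- The coefficient of the Cauchy product, ∑ f i * g j over i + j = n. Shifting `f` avoids index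
  -- subtraction.
  conv : (ℕ → ℚ) → (ℕ → ℚ) → ℕ → ℚ
  conv f g zero    = f 0 * g 0
  conv f g (suc n) = f 0 * g (suc n) + conv (f ∘ suc) g n

  conv-cong : ∀ {f f′ g g′} → (∀ k → f k ≡ f′ k) → (∀ k → g k ≡ g′ k) → ∀ n → conv f g n ≡ conv f′ g′ n
  conv-cong p q zero    = cong₂ _*_ (p 0) (q 0)
  conv-cong p q (suc n) = cong₂ _+_ (cong₂ _*_ (p 0) (q (suc n))) (conv-cong (p ∘ suc) q n)

  conv-+ˡ : ∀ f f′ g n → conv (λ k → f k + f′ k) g n ≡ conv f g n + conv f′ g n
  conv-+ˡ f f′ g zero    = *-distribʳ-+ (g 0) (f 0) (f′ 0)
  conv-+ˡ f f′ g (suc n) = trans (cong ((f 0 + f′ 0) * g (suc n) +_) (conv-+ˡ (f ∘ suc) (f′ ∘ suc) g n))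
    (solve 5 (λ a b c x y → (a :+ b) :* c :+ (x :+ y) := a :* c :+ x :+ (b :* c :+ y)) refl (f 0) (f′ 0) (g (suc n)) (conv (f ∘ suc) g n) (conv (f′ ∘ suc) g n))

  conv-*ˡ : ∀ x f g n → conv (λ k → x * f k) g n ≡ x * conv f g n
  conv-*ˡ x f g zero    = *-assoc x (f 0) (g 0)
  conv-*ˡ x f g (suc n) = trans (cong (x * f 0 * g (suc n) +_) (conv-*ˡ x (f ∘ suc) g n))
    (solve 4 (λ x a b c → x :* a :* b :+ x :* c := x :* (a :* b :+ c)) refl x (f 0) (g (suc n)) (conv (f ∘ suc) g n))

  conv-*ʳ : ∀ x f g n → conv f (λ k → x * g k) n ≡ x * conv f g n
  conv-*ʳ x f g zero    = solve 3 (λ a x b → a :* (x :* b) := x :* (a :* b)) refl (f 0) x (g 0)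
  conv-*ʳ x f g (suc n) = trans (cong (f 0 * (x * g (suc n)) +_) (conv-*ʳ x (f ∘ suc) g n))
    (solve 4 (λ x a b c → a :* (x :* b) :+ x :* c := x :* (a :* b :+ c)) refl x (f 0) (g (suc n)) (conv (f ∘ suc) g n))

  conv-nonNeg : ∀ {f g} → (∀ k → 0ℚ ≤ f k) → (∀ k → 0ℚ ≤ g k) → ∀ n → 0ℚ ≤ conv f g n
  conv-nonNeg 0≤f 0≤g zero    = *-nn (0≤f 0) (0≤g 0)
  conv-nonNeg 0≤f 0≤g (suc n) = +-nn (*-nn (0≤f 0) (0≤g (suc n))) (conv-nonNeg (0≤f ∘ suc) 0≤g n)

  -- The derivative, on coefficient sequences of power series.
  D : (ℕ → ℚ) → ℕ → ℚ
  D f k = ι (suc k) * f (suc k)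

  -- The product rule for formal power series. For F = f 0 + T F₁ the induction uses F′ = F₁ + T
  -- F₁′, which is `step` on coefficients.
  leibniz : ∀ f g n → ι (suc n) * conv f g (suc n) ≡ conv (D f) g n + conv f (D g) n
  leibniz f g zero    = solve 5 (λ i a b c d → i :* (a :* d :+ b :* c) := i :* b :* c :+ a :* (i :* d)) refl (ι 1) (f 0) (f 1) (g 0) (g 1)
  leibniz f g (suc n) = begin
    ι (suc (suc n)) * (f 0 * g (suc (suc n)) + c)
      ≡⟨ *-distribˡ-+ (ι (suc (suc n))) (f 0 * g (suc (suc n))) c ⟩
    ι (suc (suc n)) * (f 0 * g (suc (suc n))) + ι (suc (suc n)) * c
      ≡⟨ cong₂ _+_ (solve 3 (λ i a b → i :* (a :* b) := a :* (i :* b)) refl (ι (suc (suc n))) (f 0) (g (suc (suc n))))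
                   (trans (cong (_* c) (ι-suc (suc n))) (*-distribʳ-+ c 1ℚ (ι (suc n)))) ⟩
    f 0 * D g (suc n) + (1ℚ * c + ι (suc n) * c)
      ≡⟨ cong (λ z → f 0 * D g (suc n) + (1ℚ * c + z)) (leibniz (f ∘ suc) g n) ⟩
    f 0 * D g (suc n) + (1ℚ * c + (p + q))
      ≡⟨ solve 6 (λ s t w h p q → s :+ (con 1ℚ :* (t :* w :+ h) :+ (p :+ q)) := con 1ℚ :* t :* w :+ (p :+ h) :+ (s :+ q)) refl
           (f 0 * D g (suc n)) (f 1) (g (suc n)) (conv (f ∘ (2 ℕ.+_)) g n) p q ⟩
    D f 0 * g (suc n) + (p + conv (f ∘ (2 ℕ.+_)) g n) + (f 0 * D g (suc n) + q)
      ≡⟨ cong (λ z → D f 0 * g (suc n) + z + (f 0 * D g (suc n) + q)) (trans (sym (conv-+ˡ (D (f ∘ suc)) (f ∘ (2 ℕ.+_)) g n)) (conv-cong step (λ _ → refl) n)) ⟩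
    D f 0 * g (suc n) + conv (D f ∘ suc) g n + (f 0 * D g (suc n) + q) ∎
    where
    open ≡.≡-Reasoning
    c = conv (f ∘ suc) g (suc n)
    p = conv (D (f ∘ suc)) g n
    q = conv (f ∘ suc) (D g) n
    step : ∀ k → D (f ∘ suc) k + f (suc (suc k)) ≡ D f (suc k)
    step k = trans (solve 2 (λ i a → i :* a :+ a := (con 1ℚ :+ i) :* a) refl (ι (suc k)) (f (suc (suc k)))) (cong (_* f (suc (suc k))) (sym (ι-suc (suc k))))

  ι-cancel : ∀ k {a b} → ι (suc k) * a ≡ ι (suc k) * b → a ≡ b
  ι-cancel k {a} {b} e = trans (unscale a) (trans (cong (recip (suc k) *_) e) (sym (unscale b)))
    where
    unscale : ∀ a → a ≡ recip (suc k) * (ι (suc k) * a)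
    unscale a = trans (sym (*-identityˡ a)) (trans (cong (_* a) (sym (ι-recip k)))
      (solve 3 (λ i r a → i :* r :* a := r :* (i :* a)) refl (ι (suc k)) (recip (suc k)) a))

  -- The coefficients of e^(xT) as a power series in T.
  e : ℚ → ℕ → ℚ
  e x k = x ^ k * recip (k !) {{ℕₚ._!≢0 k}}

  D-e : ∀ x k → D (e x) k ≡ x * e x k
  D-e x k = begin
    ι (suc k) * (x * x ^ k * recip (suc k !) {{ℕₚ._!≢0 (suc k)}})
      ≡⟨ cong (λ z → ι (suc k) * (x * x ^ k * z)) (recip-* (suc k) (k !) {{_}} {{ℕₚ._!≢0 k}} {{ℕₚ._!≢0 (suc k)}}) ⟩
    ι (suc k) * (x * x ^ k * (recip (suc k) * r))
      ≡⟨ solve 5 (λ i x p s r → i :* (x :* p :* (s :* r)) := i :* s :* (x :* (p :* r))) refl (ι (suc k)) x (x ^ k) (recip (suc k)) r ⟩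
    ι (suc k) * recip (suc k) * (x * e x k)
      ≡⟨ cong (_* (x * e x k)) (ι-recip k) ⟩
    1ℚ * (x * e x k)
      ≡⟨ *-identityˡ (x * e x k) ⟩
    x * e x k ∎
    where
    open ≡.≡-Reasoning
    r = recip (k !) {{ℕₚ._!≢0 k}}

  -- The binomial theorem without binomial coefficients: both sides solve h′ = (x + y) h with the
  -- same constant term, and cancelling n + 1 determines each next coefficient.
  conv-e : ∀ x y n → conv (e x) (e y) n ≡ e (x + y) n
  conv-e x y zero    = refl
  conv-e x y (suc n) = ι-cancel n (begin
    ι (suc n) * conv (e x) (e y) (suc n)
      ≡⟨ leibniz (e x) (e y) n ⟩
    conv (D (e x)) (e y) n + conv (e x) (D (e y)) n
      ≡⟨ cong₂ _+_ (trans (conv-cong (D-e x) (λ _ → refl) n) (conv-*ˡ x (e x) (e y) n)) (trans (conv-cong (λ _ → refl) (D-e y) n) (conv-*ʳ y (e x) (e y) n)) ⟩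
    x * conv (e x) (e y) n + y * conv (e x) (e y) n
      ≡⟨ *-distribʳ-+ (conv (e x) (e y) n) x y ⟨
    (x + y) * conv (e x) (e y) n
      ≡⟨ cong ((x + y) *_) (conv-e x y n) ⟩
    (x + y) * e (x + y) n
      ≡⟨ D-e (x + y) n ⟨
    ι (suc n) * e (x + y) (suc n) ∎)
    where open ≡.≡-Reasoning

  -- `∑ (conv f g) n` runs over the triangle i + j < n. Splitting off the row i = 0 leaves a smaller
  -- triangle for the shifted `f`.
  ∑-conv-suc : ∀ f g n → ∑ (conv f g) (suc n) ≡ f 0 * ∑ g (suc n) + ∑ (conv (f ∘ suc) g) n
  ∑-conv-suc f g zero    = solve 2 (λ a b → con 0ℚ :+ a :* b := a :* (con 0ℚ :+ b) :+ con 0ℚ) refl (f 0) (g 0)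
  ∑-conv-suc f g (suc n) = trans (cong (_+ conv f g (suc n)) (∑-conv-suc f g n))
    (solve 5 (λ a s t b c → a :* s :+ t :+ (a :* b :+ c) := a :* (s :+ b) :+ (t :+ c)) refl (f 0) (∑ g (suc n)) (∑ (conv (f ∘ suc) g) n) (g (suc n)) (conv (f ∘ suc) g n))

  -- The sum of f i * g j over the corner i < a, j < b, i + j ≥ n.
  corner-≤ : ∀ {f g F G} → (∀ k → abs (f k) ≤ F k) → (∀ k → abs (g k) ≤ G k) → ∀ n a b → n ℕ.≤ a → n ℕ.≤ b →
             abs (∑ f a * ∑ g b - ∑ (conv f g) n) ≤ ∑ F a * ∑ G b - ∑ (conv F G) n
  corner-≤ {f} {g} {F} {G} f≤F g≤G zero a b _ _ = begin
    abs (∑ f a * ∑ g b - 0ℚ)      ≡⟨ cong abs (+-identityʳ (∑ f a * ∑ g b)) ⟩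
    abs (∑ f a * ∑ g b)           ≡⟨ ∣p*q∣≡∣p∣*∣q∣ (∑ f a) (∑ g b) ⟩
    abs (∑ f a) * abs (∑ g b)     ≤⟨ *-mono-nn (0≤∣p∣ (∑ f a)) (∑-abs-≤ f≤F a) (0≤∣p∣ (∑ g b)) (∑-abs-≤ g≤G b) ⟩
    ∑ F a * ∑ G b                 ≡⟨ +-identityʳ (∑ F a * ∑ G b) ⟨
    ∑ F a * ∑ G b - 0ℚ            ∎
    where open ≤-Reasoning
  corner-≤ {f} {g} {F} {G} f≤F g≤G (suc n) (suc a) b (ℕ.s≤s n≤a) n<b = begin
    abs (∑ f (suc a) * ∑ g b - ∑ (conv f g) (suc n))
      ≡⟨ cong abs (peel f g) ⟩
    abs (f 0 * (∑ g b - ∑ g (suc n)) + (∑ f′ a * ∑ g b - ∑ (conv f′ g) n))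
      ≤⟨ ∣p+q∣≤∣p∣+∣q∣ (f 0 * (∑ g b - ∑ g (suc n))) _ ⟩
    abs (f 0 * (∑ g b - ∑ g (suc n))) + abs (∑ f′ a * ∑ g b - ∑ (conv f′ g) n)
      ≡⟨ cong (_+ abs (∑ f′ a * ∑ g b - ∑ (conv f′ g) n)) (∣p*q∣≡∣p∣*∣q∣ (f 0) (∑ g b - ∑ g (suc n))) ⟩
    abs (f 0) * abs (∑ g b - ∑ g (suc n)) + abs (∑ f′ a * ∑ g b - ∑ (conv f′ g) n)
      ≤⟨ +-mono-≤ (*-mono-nn (0≤∣p∣ (f 0)) (f≤F 0) (0≤∣p∣ _) (∑-abs-diff g≤G n<b)) (corner-≤ (f≤F ∘ suc) g≤G n a b n≤a (ℕₚ.<⇒≤ n<b)) ⟩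
    F 0 * (∑ G b - ∑ G (suc n)) + (∑ F′ a * ∑ G b - ∑ (conv F′ G) n)
      ≡⟨ peel F G ⟨
    ∑ F (suc a) * ∑ G b - ∑ (conv F G) (suc n) ∎
    where
    open ≤-Reasoning
    f′ = f ∘ suc
    F′ = F ∘ suc
    -- Separates the row i = 0 of the corner, where n < j < b, from the corner of the shifted `f`;
    -- the same identity serves the terms and their majorants.
    peel : ∀ f g → ∑ f (suc a) * ∑ g b - ∑ (conv f g) (suc n) ≡ f 0 * (∑ g b - ∑ g (suc n)) + (∑ (f ∘ suc) a * ∑ g b - ∑ (conv (f ∘ suc) g) n)
    peel f g = trans (cong₂ (λ s t → s * ∑ g b - t) (∑-front f a) (∑-conv-suc f g n))
      (solve 5 (λ c s w t u → (c :+ s) :* w :- (c :* t :+ u) := c :* (w :- t) :+ (s :* w :- u)) refl (f 0) (∑ (f ∘ suc) a) (∑ g b) (∑ g (suc n)) (∑ (conv (f ∘ suc) g) n))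

  -- All terms are nonnegative, and the rectangle i < a, j < b lies inside the triangle i + j < n.
  rectangle-≤ : ∀ {F G} → (∀ k → 0ℚ ≤ F k) → (∀ k → 0ℚ ≤ G k) → ∀ a b n → a ℕ.+ b ℕ.≤ n → ∑ F a * ∑ G b ≤ ∑ (conv F G) n
  rectangle-≤ {F} {G} 0≤F 0≤G zero b n _ = subst (_≤ ∑ (conv F G) n) (sym (*-zeroˡ (∑ G b))) (∑-nonNeg (conv-nonNeg 0≤F 0≤G) n)
  rectangle-≤ {F} {G} 0≤F 0≤G (suc a) b (suc n) (ℕ.s≤s a+b≤n) = begin
    ∑ F (suc a) * ∑ G b                          ≡⟨ cong (_* ∑ G b) (∑-front F a) ⟩
    (F 0 + ∑ (F ∘ suc) a) * ∑ G b                ≡⟨ *-distribʳ-+ (∑ G b) (F 0) (∑ (F ∘ suc) a) ⟩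
    F 0 * ∑ G b + ∑ (F ∘ suc) a * ∑ G b          ≤⟨ +-mono-≤ (*-mono-nn (0≤F 0) ≤-refl (∑-nonNeg 0≤G b) (∑-mono 0≤G (ℕₚ.≤-trans (ℕₚ.m≤n+m b a) (ℕₚ.m≤n⇒m≤1+n a+b≤n))))
                                                             (rectangle-≤ (0≤F ∘ suc) 0≤G a b n a+b≤n) ⟩
    F 0 * ∑ G (suc n) + ∑ (conv (F ∘ suc) G) n   ≡⟨ ∑-conv-suc F G n ⟨
    ∑ (conv F G) (suc n)                         ∎
    where open ≤-Reasoning

  module _ {B : ℚ} (1≤B : 1ℚ ≤ B) where

    private
      1≤+ : ∀ {B} → 1ℚ ≤ B → 1ℚ ≤ B + B
      1≤+ {B} 1≤B = ≤-trans 1≤B (by B (solve 1 (λ b → b :+ b :- b := b) refl B) (≤-trans (<⇒≤ 0<1) 1≤B))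

      1≤2B : 1ℚ ≤ B + B
      1≤2B = 1≤+ 1≤B

    1≤4B : 1ℚ ≤ (B + B) + (B + B)
    1≤4B = 1≤+ 1≤2B

    -- The error is the corner of the n by n square beyond the triangle. `term≤` majorises both
    -- series by (2B)^k / k!, whose Cauchy square is (4B)^k / k!. As the square lies in the triangle
    -- of size 2n, the error is at most the segment of the 4B series from n to 2n, which `∑u-tail`
    -- bounds by twice its first term.
    product-≤ : ∀ c d → (∀ k → abs (c k) ≤ 1ℚ) → (∀ k → abs (d k) ≤ 1ℚ) →
                ∀ x y → abs x ≤ B → abs y ≤ B → ∀ n → K 1≤4B ℕ.≤ n →
                abs (∑ (term c x) n * ∑ (term d y) n - ∑ (conv (term c x) (term d y)) n) ≤ u 1≤4B n + u 1≤4B n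
    product-≤ c d c≤1 d≤1 x y ∣x∣≤B ∣y∣≤B n K≤n = begin
      abs (∑ (term c x) n * ∑ (term d y) n - ∑ (conv (term c x) (term d y)) n)
        ≤⟨ corner-≤ (term≤ 1≤2B 1≤B refl c c≤1 x ∣x∣≤B) (term≤ 1≤2B 1≤B refl d d≤1 y ∣y∣≤B) n n n ℕₚ.≤-refl ℕₚ.≤-refl ⟩
      ∑ (u 1≤2B) n * ∑ (u 1≤2B) n - ∑ (conv (u 1≤2B) (u 1≤2B)) n
        ≤⟨ +-monoˡ-≤ (- ∑ (conv (u 1≤2B) (u 1≤2B)) n) (rectangle-≤ (u-nn 1≤2B) (u-nn 1≤2B) n n (n ℕ.+ n) ℕₚ.≤-refl) ⟩
      ∑ (conv (u 1≤2B) (u 1≤2B)) (n ℕ.+ n) - ∑ (conv (u 1≤2B) (u 1≤2B)) n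
        ≡⟨ cong₂ _-_ (∑-cong (conv-e (B + B) (B + B)) (n ℕ.+ n)) (∑-cong (conv-e (B + B) (B + B)) n) ⟩
      ∑ (u 1≤4B) (n ℕ.+ n) - ∑ (u 1≤4B) n
        ≤⟨ ∑u-tail 1≤4B (1≤2B) refl c c≤1 n n K≤n ⟩
      u 1≤4B n + u 1≤4B n ∎
      where open ≤-Reasoning

  -- In the n-th Cauchy coefficient every pair has i + j = n, so the addition rule for the factors
  -- i^k pulls out as the single factor `r n`. The sign σ is -1 for the cosine and 1 for the sine.
  conv-coefficients : ∀ σ {p q p′ q′ r : ℕ → ℚ} → (∀ i j → p i * q j + σ * (p′ i * q′ j) ≡ r (i ℕ.+ j)) → ∀ f g n →
                      conv (λ k → p k * f k) (λ k → q k * g k) n + σ * conv (λ k → p′ k * f k) (λ k → q′ k * g k) n ≡ r n * conv f g n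
  conv-coefficients σ {p} {q} {p′} {q′} {r} h f g zero =
    trans (solve 7 (λ p q s t w a b → p :* a :* (q :* b) :+ s :* (t :* a :* (w :* b)) := (p :* q :+ s :* (t :* w)) :* (a :* b)) refl
             (p 0) (q 0) σ (p′ 0) (q′ 0) (f 0) (g 0))
          (cong (_* (f 0 * g 0)) (h 0 0))
  conv-coefficients σ {p} {q} {p′} {q′} {r} h f g (suc n) = begin
    p 0 * f 0 * (q m * g m) + S + σ * (p′ 0 * f 0 * (q′ m * g m) + T)
      ≡⟨ solve 9 (λ p q s t w a b c d → p :* a :* (q :* b) :+ c :+ s :* (t :* a :* (w :* b) :+ d) := (p :* q :+ s :* (t :* w)) :* (a :* b) :+ (c :+ s :* d)) refl
           (p 0) (q m) σ (p′ 0) (q′ m) (f 0) (g m) S T ⟩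
    (p 0 * q m + σ * (p′ 0 * q′ m)) * (f 0 * g m) + (S + σ * T)
      ≡⟨ cong₂ (λ a b → a * (f 0 * g m) + b) (h 0 m) (conv-coefficients σ {p ∘ suc} {q} {p′ ∘ suc} {q′} {r ∘ suc} (h ∘ suc) (f ∘ suc) g n) ⟩
    r m * (f 0 * g m) + r m * conv (f ∘ suc) g n
      ≡⟨ *-distribˡ-+ (r m) (f 0 * g m) (conv (f ∘ suc) g n) ⟨
    r m * (f 0 * g m + conv (f ∘ suc) g n) ∎
    where
    open ≡.≡-Reasoning
    m = suc n
    S = conv (λ k → p (suc k) * f (suc k)) (λ k → q k * g k) n
    T = conv (λ k → p′ (suc k) * f (suc k)) (λ k → q′ k * g k) n

  addition-≤ : ∀ {B} (1≤B : 1ℚ ≤ B) σ → abs σ ≡ 1ℚ → ∀ {p q p′ q′ r : ℕ → ℚ} →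
               (∀ k → abs (p k) ≤ 1ℚ) → (∀ k → abs (q k) ≤ 1ℚ) → (∀ k → abs (p′ k) ≤ 1ℚ) → (∀ k → abs (q′ k) ≤ 1ℚ) →
               (∀ i j → p i * q j + σ * (p′ i * q′ j) ≡ r (i ℕ.+ j)) →
               ∀ x y → abs x ≤ B → abs y ≤ B → ∀ n → K (1≤4B 1≤B) ℕ.≤ n → ∀ {ε} → u (1≤4B 1≤B) n ≤ ε →
               abs (∑ (term r (x + y)) n - (∑ (term p x) n * ∑ (term q y) n + σ * (∑ (term p′ x) n * ∑ (term q′ y) n))) ≤ ι 4 * ε
  addition-≤ {B} 1≤B σ ∣σ∣≡1 {p} {q} {p′} {q′} {r} p≤1 q≤1 p′≤1 q′≤1 h x y ∣x∣≤B ∣y∣≤B n K≤n {ε} u≤ε = begin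
    abs (∑ (term r (x + y)) n - (P + σ * Q))
      ≡⟨ cong (λ s → abs (s - (P + σ * Q))) sums ⟩
    abs (P₀ + σ * Q₀ - (P + σ * Q))
      ≡⟨ ∣-∣-sym (P₀ + σ * Q₀) (P + σ * Q) ⟩
    abs (P + σ * Q - (P₀ + σ * Q₀))
      ≡⟨ cong abs (solve 5 (λ a b s c d → a :+ s :* c :- (b :+ s :* d) := (a :- b) :+ s :* (c :- d)) refl P P₀ σ Q Q₀) ⟩
    abs ((P - P₀) + σ * (Q - Q₀))
      ≤⟨ ∣p+q∣≤∣p∣+∣q∣ (P - P₀) (σ * (Q - Q₀)) ⟩
    abs (P - P₀) + abs (σ * (Q - Q₀))
      ≡⟨ cong (abs (P - P₀) +_) (trans (∣p*q∣≡∣p∣*∣q∣ σ (Q - Q₀)) (trans (cong (_* abs (Q - Q₀)) ∣σ∣≡1) (*-identityˡ (abs (Q - Q₀))))) ⟩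
    abs (P - P₀) + abs (Q - Q₀)
      ≤⟨ +-mono-≤ (product-≤ 1≤B p q p≤1 q≤1 x y ∣x∣≤B ∣y∣≤B n K≤n) (product-≤ 1≤B p′ q′ p′≤1 q′≤1 x y ∣x∣≤B ∣y∣≤B n K≤n) ⟩
    (w + w) + (w + w)
      ≤⟨ +-mono-≤ (+-mono-≤ u≤ε u≤ε) (+-mono-≤ u≤ε u≤ε) ⟩
    (ε + ε) + (ε + ε)
      ≡⟨ solve 1 (λ e → (e :+ e) :+ (e :+ e) := con (ι 4) :* e) refl ε ⟩
    ι 4 * ε ∎
    where
    open ≤-Reasoning
    w = u (1≤4B 1≤B) n
    P = ∑ (term p x) n * ∑ (term q y) n
    Q = ∑ (term p′ x) n * ∑ (term q′ y) n
    P₀ = ∑ (conv (term p x) (term q y)) n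
    Q₀ = ∑ (conv (term p′ x) (term q′ y)) n
    sums : ∑ (term r (x + y)) n ≡ P₀ + σ * Q₀
    sums = trans (∑-cong (λ k → trans (cong (r k *_) (sym (conv-e x y k))) (sym (conv-coefficients σ {p} {q} {p′} {q′} {r} h (e x) (e y) k))) n)
                 (∑-linear σ (conv (term p x) (term q y)) (conv (term p′ x) (term q′ y)) n)

  -- The real part of i^(j+k) = i^j i^k, shaped for `conv-coefficients`. Raising the first exponent
  -- by two negates both sides.
  re-i-+ : ∀ i j → re-i i * re-i j + - 1ℚ * (im-i i * im-i j) ≡ re-i (i ℕ.+ j)
  re-i-+ zero          j = solve 2 (λ a b → con 1ℚ :* a :+ con (- 1ℚ) :* (con 0ℚ :* b) := a) refl (re-i j) (im-i j)
  re-i-+ (suc zero)    j = trans (solve 2 (λ a b → con 0ℚ :* a :+ con (- 1ℚ) :* (con 1ℚ :* b) := :- b) refl (re-i j) (im-i j)) (-im-i j)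
    where
    -im-i : ∀ j → - im-i j ≡ re-i (suc j)
    -im-i zero          = refl
    -im-i (suc zero)    = refl
    -im-i (suc (suc j)) = cong -_ (-im-i j)
  re-i-+ (suc (suc i)) j = trans
    (solve 4 (λ a b c d → :- a :* b :+ con (- 1ℚ) :* (:- c :* d) := :- (a :* b :+ con (- 1ℚ) :* (c :* d))) refl (re-i i) (re-i j) (im-i i) (im-i j))
    (cong -_ (re-i-+ i j))

  im-i-+ : ∀ i j → re-i i * im-i j + 1ℚ * (im-i i * re-i j) ≡ im-i (i ℕ.+ j)
  im-i-+ zero          j = solve 2 (λ a b → con 1ℚ :* b :+ con 1ℚ :* (con 0ℚ :* a) := b) refl (re-i j) (im-i j)
  im-i-+ (suc zero)    j = trans (solve 2 (λ a b → con 0ℚ :* b :+ con 1ℚ :* (con 1ℚ :* a) := a) refl (re-i j) (im-i j)) (re-i-im-i j)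
    where
    re-i-im-i : ∀ j → re-i j ≡ im-i (suc j)
    re-i-im-i zero          = refl
    re-i-im-i (suc zero)    = refl
    re-i-im-i (suc (suc j)) = cong -_ (re-i-im-i j)
  im-i-+ (suc (suc i)) j = trans
    (solve 4 (λ a b c d → :- a :* b :+ con 1ℚ :* (:- c :* d) := :- (a :* b :+ con 1ℚ :* (c :* d))) refl (re-i i) (im-i j) (im-i i) (re-i j))
    (cong -_ (im-i-+ i j))

  ∑-im-i-neg : ∀ x n → ∑ (term im-i (- x)) n ≡ - ∑ (term im-i x) n
  ∑-im-i-neg x n = trans (∑-cong (λ k → term-neg k (recip (k !) {{ℕₚ._!≢0 k}})) n) (∑-neg (term im-i x) n)
    where
    term-neg : ∀ k r → im-i k * ((- x) ^ k * r) ≡ - (im-i k * (x ^ k * r))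
    term-neg zero          r = solve 1 (λ r → con 0ℚ :* (con 1ℚ :* r) := :- (con 0ℚ :* (con 1ℚ :* r))) refl r
    term-neg (suc zero)    r = solve 2 (λ x r → con 1ℚ :* (:- x :* con 1ℚ :* r) := :- (con 1ℚ :* (x :* con 1ℚ :* r))) refl x r
    term-neg (suc (suc k)) r = trans
      (solve 4 (λ i x p r → :- i :* (:- x :* (:- x :* p) :* r) := :- (x :* x) :* (i :* (p :* r))) refl (im-i k) x ((- x) ^ k) r)
      (trans (cong (- (x * x) *_) (term-neg k r))
        (solve 4 (λ i x p r → :- (x :* x) :* (:- (i :* (p :* r))) := :- (:- i :* (x :* (x :* p) :* r))) refl (im-i k) x (x ^ k) r))

  ∑-term-0 : ∀ c n → ∑ (term c 0ℚ) (suc n) ≡ c 0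
  ∑-term-0 c zero    = solve 1 (λ c → con 0ℚ :+ c :* con 1ℚ := c) refl (c 0)
  ∑-term-0 c (suc n) = trans (cong₂ _+_ (∑-term-0 c n) (solve 3 (λ c p r → c :* (con 0ℚ :* p :* r) := con 0ℚ) refl (c (suc n)) (0ℚ ^ n) (recip (suc n !) {{ℕₚ._!≢0 (suc n)}})))
    (+-identityʳ (c 0))

open import Defs

-- Cauchy reals as an ordered commutative semiring

module RealNumbers where
  open Defs.RationalSequences hiding (IsCauchy; _^_)
  open +-*-Solver
  open ≡ using (cong; cong₂; sym; trans; subst; refl)

  Eventually : (ℕ → Set) → Set
  Eventually P = ∃ λ N → ∀ n → N ℕ.≤ n → P n

  always : ∀ {P : ℕ → Set} → (∀ n → P n) → Eventually P
  always p = 0 , λ n _ → p n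

  map : ∀ {P Q : ℕ → Set} → (∀ n → P n → Q n) → Eventually P → Eventually Q
  map f (N , p) = N , λ n N≤n → f n (p n N≤n)

  map₂ : ∀ {P Q R : ℕ → Set} → (∀ n → P n → Q n → R n) → Eventually P → Eventually Q → Eventually R
  map₂ f (M , p) (N , q) = M ℕ.⊔ N , λ n h →
    f n (p n (ℕₚ.≤-trans (ℕₚ.m≤m⊔n M N) h)) (q n (ℕₚ.≤-trans (ℕₚ.m≤n⊔m M N) h))

  -- All operations act termwise on representatives, so this reduces each algebraic law to a
  -- rational identity.
  ≈-pointwise : ∀ x y → (∀ n → seq x n ≡ seq y n) → x ≈ y
  ≈-pointwise x y h ε 0<ε = always λ n → subst (λ z → ℚ.∣ seq x n ℚ.- z ∣ ℚ.< ε) (h n)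
    (subst (λ z → ℚ.∣ z ∣ ℚ.< ε) (sym (ℚₚ.+-inverseʳ (seq x n))) 0<ε)

  ≈-refl : ∀ x → x ≈ x
  ≈-refl x = ≈-pointwise x x λ _ → refl

  ≈-sym : ∀ x y → x ≈ y → y ≈ x
  ≈-sym x y x≈y ε 0<ε = map (λ n → subst (ℚ._< ε) (∣-∣-sym (seq x n) (seq y n))) (x≈y ε 0<ε)

  ≈-trans : ∀ x y z → x ≈ y → y ≈ z → x ≈ z
  ≈-trans x y z x≈y y≈z ε 0<ε = map₂ (λ n p q →
      ℚₚ.≤-<-trans (triangle (seq x n) (seq y n) (seq z n)) (subst (_ ℚ.<_) (half ε) (ℚₚ.+-mono-< p q)))
    (x≈y (½ ℚ.* ε) (half-pos 0<ε)) (y≈z (½ ℚ.* ε) (half-pos 0<ε))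

  -- Using the estimate at ε / (2C) absorbs the constant, and the spare factor 1/2 makes the
  -- inequality strict.
  ≈-scaled : ∀ x y C → 0ℚ ℚ.< C → (∀ ε → 0ℚ ℚ.< ε → Eventually λ n → ℚ.∣ seq x n ℚ.- seq y n ∣ ℚ.≤ C ℚ.* ε) → x ≈ y
  ≈-scaled x y C 0<C h ε 0<ε = map (λ n p → ℚₚ.≤-<-trans p (by< (½ ℚ.* ε) eq (half-pos 0<ε)))
    (h (½ ℚ.* ε ℚ.* inv C) (*-pos (half-pos 0<ε) (inv-pos 0<C)))
    where
    eq : ε ℚ.- C ℚ.* (½ ℚ.* ε ℚ.* inv C) ≡ ½ ℚ.* ε
    eq = trans (cong₂ ℚ._-_ (sym (half ε)) (trans (solve 3 (λ c e i → c :* (e :* i) := e :* (c :* i)) refl C (½ ℚ.* ε) (inv C))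
                                                (trans (cong (½ ℚ.* ε ℚ.*_) (inv-* 0<C)) (ℚₚ.*-identityʳ (½ ℚ.* ε)))))
               (solve 1 (λ h → h :+ h :- h := h) refl (½ ℚ.* ε))

  +-cong : ∀ x y z w → x ≈ y → z ≈ w → x + z ≈ y + w
  +-cong x y z w x≈y z≈w = ≈-scaled (x + z) (y + w) (1ℚ ℚ.+ 1ℚ) (ℚₚ.positive⁻¹ (1ℚ ℚ.+ 1ℚ)) λ ε 0<ε →
    map₂ (λ n p q → +-est (seq x n) (seq y n) (seq z n) (seq w n) (ℚₚ.<⇒≤ p) (ℚₚ.<⇒≤ q)) (x≈y ε 0<ε) (z≈w ε 0<ε)

  bound-of : ∀ x → ∃ λ B → 1ℚ ℚ.≤ B × Eventually λ n → ℚ.∣ seq x n ∣ ℚ.≤ B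
  bound-of x = bounded {seq x} (cauchy x)

  *-cong : ∀ x y z w → x ≈ y → z ≈ w → x * z ≈ y * w
  *-cong x y z w x≈y z≈w = helper (bound-of x) (bound-of w)
    where
    helper : (∃ λ A → 1ℚ ℚ.≤ A × Eventually λ n → ℚ.∣ seq x n ∣ ℚ.≤ A) → (∃ λ B → 1ℚ ℚ.≤ B × Eventually λ n → ℚ.∣ seq w n ∣ ℚ.≤ B) → x * z ≈ y * w
    helper (A , 1≤A , x≤A) (B , 1≤B , w≤B) = ≈-scaled (x * z) (y * w) (A ℚ.+ B) (+-pos (ℚₚ.<-≤-trans 0<1 1≤A) (ℚₚ.≤-trans (ℚₚ.<⇒≤ 0<1) 1≤B)) λ ε 0<ε →
      map₂ {λ n → P n × X ε n} {λ n → Q n × Y ε n}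
        (λ n p q → *-est (seq x n) (seq y n) (seq z n) (seq w n) {A} {B} {ε} (proj₁ p) (proj₁ q) (ℚₚ.<⇒≤ (proj₂ p)) (ℚₚ.<⇒≤ (proj₂ q)))
        (map₂ {P} {X ε} (λ _ → _,_) x≤A (x≈y ε 0<ε)) (map₂ {Q} {Y ε} (λ _ → _,_) w≤B (z≈w ε 0<ε))
      where
      P Q : ℕ → Set
      P n = ℚ.∣ seq x n ∣ ℚ.≤ A
      Q n = ℚ.∣ seq w n ∣ ℚ.≤ B
      X Y : ℚ → ℕ → Set
      X ε n = ℚ.∣ seq x n ℚ.- seq y n ∣ ℚ.< ε
      Y ε n = ℚ.∣ seq z n ℚ.- seq w n ∣ ℚ.< ε

  ≈-isEquivalence : IsEquivalence _≈_
  ≈-isEquivalence = record { refl = λ {x} → ≈-refl x ; sym = λ {x} {y} → ≈-sym x y ; trans = λ {x} {y} {z} → ≈-trans x y z }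

  ℝ-commutativeSemiring : CommutativeSemiring 0ℓ 0ℓ
  ℝ-commutativeSemiring = record
    { Carrier = ℝ ; _≈_ = _≈_ ; _+_ = _+_ ; _*_ = _*_ ; 0# = 0ℝ ; 1# = 1ℝ
    ; isCommutativeSemiring = isCommutativeSemiringˡ record
      { +-isCommutativeMonoid = record
        { isMonoid = record
          { isSemigroup = record
            { isMagma = record { isEquivalence = ≈-isEquivalence ; ∙-cong = λ {x} {y} {z} {w} → +-cong x y z w }
            ; assoc   = λ x y z → ≈-pointwise (x + y + z) (x + (y + z)) λ n → ℚₚ.+-assoc (seq x n) (seq y n) (seq z n)
            }
          ; identity = (λ x → ≈-pointwise (0ℝ + x) x λ n → ℚₚ.+-identityˡ (seq x n))
                     , (λ x → ≈-pointwise (x + 0ℝ) x λ n → ℚₚ.+-identityʳ (seq x n))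
          }
        ; comm = λ x y → ≈-pointwise (x + y) (y + x) λ n → ℚₚ.+-comm (seq x n) (seq y n)
        }
      ; *-isCommutativeMonoid = record
        { isMonoid = record
          { isSemigroup = record
            { isMagma = record { isEquivalence = ≈-isEquivalence ; ∙-cong = λ {x} {y} {z} {w} → *-cong x y z w }
            ; assoc   = λ x y z → ≈-pointwise (x * y * z) (x * (y * z)) λ n → ℚₚ.*-assoc (seq x n) (seq y n) (seq z n)
            }
          ; identity = (λ x → ≈-pointwise (1ℝ * x) x λ n → ℚₚ.*-identityˡ (seq x n))
                     , (λ x → ≈-pointwise (x * 1ℝ) x λ n → ℚₚ.*-identityʳ (seq x n))
          }
        ; comm = λ x y → ≈-pointwise (x * y) (y * x) λ n → ℚₚ.*-comm (seq x n) (seq y n)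
        }
      ; distribʳ = λ x y z → ≈-pointwise ((y + z) * x) (y * x + z * x) λ n → ℚₚ.*-distribʳ-+ (seq x n) (seq y n) (seq z n)
      ; zeroˡ    = λ x → ≈-pointwise (0ℝ * x) 0ℝ λ n → ℚₚ.*-zeroˡ (seq x n)
      }
    }

  infix 4 _≤_

  -- The slack ε makes the order independent of representatives. A disjunction of `<` and `≈` would
  -- demand a decision that approximations cannot give.
  _≤_ : ℝ → ℝ → Set
  x ≤ y = ∀ ε → 0ℚ ℚ.< ε → Eventually λ n → seq x n ℚ.≤ seq y n ℚ.+ ε

  ≤-pointwise : ∀ x y → (∀ n → seq x n ℚ.≤ seq y n) → x ≤ y
  ≤-pointwise x y h ε 0<ε = always λ n → ℚₚ.≤-trans (h n) (by ε (solve 2 (λ y e → y :+ e :- y := e) refl (seq y n) ε) (ℚₚ.<⇒≤ 0<ε))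

  ≈⇒≤ : ∀ x y → x ≈ y → x ≤ y
  ≈⇒≤ x y x≈y ε 0<ε = map (λ n p → by (ε ℚ.- (seq x n ℚ.- seq y n)) (solve 3 (λ x y e → y :+ e :- x := e :- (x :- y)) refl (seq x n) (seq y n) ε)
    (diff (ℚₚ.≤-trans (p≤∣p∣ _) (ℚₚ.<⇒≤ p)))) (x≈y ε 0<ε)

  ≤-trans : ∀ x y z → x ≤ y → y ≤ z → x ≤ z
  ≤-trans x y z x≤y y≤z ε 0<ε = map₂ (λ n p q → ℚₚ.≤-trans p (ℚₚ.≤-trans (ℚₚ.+-monoˡ-≤ (½ ℚ.* ε) q)
      (ℚₚ.≤-reflexive (trans (ℚₚ.+-assoc (seq z n) (½ ℚ.* ε) (½ ℚ.* ε)) (cong (seq z n ℚ.+_) (half ε))))))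
    (x≤y (½ ℚ.* ε) (half-pos 0<ε)) (y≤z (½ ℚ.* ε) (half-pos 0<ε))

  <⇒≤ : ∀ x y → x < y → x ≤ y
  <⇒≤ x y (δ , 0<δ , h) ε 0<ε = map (λ n p → by ((seq y n ℚ.- (seq x n ℚ.+ δ)) ℚ.+ (δ ℚ.+ ε))
    (solve 4 (λ x y d e → y :+ e :- x := (y :- (x :+ d)) :+ (d :+ e)) refl (seq x n) (seq y n) δ ε)
    (+-nn (diff p) (ℚₚ.<⇒≤ (+-pos 0<δ (ℚₚ.<⇒≤ 0<ε))))) h

  <-≤-trans : ∀ x y z → x < y → y ≤ z → x < z
  <-≤-trans x y z (δ , 0<δ , h) y≤z = ½ ℚ.* δ , half-pos 0<δ , map₂ (λ n p q →
      by ((seq y n ℚ.- (seq x n ℚ.+ δ)) ℚ.+ (seq z n ℚ.+ ½ ℚ.* δ ℚ.- seq y n))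
        (trans (solve 4 (λ x y z d → z :- (x :+ d) := (y :- (x :+ (d :+ d))) :+ (z :+ d :- y)) refl (seq x n) (seq y n) (seq z n) (½ ℚ.* δ))
               (cong (λ d → (seq y n ℚ.- (seq x n ℚ.+ d)) ℚ.+ (seq z n ℚ.+ ½ ℚ.* δ ℚ.- seq y n)) (half δ)))
        (+-nn (diff p) (diff q)))
    h (y≤z (½ ℚ.* δ) (half-pos 0<δ))

  ≤-<-trans : ∀ x y z → x ≤ y → y < z → x < z
  ≤-<-trans x y z x≤y (δ , 0<δ , h) = ½ ℚ.* δ , half-pos 0<δ , map₂ (λ n p q →
      by ((seq y n ℚ.+ ½ ℚ.* δ ℚ.- seq x n) ℚ.+ (seq z n ℚ.- (seq y n ℚ.+ δ)))
        (trans (solve 4 (λ x y z d → z :- (x :+ d) := (y :+ d :- x) :+ (z :- (y :+ (d :+ d)))) refl (seq x n) (seq y n) (seq z n) (½ ℚ.* δ))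
               (cong (λ d → (seq y n ℚ.+ ½ ℚ.* δ ℚ.- seq x n) ℚ.+ (seq z n ℚ.- (seq y n ℚ.+ d))) (half δ)))
        (+-nn (diff p) (diff q)))
    (x≤y (½ ℚ.* δ) (half-pos 0<δ)) h

  <-irrefl : ∀ x → ¬ x < x
  <-irrefl x (δ , 0<δ , N , h) = ℚₚ.<-irrefl refl (ℚₚ.<-≤-trans (by< δ (solve 2 (λ x d → x :+ d :- x := d) refl (seq x N) δ) 0<δ) (h N ℕₚ.≤-refl))

  -- Beyond some N the difference d = y - x varies by less than ε/2, so one rational comparison at N
  -- settles it: if d N ≤ ε/2, then d stays below ε; otherwise d N - ε/2 is a gap witnessing x < y.
  ≮⇒≥ : ∀ x y → ¬ x < y → y ≤ x
  ≮⇒≥ x y x≮y ε 0<ε = helper (cauchy (y + - x) (½ ℚ.* ε) (half-pos 0<ε))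
    where
    d : ℕ → ℚ
    d n = seq y n ℚ.- seq x n
    helper : (∃ λ N → ∀ m n → N ℕ.≤ m → N ℕ.≤ n → ℚ.∣ d m ℚ.- d n ∣ ℚ.< ½ ℚ.* ε) → Eventually λ n → seq y n ℚ.≤ seq x n ℚ.+ ε
    helper (N , close) with d N ℚ.≤? ½ ℚ.* ε
    ... | yes small = N , λ n N≤n → by
          ((½ ℚ.* ε ℚ.- d N) ℚ.+ (½ ℚ.* ε ℚ.- (d n ℚ.- d N)))
          (trans (cong (λ e → seq x n ℚ.+ e ℚ.- seq y n) (sym (half ε)))
            (solve 4 (λ h x y d → x :+ (h :+ h) :- y := (h :- d) :+ (h :- ((y :- x) :- d))) refl (½ ℚ.* ε) (seq x n) (seq y n) (d N)))
          (+-nn (diff small) (diff (ℚₚ.≤-trans (p≤∣p∣ (d n ℚ.- d N)) (ℚₚ.<⇒≤ (close n N N≤n ℕₚ.≤-refl)))))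
    ... | no large = ⊥-elim (x≮y (d N ℚ.- ½ ℚ.* ε , diff< (ℚₚ.≰⇒> large) , N , λ n N≤n → by
          (½ ℚ.* ε ℚ.- (d N ℚ.- d n))
          (solve 4 (λ h x y d → y :- (x :+ (d :- h)) := h :- (d :- (y :- x))) refl (½ ℚ.* ε) (seq x n) (seq y n) (d N))
          (diff (ℚₚ.≤-trans (p≤∣p∣ (d N ℚ.- d n)) (ℚₚ.<⇒≤ (close N n ℕₚ.≤-refl N≤n))))))

  +-mono-≤ : ∀ x y z w → x ≤ y → z ≤ w → x + z ≤ y + w
  +-mono-≤ x y z w x≤y z≤w ε 0<ε = map₂ (λ n p q → ℚₚ.≤-trans (ℚₚ.+-mono-≤ p q) (ℚₚ.≤-reflexive
      (trans (solve 3 (λ y w h → (y :+ h) :+ (w :+ h) := y :+ w :+ (h :+ h)) refl (seq y n) (seq w n) (½ ℚ.* ε)) (cong (seq y n ℚ.+ seq w n ℚ.+_) (half ε)))))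
    (x≤y (½ ℚ.* ε) (half-pos 0<ε)) (z≤w (½ ℚ.* ε) (half-pos 0<ε))

  +-mono-<-≤ : ∀ x y z w → x < y → z ≤ w → x + z < y + w
  +-mono-<-≤ x y z w (δ , 0<δ , h) z≤w = <-≤-trans (x + z) (y + z) (y + w)
    (δ , 0<δ , map (λ n p → by (seq y n ℚ.- (seq x n ℚ.+ δ)) (solve 4 (λ x y z d → y :+ z :- (x :+ z :+ d) := y :- (x :+ d)) refl (seq x n) (seq y n) (seq z n) δ) (diff p)) h)
    (+-mono-≤ y y z w (≈⇒≤ y y (≈-refl y)) z≤w)

  -- Both z and d = y - x are nonnegative only up to δ. Expanding (z + δ)(d + δ) ≥ 0 gives z d ≥ -δ
  -- (z + d + δ), and with |z| ≤ A, |d| ≤ D and δ ≤ 1 the loss is at most δ (A + D + 1). This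
  -- dictates C and δ.
  *-monoˡ-≤ : ∀ x y z → 0ℝ ≤ z → x ≤ y → z * x ≤ z * y
  *-monoˡ-≤ x y z 0≤z x≤y ε 0<ε = helper (bound-of z) (bound-of (y + - x))
    where
    d : ℕ → ℚ
    d n = seq y n ℚ.- seq x n
    helper : (∃ λ A → 1ℚ ℚ.≤ A × Eventually λ n → ℚ.∣ seq z n ∣ ℚ.≤ A) → (∃ λ D → 1ℚ ℚ.≤ D × Eventually λ n → ℚ.∣ d n ∣ ℚ.≤ D) →
             Eventually λ n → seq z n ℚ.* seq x n ℚ.≤ seq z n ℚ.* seq y n ℚ.+ ε
    helper (A , 1≤A , z≤A) (D , 1≤D , d≤D) = map₂ {λ n → Z n × P n} {λ n → Q n × X n} estimate
      (map₂ {Z} {P} (λ _ → _,_) (0≤z δ 0<δ) z≤A) (map₂ {Q} {X} (λ _ → _,_) (x≤y δ 0<δ) d≤D)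
      where
      C = A ℚ.+ D ℚ.+ 1ℚ
      0<C : 0ℚ ℚ.< C
      0<C = +-pos (+-pos (ℚₚ.<-≤-trans 0<1 1≤A) (ℚₚ.≤-trans (ℚₚ.<⇒≤ 0<1) 1≤D)) (ℚₚ.<⇒≤ 0<1)
      δ = (ε ℚ.* inv C) ℚ.⊓ 1ℚ
      0<δ : 0ℚ ℚ.< δ
      0<δ with ℚₚ.⊓-sel (ε ℚ.* inv C) 1ℚ
      ... | inj₁ e = subst (0ℚ ℚ.<_) (sym e) (*-pos 0<ε (inv-pos 0<C))
      ... | inj₂ e = subst (0ℚ ℚ.<_) (sym e) 0<1
      δ≤1 : δ ℚ.≤ 1ℚ
      δ≤1 = ℚₚ.p⊓q≤q (ε ℚ.* inv C) 1ℚ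
      Cδ≤ε : C ℚ.* δ ℚ.≤ ε
      Cδ≤ε = ℚₚ.≤-trans (*-mono-nn (ℚₚ.<⇒≤ 0<C) ℚₚ.≤-refl (ℚₚ.<⇒≤ 0<δ) (ℚₚ.p⊓q≤p (ε ℚ.* inv C) 1ℚ))
        (ℚₚ.≤-reflexive (trans (solve 3 (λ c e i → c :* (e :* i) := e :* (c :* i)) refl C ε (inv C)) (trans (cong (ε ℚ.*_) (inv-* 0<C)) (ℚₚ.*-identityʳ ε))))
      Z P Q X : ℕ → Set
      Z n = 0ℚ ℚ.≤ seq z n ℚ.+ δ
      P n = ℚ.∣ seq z n ∣ ℚ.≤ A
      Q n = seq x n ℚ.≤ seq y n ℚ.+ δ
      X n = ℚ.∣ d n ∣ ℚ.≤ D
      estimate : ∀ n → Z n × P n → Q n × X n → seq z n ℚ.* seq x n ℚ.≤ seq z n ℚ.* seq y n ℚ.+ ε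
      estimate n (p , p′) (q , q′) = by
        ((seq z n ℚ.+ δ) ℚ.* (d n ℚ.+ δ) ℚ.+ (ε ℚ.- C ℚ.* δ) ℚ.+ δ ℚ.* ((A ℚ.- seq z n) ℚ.+ (D ℚ.- d n) ℚ.+ (1ℚ ℚ.- δ)))
        (solve 7 (λ x y z e t A D → z :* y :+ e :- z :* x := (z :+ t) :* ((y :- x) :+ t) :+ (e :- (A :+ D :+ con 1ℚ) :* t) :+ t :* ((A :- z) :+ (D :- (y :- x)) :+ (con 1ℚ :- t)))
           refl (seq x n) (seq y n) (seq z n) ε δ A D)
        (+-nn (+-nn (*-nn p (subst (0ℚ ℚ.≤_) (solve 3 (λ x y t → y :+ t :- x := (y :- x) :+ t) refl (seq x n) (seq y n) δ) (diff q))) (diff Cδ≤ε))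
          (*-nn (ℚₚ.<⇒≤ 0<δ) (+-nn (+-nn (diff (ℚₚ.≤-trans (p≤∣p∣ (seq z n)) p′)) (diff (ℚₚ.≤-trans (p≤∣p∣ (d n)) q′))) (diff δ≤1))))

  *-monoˡ-< : ∀ x y z → 0ℝ < z → x < y → z * x < z * y
  *-monoˡ-< x y z (δ , 0<δ , h) (η , 0<η , k) = δ ℚ.* η , *-pos 0<δ 0<η , map₂ (λ n p q → by
      ((seq z n ℚ.- δ) ℚ.* (seq y n ℚ.- seq x n) ℚ.+ δ ℚ.* (seq y n ℚ.- (seq x n ℚ.+ η)))
      (solve 5 (λ x y z d e → z :* y :- (z :* x :+ d :* e) := (z :- d) :* (y :- x) :+ d :* (y :- (x :+ e))) refl (seq x n) (seq y n) (seq z n) δ η)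
      (+-nn (*-nn (diff (subst (ℚ._≤ seq z n) (ℚₚ.+-identityˡ δ) p)) (subst (0ℚ ℚ.≤_) (solve 3 (λ x y e → (y :- (x :+ e)) :+ e := y :- x) refl (seq x n) (seq y n) η) (+-nn (diff q) (ℚₚ.<⇒≤ 0<η))))
            (*-nn (ℚₚ.<⇒≤ 0<δ) (diff q))))
    h k

  ℝ-orderedSemiring : OrderedCommutativeSemiring
  ℝ-orderedSemiring = record
    { commutativeSemiring  = ℝ-commutativeSemiring
    ; _≤_                  = _≤_
    ; _<_                  = _<_
    ; isPreorder           = record { isEquivalence = ≈-isEquivalence ; reflexive = λ {x} {y} → ≈⇒≤ x y ; trans = λ {x} {y} {z} → ≤-trans x y z }
    ; isStrictPartialOrder = record
      { isEquivalence = ≈-isEquivalence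
      ; irrefl        = λ {x} {y} x≈y x<y → <-irrefl x (<-≤-trans x y x x<y (≈⇒≤ y x (≈-sym x y x≈y)))
      ; trans         = λ {x} {y} {z} x<y y<z → <-≤-trans x y z x<y (<⇒≤ y z y<z)
      ; <-resp-≈      = (λ {x} {y} {z} y≈z x<y → <-≤-trans x y z x<y (≈⇒≤ y z y≈z))
                      , (λ {x} {y} {z} y≈z y<x → ≤-<-trans z y x (≈⇒≤ z y (≈-sym y z y≈z)) y<x)
      }
    ; <⇒≤        = λ {x} {y} → <⇒≤ x y
    ; <-≤-trans  = λ {x} {y} {z} → <-≤-trans x y z
    ; ≤-<-trans  = λ {x} {y} {z} → ≤-<-trans x y z
    ; +-mono-≤   = λ {x} {y} {z} {w} → +-mono-≤ x y z w
    ; +-mono-<-≤ = λ {x} {y} {z} {w} → +-mono-<-≤ x y z w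
    ; *-monoˡ-≤  = λ {x} {y} {z} → *-monoˡ-≤ x y z
    ; *-monoˡ-<  = λ {x} {y} {z} → *-monoˡ-< x y z
    }

  -- Complex numbers as a commutative semiring

  ≈ᶜ-pointwise : ∀ z w → (∀ n → seq (re z) n ≡ seq (re w) n) → (∀ n → seq (im z) n ≡ seq (im w) n) → z ≈ᶜ w
  ≈ᶜ-pointwise z w h k = ≈-pointwise (re z) (re w) h , ≈-pointwise (im z) (im w) k

  -‿cong : ∀ x y → x ≈ y → - x ≈ - y
  -‿cong x y x≈y ε 0<ε = map (λ n → subst (ℚ._< ε) (trans (∣-∣-sym (seq x n) (seq y n))
    (cong ℚ.∣_∣ (solve 2 (λ x y → y :- x := :- x :- :- y) refl (seq x n) (seq y n))))) (x≈y ε 0<ε)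

  *ᶜ-cong : ∀ x y z w → x ≈ᶜ y → z ≈ᶜ w → x *ᶜ z ≈ᶜ y *ᶜ w
  *ᶜ-cong x y z w (p , p′) (q , q′) =
    +-cong (re x * re z) (re y * re w) (- (im x * im z)) (- (im y * im w)) (*-cong (re x) (re y) (re z) (re w) p q)
      (-‿cong (im x * im z) (im y * im w) (*-cong (im x) (im y) (im z) (im w) p′ q′)) ,
    +-cong (re x * im z) (re y * im w) (im x * re z) (im y * re w) (*-cong (re x) (re y) (im z) (im w) p q′) (*-cong (im x) (im y) (re z) (re w) p′ q)

  ≈ᶜ-isEquivalence : IsEquivalence _≈ᶜ_
  ≈ᶜ-isEquivalence = record
    { refl  = λ {z} → ≈-refl (re z) , ≈-refl (im z)
    ; sym   = λ { {z} {w} (p , q) → ≈-sym (re z) (re w) p , ≈-sym (im z) (im w) q }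
    ; trans = λ { {x} {y} {z} (p , q) (p′ , q′) → ≈-trans (re x) (re y) (re z) p p′ , ≈-trans (im x) (im y) (im z) q q′ }
    }

  1ᶜ : ℂ
  1ᶜ = fromℝ 1ℝ

  ℂ-commutativeSemiring : CommutativeSemiring 0ℓ 0ℓ
  ℂ-commutativeSemiring = record
    { Carrier = ℂ ; _≈_ = _≈ᶜ_ ; _+_ = _+ᶜ_ ; _*_ = _*ᶜ_ ; 0# = 0ℂ ; 1# = 1ᶜ
    ; isCommutativeSemiring = isCommutativeSemiringˡ record
      { +-isCommutativeMonoid = record
        { isMonoid = record
          { isSemigroup = record
            { isMagma = record
              { isEquivalence = ≈ᶜ-isEquivalence
              ; ∙-cong = λ { {x} {y} {z} {w} (p , p′) (q , q′) → +-cong (re x) (re y) (re z) (re w) p q , +-cong (im x) (im y) (im z) (im w) p′ q′ }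
              }
            ; assoc   = λ x y z → ≈ᶜ-pointwise ((x +ᶜ y) +ᶜ z) (x +ᶜ (y +ᶜ z))
                (λ n → ℚₚ.+-assoc (seq (re x) n) (seq (re y) n) (seq (re z) n)) (λ n → ℚₚ.+-assoc (seq (im x) n) (seq (im y) n) (seq (im z) n))
            }
          ; identity = (λ x → ≈ᶜ-pointwise (0ℂ +ᶜ x) x (λ n → ℚₚ.+-identityˡ (seq (re x) n)) (λ n → ℚₚ.+-identityˡ (seq (im x) n)))
                     , (λ x → ≈ᶜ-pointwise (x +ᶜ 0ℂ) x (λ n → ℚₚ.+-identityʳ (seq (re x) n)) (λ n → ℚₚ.+-identityʳ (seq (im x) n)))
          }
        ; comm = λ x y → ≈ᶜ-pointwise (x +ᶜ y) (y +ᶜ x) (λ n → ℚₚ.+-comm (seq (re x) n) (seq (re y) n)) (λ n → ℚₚ.+-comm (seq (im x) n) (seq (im y) n))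
        }
      ; *-isCommutativeMonoid = record
        { isMonoid = record
          { isSemigroup = record
            { isMagma = record { isEquivalence = ≈ᶜ-isEquivalence ; ∙-cong = λ {x} {y} {z} {w} → *ᶜ-cong x y z w }
            ; assoc   = λ x y z → ≈ᶜ-pointwise ((x *ᶜ y) *ᶜ z) (x *ᶜ (y *ᶜ z))
                (λ n → solve 6 (λ a b c d e f → (a :* c :+ :- (b :* d)) :* e :+ :- ((a :* d :+ b :* c) :* f) := a :* (c :* e :+ :- (d :* f)) :+ :- (b :* (c :* f :+ d :* e)))
                  refl (seq (re x) n) (seq (im x) n) (seq (re y) n) (seq (im y) n) (seq (re z) n) (seq (im z) n))
                (λ n → solve 6 (λ a b c d e f → (a :* c :+ :- (b :* d)) :* f :+ (a :* d :+ b :* c) :* e := a :* (c :* f :+ d :* e) :+ b :* (c :* e :+ :- (d :* f)))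
                  refl (seq (re x) n) (seq (im x) n) (seq (re y) n) (seq (im y) n) (seq (re z) n) (seq (im z) n))
            }
          ; identity = (λ x → ≈ᶜ-pointwise (1ᶜ *ᶜ x) x
                         (λ n → solve 2 (λ a b → con 1ℚ :* a :+ :- (con 0ℚ :* b) := a) refl (seq (re x) n) (seq (im x) n))
                         (λ n → solve 2 (λ a b → con 1ℚ :* b :+ con 0ℚ :* a := b) refl (seq (re x) n) (seq (im x) n)))
                     , (λ x → ≈ᶜ-pointwise (x *ᶜ 1ᶜ) x
                         (λ n → solve 2 (λ a b → a :* con 1ℚ :+ :- (b :* con 0ℚ) := a) refl (seq (re x) n) (seq (im x) n))
                         (λ n → solve 2 (λ a b → a :* con 0ℚ :+ b :* con 1ℚ := b) refl (seq (re x) n) (seq (im x) n)))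
          }
        ; comm = λ x y → ≈ᶜ-pointwise (x *ᶜ y) (y *ᶜ x)
            (λ n → solve 4 (λ a b c d → a :* c :+ :- (b :* d) := c :* a :+ :- (d :* b)) refl (seq (re x) n) (seq (im x) n) (seq (re y) n) (seq (im y) n))
            (λ n → solve 4 (λ a b c d → a :* d :+ b :* c := c :* b :+ d :* a) refl (seq (re x) n) (seq (im x) n) (seq (re y) n) (seq (im y) n))
        }
      ; distribʳ = λ x y z → ≈ᶜ-pointwise ((y +ᶜ z) *ᶜ x) ((y *ᶜ x) +ᶜ (z *ᶜ x))
          (λ n → solve 6 (λ a b c d e f → (c :+ e) :* a :+ :- ((d :+ f) :* b) := c :* a :+ :- (d :* b) :+ (e :* a :+ :- (f :* b)))
            refl (seq (re x) n) (seq (im x) n) (seq (re y) n) (seq (im y) n) (seq (re z) n) (seq (im z) n))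
          (λ n → solve 6 (λ a b c d e f → (c :+ e) :* b :+ (d :+ f) :* a := c :* b :+ d :* a :+ (e :* b :+ f :* a))
            refl (seq (re x) n) (seq (im x) n) (seq (re y) n) (seq (im y) n) (seq (re z) n) (seq (im z) n))
      ; zeroˡ    = λ x → ≈ᶜ-pointwise (0ℂ *ᶜ x) 0ℂ
          (λ n → solve 2 (λ a b → con 0ℚ :* a :+ :- (con 0ℚ :* b) := con 0ℚ) refl (seq (re x) n) (seq (im x) n))
          (λ n → solve 2 (λ a b → con 0ℚ :* b :+ con 0ℚ :* a := con 0ℚ) refl (seq (re x) n) (seq (im x) n))
      }
    }

-- Minima, maxima, roots, reciprocals and integer multiples

module RealFunctions where
  open RealNumbers
  open Defs.RationalSequences hiding (IsCauchy; _^_)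
  open +-*-Solver
  open ≡ using (cong; cong₂; sym; trans; subst; subst₂; refl)
  module R = OrderedSemiringProperties ℝ-orderedSemiring

  0<1ℝ : 0ℝ < 1ℝ
  0<1ℝ = 1ℚ , 0<1 , always λ _ → ℚₚ.≤-refl

  ⊓-glb : ∀ x y z → z ≤ x → z ≤ y → z ≤ x ⊓ y
  ⊓-glb x y z z≤x z≤y ε 0<ε = map₂ meet (z≤x ε 0<ε) (z≤y ε 0<ε)
    where
    meet : ∀ n → seq z n ℚ.≤ seq x n ℚ.+ ε → seq z n ℚ.≤ seq y n ℚ.+ ε → seq z n ℚ.≤ (seq x n ℚ.⊓ seq y n) ℚ.+ ε
    meet n p q with ℚₚ.⊓-sel (seq x n) (seq y n)
    ... | inj₁ e = subst (λ m → seq z n ℚ.≤ m ℚ.+ ε) (sym e) p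
    ... | inj₂ e = subst (λ m → seq z n ℚ.≤ m ℚ.+ ε) (sym e) q

  ≤-refl : ∀ x → x ≤ x
  ≤-refl x = ≈⇒≤ x x (≈-refl x)

  -- `⊓` acts on approximations, which may keep switching between the arguments, so no index can be
  -- extracted outright.
  foldr-⊓-attained : ∀ {n} e (x : Vector ℝ n) → ¬ ¬ (e ≤ foldr _⊓_ e x ⊎ ∃ λ i → x i ≤ foldr _⊓_ e x)
  foldr-⊓-attained {zero}  e x ¬h = ¬h (inj₁ (≤-refl e))
  foldr-⊓-attained {suc n} e x ¬h = foldr-⊓-attained e (tail x) λ where
      (inj₁ e≤F)       → head-smallest λ F≤x₀ → ¬h (inj₁ (≤-trans e F (head x ⊓ F) e≤F (F≤min F≤x₀)))
      (inj₂ (i , p)) → head-smallest λ F≤x₀ → ¬h (inj₂ (suc i , ≤-trans (x (suc i)) F (head x ⊓ F) p (F≤min F≤x₀)))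
    where
    F = foldr _⊓_ e (tail x)
    F≤min : F ≤ head x → F ≤ head x ⊓ F
    F≤min F≤x₀ = ⊓-glb (head x) F F F≤x₀ (≤-refl F)
    -- If F ≤ x₀ fails, then so does F < x₀; hence x₀ ≤ F and the head itself attains the minimum,
    -- against `¬h`.
    head-smallest : ¬ ¬ F ≤ head x
    head-smallest F≰x₀ = ¬h (inj₂ (zero , ⊓-glb (head x) F (head x) (≤-refl (head x))
      (≮⇒≥ F (head x) λ F<x₀ → F≰x₀ (<⇒≤ F (head x) F<x₀))))

  minimum-attained : ∀ {n} .{{_ : NonZero n}} (x : Vector ℝ n) → ¬ ¬ ∃ λ i → x i ≤ minimum x
  minimum-attained {suc n} x ¬h = foldr-⊓-attained (head x) (tail x) λ where
    (inj₁ p)       → ¬h (zero , p)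
    (inj₂ (i , p)) → ¬h (suc i , p)

  ≤-foldr-⊔ : ∀ {n} e (x : Vector ℝ n) → e ≤ foldr _⊔_ e x × ∀ i → x i ≤ foldr _⊔_ e x
  ≤-foldr-⊔ {zero}  e x = ≤-refl e , λ ()
  ≤-foldr-⊔ {suc n} e x = ≤-trans e F (head x ⊔ F) (proj₁ ih) F≤ , λ where
      zero    → ≤-pointwise (head x) (head x ⊔ F) λ n → ℚₚ.p≤p⊔q (seq (head x) n) (seq F n)
      (suc i) → ≤-trans (x (suc i)) F (head x ⊔ F) (proj₂ ih i) F≤
    where
    F = foldr _⊔_ e (tail x)
    ih = ≤-foldr-⊔ e (tail x)
    F≤ : F ≤ head x ⊔ F
    F≤ = ≤-pointwise F (head x ⊔ F) λ n → ℚₚ.p≤q⊔p (seq (head x) n) (seq F n)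

  ≤-maximum : ∀ {n} (x : Vector ℝ n) i → x i ≤ maximum x
  ≤-maximum {suc n} x zero    = proj₁ (≤-foldr-⊔ (head x) (tail x))
  ≤-maximum {suc n} x (suc i) = proj₂ (≤-foldr-⊔ (head x) (tail x)) i

  maximum-nonNeg : ∀ {n} (x : Vector ℝ n) → (∀ i → 0ℝ ≤ x i) → 0ℝ ≤ maximum x
  maximum-nonNeg {zero}  x 0≤x = ≤-refl 0ℝ
  maximum-nonNeg {suc n} x 0≤x = ≤-trans 0ℝ (x zero) (maximum x) (0≤x zero) (≤-maximum x zero)

  root-nonNeg : ∀ m .{{_ : NonZero m}} x → 0ℝ ≤ root m x
  root-nonNeg m x = ≤-pointwise 0ℝ (root m x) λ n → approxRoot-nn m (seq x n) n

  seq-^ : ∀ x m n → seq (x R.^ m) n ≡ Defs.RationalSequences._^_ (seq x n) m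
  seq-^ x zero    n = refl
  seq-^ x (suc m) n = cong (seq x n ℚ.*_) (seq-^ x m n)

  -- A representative of zero whose n-th term is the mesh of the grid searched by `approxRoot` at
  -- index n.
  gap : ℝ
  gap = real (λ n → recip (suc n)) (cauchy-one-sided (λ n → recip (suc n)) λ ε 0<ε →
    let (N , small) = recip-small (half-pos 0<ε) in
    N , λ m n N≤m _ → ℚₚ.≤-<-trans
      (by (recip (suc n)) (solve 2 (λ a b → a :- (a :- b) := b) refl (recip (suc m)) (recip (suc n))) (ℚₚ.<⇒≤ (recip-pos (suc n))))
      (ℚₚ.≤-<-trans (small m N≤m) (by< (½ ℚ.* ε) (trans (cong (ℚ._- ½ ℚ.* ε) (sym (half ε))) (solve 1 (λ h → h :+ h :- h := h) refl (½ ℚ.* ε))) (half-pos 0<ε))))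

  gap≈0 : gap ≈ 0ℝ
  gap≈0 = ≈-scaled gap 0ℝ 1ℚ 0<1 λ ε 0<ε → let (N , small) = recip-small 0<ε in
    N , λ n N≤n → subst₂ ℚ._≤_ (sym (trans (cong ℚ.∣_∣ (ℚₚ.+-identityʳ (recip (suc n)))) (ℚₚ.0≤p⇒∣p∣≡p (ℚₚ.<⇒≤ (recip-pos (suc n))))))
      (sym (ℚₚ.*-identityˡ ε)) (small n N≤n)

  -- The approximate root is the largest admissible grid point, so one mesh further the power
  -- exceeds x. Thus the bound holds termwise for `y + gap`, and `gap` is then replaced by 0.
  ≤-root-^ : ∀ m .{{_ : NonZero m}} x → x ≤ root m x R.^ m
  ≤-root-^ m@(suc m′) x = ≤-trans x ((y + gap) R.^ m) (y R.^ m)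
    (≤-pointwise x ((y + gap) R.^ m) λ n → subst (seq x n ℚ.≤_) (sym (seq-^ (y + gap) m n)) (ℚₚ.<⇒≤ (approxRoot-> m′ (seq x n) n)))
    (≈⇒≤ ((y + gap) R.^ m) (y R.^ m) (R.^-congˡ m {y + gap} {y}
      (≈-trans (y + gap) (y + 0ℝ) y (+-cong y y gap 0ℝ (≈-refl y) gap≈0) (≈-pointwise (y + 0ℝ) y λ n → ℚₚ.+-identityʳ (seq y n)))))
    where
    y = root m x

  cancel-* : ∀ i q r → i ℚ.* r ≡ 1ℚ → i ℚ.* (q ℚ.* r) ≡ q
  cancel-* i q r e = trans (solve 3 (λ i q r → i :* (q :* r) := q :* (i :* r)) refl i q r) (trans (cong (q ℚ.*_) e) (ℚₚ.*-identityʳ q))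

  reciprocal-cancel : ∀ y (0<y : 0ℝ < y) x → y * (x * reciprocal y 0<y) ≈ x
  reciprocal-cancel y 0<y@(δ , 0<δ , h) x ε 0<ε = map (λ n p →
      let 0<yₙ = ℚₚ.<-≤-trans 0<δ (subst (ℚ._≤ seq y n) (ℚₚ.+-identityˡ δ) p)
          e = cancel-* (seq y n) (seq x n) (inv (seq y n)) (inv-* 0<yₙ)
      in subst (λ z → ℚ.∣ z ∣ ℚ.< ε) (sym (trans (cong (ℚ._- seq x n) e) (ℚₚ.+-inverseʳ (seq x n)))) 0<ε) h

  seq-sum-neg : ∀ {n} (x : Vector ℝ n) k → seq (R.sum (λ i → - x i)) k ≡ ℚ.- seq (R.sum x) k
  seq-sum-neg {zero}  x k = refl
  seq-sum-neg {suc n} x k = trans (cong (ℚ.- seq (head x) k ℚ.+_) (seq-sum-neg (tail x) k))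
    (sym (ℚₚ.neg-distrib-+ (seq (head x) k) (seq (R.sum (tail x)) k)))

  -- Links the total weight B of the averaging to the |∑ a_j| in the definition of v.
  sum-neg-≤ : ∀ {n} (x : Vector ℝ n) → R.sum (λ i → - x i) ≤ ∣ R.sum x ∣
  sum-neg-≤ x = ≤-pointwise (R.sum (λ i → - x i)) ∣ R.sum x ∣ λ k → ℚₚ.≤-trans (ℚₚ.≤-reflexive (seq-sum-neg x k))
    (subst (ℚ.- seq (R.sum x) k ℚ.≤_) (ℚₚ.∣-p∣≡∣p∣ (seq (R.sum x) k)) (p≤∣p∣ (ℚ.- seq (R.sum x) k)))

  neg-pos : ∀ x → x < 0ℝ → 0ℝ < - x
  neg-pos x (δ , 0<δ , h) = δ , 0<δ , map (λ n p → by (0ℚ ℚ.- (seq x n ℚ.+ δ))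
    (solve 2 (λ x d → :- x :- (con 0ℚ :+ d) := con 0ℚ :- (x :+ d)) refl (seq x n) δ) (diff p)) h

  ≈0 : ∀ x → x ≤ 0ℝ → - x ≤ 0ℝ → x ≈ 0ℝ
  ≈0 x x≤0 -x≤0 = ≈-scaled x 0ℝ 1ℚ 0<1 λ ε 0<ε → map₂ (λ n p q → subst₂ (λ d e → ℚ.∣ d ∣ ℚ.≤ e) (sym (ℚₚ.+-identityʳ (seq x n)))
    (trans (ℚₚ.+-identityˡ ε) (sym (ℚₚ.*-identityˡ ε))) (∣∣≤ p q)) (x≤0 ε 0<ε) (-x≤0 ε 0<ε)

  infixr 8 _×ᵣ_

  -- Unlike for the library's _×_, here suc m ×ᵣ x unfolds literally to x + m ×ᵣ x.
  _×ᵣ_ : ℕ → ℝ → ℝ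
  zero  ×ᵣ x = 0ℝ
  suc m ×ᵣ x = x + m ×ᵣ x

  ×-nonNeg : ∀ x → 0ℝ ≤ x → ∀ m → 0ℝ ≤ m ×ᵣ x
  ×-nonNeg x 0≤x zero    = ≤-refl 0ℝ
  ×-nonNeg x 0≤x (suc m) = R.+-nonNeg {x} {m ×ᵣ x} 0≤x (×-nonNeg x 0≤x m)

  ×-pos : ∀ x → 0ℝ < x → ∀ m → 0ℝ < suc m ×ᵣ x
  ×-pos x 0<x m = ≤-<-trans 0ℝ (0ℝ + 0ℝ) (suc m ×ᵣ x) (≤-refl 0ℝ) (+-mono-<-≤ 0ℝ x 0ℝ (m ×ᵣ x) 0<x (×-nonNeg x (<⇒≤ 0ℝ x 0<x) m))

  ×-mono-≤ : ∀ x y → 0ℝ ≤ y → x ≤ y → ∀ {m n} → m ℕ.≤ n → m ×ᵣ x ≤ n ×ᵣ y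
  ×-mono-≤ x y 0≤y x≤y {n = n} ℕ.z≤n = ×-nonNeg y 0≤y n
  ×-mono-≤ x y 0≤y x≤y (ℕ.s≤s {m} {n} m≤n) = +-mono-≤ x y (m ×ᵣ x) (n ×ᵣ y) x≤y (×-mono-≤ x y 0≤y x≤y m≤n)

  ×-mono-< : ∀ x y → 0ℝ ≤ y → x < y → ∀ {m n} → m ℕ.< n → suc m ×ᵣ x < n ×ᵣ y
  ×-mono-< x y 0≤y x<y (ℕ.s≤s {m} {n} m≤n) = +-mono-<-≤ x y (m ×ᵣ x) (n ×ᵣ y) x<y (×-mono-≤ x y 0≤y (<⇒≤ x y x<y) m≤n)

  seq-× : ∀ m x n → seq (m ×ᵣ x) n ≡ ι m ℚ.* seq x n
  seq-× zero    x n = sym (ℚₚ.*-zeroˡ (seq x n))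
  seq-× (suc m) x n = trans (cong (seq x n ℚ.+_) (seq-× m x n))
    (trans (solve 2 (λ i x → x :+ i :* x := (con 1ℚ :+ i) :* x) refl (ι m) (seq x n)) (cong (ℚ._* seq x n) (sym (ι-suc m))))

  seq-scale : ∀ i r x k → i ℚ.* r ≡ 1ℚ → i ℚ.* seq (x * fromℚ r) k ≡ seq x k
  seq-scale i r x k = cancel-* i (seq x k) r

  ×-scale : ∀ n r x → ι n ℚ.* r ≡ 1ℚ → n ×ᵣ (x * fromℚ r) ≈ x
  ×-scale n r x e = ≈-pointwise (n ×ᵣ (x * fromℚ r)) x λ k → trans (seq-× n (x * fromℚ r) k) (seq-scale (ι n) r x k e)

  -- The instances are explicit because unifying unsolved ones would normalise recip n.
  ×-/ℕ : ∀ n .{{_ : NonZero n}} x → n ×ᵣ (x /ℕ n) ≈ x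
  ×-/ℕ n {{n≢0}} x = subst (λ y → n ×ᵣ y ≈ x) (unfold n {{n≢0}}) (×-scale n (recip n {{n≢0}}) x (ι-*-recip n {{n≢0}}))
    where
    unfold : ∀ n .{{_ : NonZero n}} → x * fromℚ (recip n) ≡ x /ℕ n
    unfold n = refl
    ι-*-recip : ∀ n .{{_ : NonZero n}} → ι n ℚ.* recip n ≡ 1ℚ
    ι-*-recip (suc n) = ι-recip n

  seq-×-neg : ∀ m x n → seq (m ×ᵣ (- x)) n ≡ ℚ.- seq (m ×ᵣ x) n
  seq-×-neg m x n = trans (seq-× m (- x) n) (trans (sym (ℚₚ.neg-distribʳ-* (ι m) (seq x n))) (cong ℚ.-_ (sym (seq-× m x n))))

  ≤-∣∣ : ∀ x → x ≤ ∣ x ∣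
  ≤-∣∣ x = ≤-pointwise x ∣ x ∣ λ k → p≤∣p∣ (seq x k)

  neg-≤-∣∣ : ∀ x → - x ≤ ∣ x ∣
  neg-≤-∣∣ x = ≤-pointwise (- x) ∣ x ∣ λ k → subst (ℚ.- seq x k ℚ.≤_) (ℚₚ.∣-p∣≡∣p∣ (seq x k)) (p≤∣p∣ (ℚ.- seq x k))

  -- Cosine and sine: addition theorems, oddness, behaviour at zero

  open ExponentialSeries

  -- What `addition-≤` needs at a common index: one bound for both arguments, the index from which
  -- (4B)^k / k! at least halves, and smallness of its n-th term.
  UniformBound : ℝ → ℝ → Set
  UniformBound x y = ∃ λ B → ∃ λ (1≤B : 1ℚ ℚ.≤ B) → ∀ ε → 0ℚ ℚ.< ε →
    Eventually λ n → (ℚ.∣ seq x n ∣ ℚ.≤ B × ℚ.∣ seq y n ∣ ℚ.≤ B) × (K (1≤4B 1≤B) ℕ.≤ n × u (1≤4B 1≤B) n ℚ.≤ ε)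

  uniform-bound : ∀ x y → UniformBound x y
  uniform-bound x y = helper (bound-of x) (bound-of y)
    where
    helper : (∃ λ A → 1ℚ ℚ.≤ A × Eventually λ n → ℚ.∣ seq x n ∣ ℚ.≤ A) → (∃ λ B → 1ℚ ℚ.≤ B × Eventually λ n → ℚ.∣ seq y n ∣ ℚ.≤ B) → UniformBound x y
    helper (A , 1≤A , x≤A) (B , 1≤B , y≤B) = A ℚ.+ B , 1≤A+B , λ ε 0<ε →
      map₂ {P} {Q ε} (λ _ → _,_)
        (map₂ {λ n → ℚ.∣ seq x n ∣ ℚ.≤ A} {λ n → ℚ.∣ seq y n ∣ ℚ.≤ B} {P} (λ n p q → ℚₚ.≤-trans p A≤A+B , ℚₚ.≤-trans q B≤A+B) x≤A y≤B)
        (map₂ {λ n → K (1≤4B 1≤A+B) ℕ.≤ n} {λ n → u (1≤4B 1≤A+B) n ℚ.≤ ε} {Q ε} (λ _ → _,_) (K (1≤4B 1≤A+B) , λ n K≤n → K≤n) (u-small (1≤4B 1≤A+B) 0<ε))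
      where
      A≤A+B = by B (solve 2 (λ a b → a :+ b :- a := b) refl A B) (ℚₚ.≤-trans (ℚₚ.<⇒≤ 0<1) 1≤B)
      B≤A+B = by A (solve 2 (λ a b → a :+ b :- b := a) refl A B) (ℚₚ.≤-trans (ℚₚ.<⇒≤ 0<1) 1≤A)
      1≤A+B : 1ℚ ℚ.≤ A ℚ.+ B
      1≤A+B = ℚₚ.≤-trans 1≤A A≤A+B
      P : ℕ → Set
      P n = ℚ.∣ seq x n ∣ ℚ.≤ A ℚ.+ B × ℚ.∣ seq y n ∣ ℚ.≤ A ℚ.+ B
      Q : ℚ → ℕ → Set
      Q ε n = K (1≤4B 1≤A+B) ℕ.≤ n × u (1≤4B 1≤A+B) n ℚ.≤ ε

  cos-+ : ∀ x y → cos (x + y) ≈ cos x * cos y + - (sin x * sin y)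
  cos-+ x y = helper (uniform-bound x y)
    where
    helper : UniformBound x y → cos (x + y) ≈ cos x * cos y + - (sin x * sin y)
    helper (B , 1≤B , h) = ≈-scaled (cos (x + y)) (cos x * cos y + - (sin x * sin y)) (ι 4) (ι-pos 3) λ ε 0<ε →
      map (λ { n ((x≤B , y≤B) , (K≤n , u≤ε)) →
        subst (λ q → ℚ.∣ seq (cos (x + y)) n ℚ.- (seq (cos x) n ℚ.* seq (cos y) n ℚ.+ q) ∣ ℚ.≤ ι 4 ℚ.* ε)
          (-1* (seq (sin x) n ℚ.* seq (sin y) n))
          (addition-≤ 1≤B (ℚ.- 1ℚ) refl {re-i} {re-i} {im-i} {im-i} {re-i} ∣re-i∣≤1 ∣re-i∣≤1 ∣im-i∣≤1 ∣im-i∣≤1 re-i-+ (seq x n) (seq y n) x≤B y≤B n K≤n {ε} u≤ε) })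
      (h ε 0<ε)
      where
      -1* : ∀ q → (ℚ.- 1ℚ) ℚ.* q ≡ ℚ.- q
      -1* q = solve 1 (λ q → con (ℚ.- 1ℚ) :* q := :- q) refl q

  sin-+ : ∀ x y → sin (x + y) ≈ cos x * sin y + sin x * cos y
  sin-+ x y = helper (uniform-bound x y)
    where
    helper : UniformBound x y → sin (x + y) ≈ cos x * sin y + sin x * cos y
    helper (B , 1≤B , h) = ≈-scaled (sin (x + y)) (cos x * sin y + sin x * cos y) (ι 4) (ι-pos 3) λ ε 0<ε →
      map (λ { n ((x≤B , y≤B) , (K≤n , u≤ε)) →
        subst (λ q → ℚ.∣ seq (sin (x + y)) n ℚ.- (seq (cos x) n ℚ.* seq (sin y) n ℚ.+ q) ∣ ℚ.≤ ι 4 ℚ.* ε)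
          (ℚₚ.*-identityˡ (seq (sin x) n ℚ.* seq (cos y) n))
          (addition-≤ 1≤B 1ℚ refl {re-i} {im-i} {im-i} {re-i} {im-i} ∣re-i∣≤1 ∣im-i∣≤1 ∣im-i∣≤1 ∣re-i∣≤1 im-i-+ (seq x n) (seq y n) x≤B y≤B n K≤n {ε} u≤ε) })
      (h ε 0<ε)

  exp-i-+ : ∀ x y → exp-i (x + y) ≈ᶜ exp-i x *ᶜ exp-i y
  exp-i-+ x y = cos-+ x y , sin-+ x y

  -- Asking for termwise negation lets this apply directly to a multiple of -φ, without invoking
  -- continuity of the sine.
  sin-neg : ∀ x y → (∀ n → seq y n ≡ ℚ.- seq x n) → sin y ≈ - sin x
  sin-neg x y h = ≈-pointwise (sin y) (- sin x) λ n → trans (cong (λ q → ∑ (term im-i q) n) (h n)) (∑-im-i-neg (seq x n) n)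

  private
    1≤2 : 1ℚ ℚ.≤ 1ℚ ℚ.+ 1ℚ
    1≤2 = by 1ℚ refl (ℚₚ.<⇒≤ 0<1)

    -- From index `K` on, `M` bounds the partial sums of ∑ 2^k / k!, which are Lipschitz constants
    -- of the truncated series on [-1, 1]. Adding 1 ensures positivity.
    C₀ : ℚ
    C₀ = 1ℚ ℚ.+ M 1≤2

    0<C₀ : 0ℚ ℚ.< C₀
    0<C₀ = +-pos 0<1 (M-nn 1≤2)

  series-near-0 : ∀ c → (∀ k → ℚ.∣ c k ∣ ℚ.≤ 1ℚ) → ∀ x → x ≈ 0ℝ → ∀ ε → 0ℚ ℚ.< ε →
                  Eventually λ n → ℚ.∣ ∑ (term c (seq x n)) n ℚ.- c 0 ∣ ℚ.≤ C₀ ℚ.* ε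
  -- The index must be positive, hence `suc`: the empty partial sum lacks the constant term c 0.
  series-near-0 c c≤1 x x≈0 ε 0<ε = map₂ est (map₂ (λ _ → _,_) (x≈0 1ℚ 0<1) (x≈0 ε 0<ε)) (suc (K 1≤2) , λ n h → h)
    where
    open ℚₚ.≤-Reasoning
    est : ∀ n → ℚ.∣ seq x n ℚ.- 0ℚ ∣ ℚ.< 1ℚ × ℚ.∣ seq x n ℚ.- 0ℚ ∣ ℚ.< ε → suc (K 1≤2) ℕ.≤ n → ℚ.∣ ∑ (term c (seq x n)) n ℚ.- c 0 ∣ ℚ.≤ C₀ ℚ.* ε
    est n@(suc n′) (x<1 , x<ε) K<n = begin
      ℚ.∣ ∑ (term c (seq x n)) n ℚ.- c 0 ∣                   ≡⟨ cong (λ q → ℚ.∣ ∑ (term c (seq x n)) n ℚ.- q ∣) (∑-term-0 c n′) ⟨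
      ℚ.∣ ∑ (term c (seq x n)) n ℚ.- ∑ (term c 0ℚ) n ∣       ≤⟨ sum-diff 1≤2 ℚₚ.≤-refl refl c c≤1 (seq x n) 0ℚ
                                                                  (subst (λ q → ℚ.∣ q ∣ ℚ.≤ 1ℚ) (ℚₚ.+-identityʳ (seq x n)) (ℚₚ.<⇒≤ x<1)) (ℚₚ.<⇒≤ 0<1) n ⟩
      ∑ (u 1≤2) n ℚ.* ℚ.∣ seq x n ℚ.- 0ℚ ∣                   ≤⟨ *-mono-nn (∑u-nn 1≤2 n) (∑u≤M 1≤2 n (ℕₚ.<⇒≤ K<n)) (ℚₚ.0≤∣p∣ (seq x n ℚ.- 0ℚ)) (ℚₚ.<⇒≤ x<ε) ⟩
      M 1≤2 ℚ.* ε                                            ≤⟨ by ε (solve 2 (λ m e → (con 1ℚ :+ m) :* e :- m :* e := e) refl (M 1≤2) ε) (ℚₚ.<⇒≤ 0<ε) ⟩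
      C₀ ℚ.* ε                                               ∎

  exp-i-≈0 : ∀ x → x ≈ 0ℝ → exp-i x ≈ᶜ 1ᶜ
  exp-i-≈0 x x≈0 = ≈-scaled (cos x) 1ℝ C₀ 0<C₀ (series-near-0 re-i ∣re-i∣≤1 x x≈0)
                 , ≈-scaled (sin x) 0ℝ C₀ 0<C₀ (series-near-0 im-i ∣im-i∣≤1 x x≈0)

-- The zero-free sector

open RealNumbers
open RealFunctions
module P = ComplexPolynomials ℝ-orderedSemiring ℂ-commutativeSemiring fromℝ
open P using (IsLinearFunctional; _^ᶜ_; evaluateᶜ)
open +-*-Solver
private module C = CommutativeSemiring ℂ-commutativeSemiring

evaluate≡evaluateᶜ : ∀ {n} (a : Vector ℝ (suc n)) z → evaluate a z ≡ evaluateᶜ a z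
evaluate≡evaluateᶜ = P.evaluateᶜ-unique (λ n → ℂ-Sum.sum {n}) _*ᶜ_ ℂ-Sum._^_ ≡.refl ≡.refl ≡.refl

fromℝ-* : ∀ x y → fromℝ (x * y) ≈ᶜ fromℝ x *ᶜ fromℝ y
fromℝ-* x y = ≈ᶜ-pointwise (fromℝ (x * y)) (fromℝ x *ᶜ fromℝ y)
  (λ n → solve 2 (λ x y → x :* y := x :* y :+ :- (con 0ℚ :* con 0ℚ)) ≡.refl (seq x n) (seq y n))
  (λ n → solve 2 (λ x y → con 0ℚ := x :* con 0ℚ :+ con 0ℚ :* y) ≡.refl (seq x n) (seq y n))

re-linear : IsLinearFunctional re
re-linear = record
  { cong    = λ {z} {w} → proj₁
  ; 0#-homo = ≈-refl 0ℝ
  ; +-homo  = λ z w → ≈-refl (re z + re w)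
  ; *-homo  = λ x z → ≈-pointwise (re (fromℝ x *ᶜ z)) (x * re z) λ n →
      solve 3 (λ x a b → x :* a :+ :- (con 0ℚ :* b) := x :* a) ≡.refl (seq x n) (seq (re z) n) (seq (im z) n)
  }

im-linear : IsLinearFunctional im
im-linear = record
  { cong    = λ {z} {w} → proj₂
  ; 0#-homo = ≈-refl 0ℝ
  ; +-homo  = λ z w → ≈-refl (im z + im w)
  ; *-homo  = λ x z → ≈-pointwise (im (fromℝ x *ᶜ z)) (x * im z) λ n →
      solve 3 (λ x a b → x :* b :+ con 0ℚ :* a := x :* b) ≡.refl (seq x n) (seq (re z) n) (seq (im z) n)
  }

-im : ℂ → ℝ
-im z = - im z

-im-linear : IsLinearFunctional -im
-im-linear = record
  { cong    = λ { {z} {w} (_ , q) → -‿cong (im z) (im w) q }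
  ; 0#-homo = ≈-refl 0ℝ
  ; +-homo  = λ z w → ≈-pointwise (- (im z + im w)) (- im z + - im w) λ n → ℚₚ.neg-distrib-+ (seq (im z) n) (seq (im w) n)
  ; *-homo  = λ x z → ≈-pointwise (- im (fromℝ x *ᶜ z)) (x * - im z) λ n →
      solve 3 (λ x a b → :- (x :* b :+ con 0ℚ :* a) := x :* (:- b)) ≡.refl (seq x n) (seq (re z) n) (seq (im z) n)
  }

-- At an index r attaining the minimum, v dominates every root of A / c r; raising to the power d
-- and multiplying by c r gives the bound. The same r gives 0 ≤ v, since roots are nonnegative and
-- the empty maximum is 0.
root-bound : ∀ {t ℓ} .{{_ : NonZero t}} (d : Fin t → Fin ℓ → ℕ) .(d≢0 : ∀ r i → NonZero (d r i)) (A : ℝ) (c : Fin t → ℝ) (0<c : ∀ r → 0ℝ < c r) →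
             ∀ v → (minimum λ r → maximum λ i → root (d r i) {{d≢0 r i}} (A * reciprocal (c r) (0<c r))) ≡ v →
             ¬ ¬ ∃ λ r → 0ℝ ≤ v × ∀ i → A ≤ c r * (v R.^ d r i)
root-bound {t} {ℓ} d d≢0 A c 0<c v ≡.refl ¬h = minimum-attained V λ (r , Vr≤v) → ¬h (r ,
    ≤-trans 0ℝ (V r) v (maximum-nonNeg (roots r) λ i → root-nonNeg (d r i) {{d≢0 r i}} (x r)) Vr≤v ,
    λ i → ≤-trans A (c r * x r) (c r * (v R.^ d r i)) (≈⇒≤ A (c r * x r) (≈-sym (c r * x r) A (reciprocal-cancel (c r) (0<c r) A)))
      (*-monoˡ-≤ (x r) (v R.^ d r i) (c r) (<⇒≤ 0ℝ (c r) (0<c r))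
      (≤-trans (x r) (roots r i R.^ d r i) (v R.^ d r i) (≤-root-^ (d r i) {{d≢0 r i}} (x r))
      (R.^-mono-≤ (<⇒≤ 0ℝ 1ℝ 0<1ℝ) {roots r i} {v} (root-nonNeg (d r i) {{d≢0 r i}} (x r))
        (≤-trans (roots r i) (V r) v (≤-maximum (roots r) i) Vr≤v) (d r i)))))
  where
  x : Fin t → ℝ
  x r = A * reciprocal (c r) (0<c r)

  roots : Fin t → Vector ℝ ℓ
  roots r i = root (d r i) {{d≢0 r i}} (x r)

  V : Vector ℝ t
  V r = maximum (roots r)

module SignIndicesProperties {n} (a : Vector ℝ (suc n)) (s : SignIndices a) where

  j-injective : Injective _≡_ _≡_ (SignIndices.j s)
  j-injective {i} {i′} e with Finₚ.<-cmp i i′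
  ... | tri< i<i′ _ _ = ⊥-elim (ℕₚ.<-irrefl (≡.cong toℕ e) (SignIndices.j-increasing s i<i′))
  ... | tri≈ _ i≡i′ _ = i≡i′
  ... | tri> _ _ i′<i = ⊥-elim (ℕₚ.<-irrefl (≡.cong toℕ (≡.sym e)) (SignIndices.j-increasing s i′<i))

  nonNeg-off-j : ∀ m → (∀ i → SignIndices.j s i ≢ m) → 0ℝ ≤ a m
  nonNeg-off-j m j≢m = ≮⇒≥ (a m) 0ℝ λ a<0 → let (i , e) = Equivalence.from (SignIndices.j-enumerates s m) a<0 in j≢m i e

  v-bound : ¬ ¬ ∃ λ r → 0ℝ ≤ SignIndices.v s × ∀ i →
            ∣ ℝ-Sum.sum (λ i′ → a (SignIndices.j s i′)) ∣ ≤ a (SignIndices.k s r) * (SignIndices.v s R.^ (toℕ (SignIndices.k s r) ℕ.∸ toℕ (SignIndices.j s i)))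
  v-bound = root-bound (λ r i → toℕ (SignIndices.k s r) ℕ.∸ toℕ (SignIndices.j s i)) (λ r i → ℕ.>-nonZero (ℕₚ.m<n⇒0<n∸m (SignIndices.k-beyond s r i)))
    ∣ ℝ-Sum.sum (λ i′ → a (SignIndices.j s i′)) ∣ (λ r → a (SignIndices.k s r)) (SignIndices.k-positive s) (SignIndices.v s) ≡.refl

-- E stands for exp-i; as a parameter it keeps conversion checking from unfolding the power series.
module Sectors (n : ℕ) .{{_ : NonZero n}} (π θ : ℝ) (nθ≈π : n ×ᵣ θ ≈ π) (E : ℝ → ℂ)
  (E-+ : ∀ x y → E (x + y) ≈ᶜ E x *ᶜ E y) (E-≈0 : ∀ x → x ≈ 0ℝ → E x ≈ᶜ 1ᶜ)
  (E-odd : ∀ x y → (∀ n → seq y n ≡ ℚ.- seq x n) → im (E y) ≈ - im (E x))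
  (E-pos : ∀ x → 0ℝ < x → x < π → 0ℝ < im (E x)) where

  E-multiple-pos : ∀ φ → 0ℝ < φ → φ < θ → ∀ m → m ℕ.< n → 0ℝ < im (E (suc m ×ᵣ φ))
  E-multiple-pos φ 0<φ φ<θ m m<n = E-pos (suc m ×ᵣ φ) (×-pos φ 0<φ m)
    (<-≤-trans (suc m ×ᵣ φ) (n ×ᵣ θ) π
      (×-mono-< φ θ (<⇒≤ 0ℝ θ (<-≤-trans 0ℝ φ θ 0<φ (<⇒≤ φ θ φ<θ))) φ<θ m<n)
      (≈⇒≤ (n ×ᵣ θ) π nθ≈π))

  module _ (ρ φ : ℝ) (0<ρ : 0ℝ < ρ) (∣φ∣<θ : ∣ φ ∣ < θ) where

    w : ℂ
    w = fromℝ ρ *ᶜ E φ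

    polar-pos : ∀ {L} → IsLinearFunctional L → ∀ m → 0ℝ < L (E (m ×ᵣ φ)) → 0ℝ < L (w ^ᶜ m)
    polar-pos {L} L-linear = P.polar-pos fromℝ-* (C.refl {1ᶜ})
      w ρ (λ m → E (m ×ᵣ φ)) (E φ) (E-≈0 0ℝ (≈-refl 0ℝ)) (λ m → E-+ φ (m ×ᵣ φ)) (C.refl {w}) {L} L-linear 0<1ℝ 0<ρ

    IsPositiveOnPowers : (ℂ → ℝ) → Set
    IsPositiveOnPowers L = IsLinearFunctional L × 0ℝ ≤ L 1ᶜ × (∀ m → m ℕ.< n → 0ℝ < L (w ^ᶜ suc m))

    im-positive : 0ℝ < φ → IsPositiveOnPowers im
    im-positive 0<φ = im-linear , ≤-refl 0ℝ , λ m m<n → polar-pos {im} im-linear (suc m)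
      (E-multiple-pos φ 0<φ (≤-<-trans φ ∣ φ ∣ θ (≤-∣∣ φ) ∣φ∣<θ) m m<n)

    -- By reflection: multiples of -φ have positive sine, and oddness carries this over to -Im at
    -- multiples of φ.
    -im-positive : 0ℝ < - φ → IsPositiveOnPowers -im
    -im-positive 0<-φ = -im-linear , ≤-refl 0ℝ , λ m m<n → polar-pos { -im} -im-linear (suc m)
      (<-≤-trans 0ℝ (im (E (suc m ×ᵣ (- φ)))) (- im (E (suc m ×ᵣ φ)))
        (E-multiple-pos (- φ) 0<-φ (≤-<-trans (- φ) ∣ φ ∣ θ (neg-≤-∣∣ φ) ∣φ∣<θ) m m<n)
        (≈⇒≤ (im (E (suc m ×ᵣ (- φ)))) (- im (E (suc m ×ᵣ φ))) (E-odd (suc m ×ᵣ φ) (suc m ×ᵣ (- φ)) (seq-×-neg (suc m) φ))))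

    -- Here w is a positive real up to `≈`, so imaginary parts say nothing, while every E (mφ) has
    -- real part 1.
    re-positive : φ ≈ 0ℝ → IsPositiveOnPowers re
    re-positive φ≈0 = re-linear , <⇒≤ 0ℝ 1ℝ 0<1ℝ , λ m m<n → polar-pos {re} re-linear (suc m)
      (<-≤-trans 0ℝ 1ℝ (re (E (suc m ×ᵣ φ))) 0<1ℝ
        (≈⇒≤ 1ℝ (re (E (suc m ×ᵣ φ))) (≈-sym (re (E (suc m ×ᵣ φ))) 1ℝ (proj₁ (E-≈0 (suc m ×ᵣ φ) (multiple≈0 (suc m)))))))
      where
      multiple≈0 : ∀ m → m ×ᵣ φ ≈ 0ℝ
      multiple≈0 zero    = ≈-refl 0ℝ
      multiple≈0 (suc m) = +-cong φ 0ℝ (m ×ᵣ φ) 0ℝ φ≈0 (multiple≈0 m)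

    -- Refuting both φ > 0 and -φ > 0 yields φ ≤ 0 and -φ ≤ 0, hence φ ≈ 0, where Re works:
    -- trichotomy in its double-negated form.
    some-positive : ¬ ¬ ∃ IsPositiveOnPowers
    some-positive ¬h = ¬h (re , re-positive (≈0 φ
      (≮⇒≥ 0ℝ φ λ 0<φ → ¬h (im , im-positive 0<φ))
      (≮⇒≥ 0ℝ (- φ) λ 0<-φ → ¬h (-im , -im-positive 0<-φ))))

    sector-zero-free : (a : Vector ℝ (suc n)) → 0ℝ < a (fromℕ n) → (s : SignIndices a) →
                       ∀ z → z ≈ᶜ (fromℝ (SignIndices.v s) +ᶜ w) → ¬ (evaluate a z ≈ᶜ 0ℂ)
    sector-zero-free a 0<aₙ s z z≈v+w f≈0 =
      v-bound λ (r , 0≤v , A≤) →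
      some-positive λ (L , L-linear , 0≤L1 , 0<Lw^) →
      P.evaluate≉0 {L} L-linear v 0≤v n z w z≈v+w 0≤L1 0<Lw^ a 0<aₙ j j-injective nonNeg-off-j
        (λ i → - a (j i)) (λ i → neg-pos (a (j i)) (Equivalence.to (j-enumerates (j i)) (i , ≡.refl)))
        (λ i → ≈-pointwise (- a (j i) + a (j i)) 0ℝ λ n → ℚₚ.+-inverseˡ (seq (a (j i)) n))
        (k r) (k-beyond r) (k-positive r)
        (λ i → ≤-trans (R.sum (λ i → - a (j i))) A (a (k r) * (v R.^ (toℕ (k r) ℕ.∸ toℕ (j i)))) (sum-neg-≤ (λ i → a (j i))) (A≤ i))
        (≡.subst (_≈ᶜ 0ℂ) (evaluate≡evaluateᶜ a z) f≈0)
      where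
      open SignIndices s
      open SignIndicesProperties a s
      A : ℝ
      A = ∣ R.sum (λ i → a (j i)) ∣

theorem2p8 : (n : ℕ) .{{_ : NonZero n}} (a : Vector ℝ (suc n)) →
    0ℝ < a (fromℕ n) →
    (s : SignIndices a) →
    (π : ℝ) → IsPi π →
    (z : ℂ) → Sector (SignIndices.v s) (π /ℕ n) z →
    ¬ (evaluate a z ≈ᶜ 0ℂ)
theorem2p8 n {{n≢0}} a 0<aₙ s π isPi z (ρ , φ , 0<ρ , ∣φ∣<π/n , z≈v+w) =
  Sectors.sector-zero-free n π (_/ℕ_ π n {{n≢0}}) (×-/ℕ n {{n≢0}} π) exp-i exp-i-+ exp-i-≈0 sin-neg (IsPi.sin-pos isPi) ρ φ 0<ρ ∣φ∣<π/n a 0<aₙ s z z≈v+w
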